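{- Consider Quickselect with dual-pivot (YBB) partitioning into three segments, without pivot sampling (the two pivots are two random elements), where the expected cost of one partitioning round on $n$ elements is $a\,n\pm O(1)$ for a constant $a$ (independent of the sought rank). Let $F_{n,m}$ be the random cost of selecting the $m$th smallest of $n$ elements. Then for $\alpha\in(0,1)$ $$\lim_{n\to\infty,\ \frac mn\to\alpha}\frac{\mathbb E[F_{n,m}]}{n} = a\Bigl(\frac32+h(\alpha)\Bigr),\qquad h(\alpha)=-\alpha\ln\alpha-(1-\alpha)\ln(1-\alpha).$$
   Context: The input consists of $n$ distinct elements in random order. In each step the algorithm picks two random elements as pivots, partitions the input into three segments around them, and recurses only into the segment that contains the sought element (it stops if that element is a pivot). Formally, there is a constant $n_0$ such that costs are $O(1)$ for $n<n_0$, and for $n\ge n_0$, $1\le m\le n$, $$F_{n,m}\ \stackrel{\mathcal D}{=}\ A_{\mathcal F}(n)+\sum_{\ell=1}^3\mathbf 1_{\{R_{\ell-1}<m<R_\ell\}}\,F^{(\ell)}_{J_\ell,\,m-R_{\ell-1}},$$ where $A_{\mathcal F}(n)$ is the random cost of the first partitioning round, with $\mathbb E[A_{\mathcal F}(n)]=a\,n\pm O(1)$; $\{R_1<R_2\}$ is a uniformly random 2-element subset of $\{1,\dots,n\}$ (the pivot ranks); $R_0=0$, $R_3=n+1$; and $J_\ell=R_\ell-R_{\ell-1}-1$. The families $(F^{(\ell)}_{n,m})_{n,m}$, $\ell=1,2,3$, are independent copies of $(F_{n,m})_{n,m}$, also independent of $(R_1,R_2)$ and $A_{\mathcal F}(n)$.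 The notation $g=f\pm O(e)$ means $|g-f|=O(|e|)$. -}

module Defs where

import Algebra.Definitions.RawSemiring as RawSemiring
open import Data.Fin.Base using (Fin; zero; suc; inject₁)
open import Data.Integer.Base using (+_)
import Data.Integer.Base as ℤ
import Data.Integer.Properties as ℤₚ
open import Data.Nat.Base using (ℕ; zero; suc)
import Data.Nat.Base as ℕ
import Data.Nat.Properties as ℕₚ
open import Data.Nat.Combinatorics using (_C_)
open import Data.Product.Base using (Σ-syntax; ∃-syntax; _×_; _,_; proj₁; proj₂)
open import Data.Rational.Base using (ℚ; 0ℚ; 1ℚ; ½)
import Data.Rational.Base as ℚ
import Data.Rational.Properties as ℚₚ
open RawSemiring ℚ.+-*-rawSemiring using (_^_)
open import Data.Rational.Solver using (module +-*-Solver)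
import Data.Rational.Unnormalised.Base as ℚᵘ
open import Data.Sum.Base using (inj₁; inj₂)
open import Data.Unit.Base using (⊤; tt)
open import Data.Vec.Functional using (foldr; []; _∷_)
open import Function.Bundles using (_⇔_)
open import Relation.Binary.PropositionalEquality
  using (_≡_; refl; sym; trans; cong; cong₂; subst)
open import Relation.Nullary.Decidable.Core using (Dec; yes; no; _×-dec_)

------------------------------------------------------------------------
-- Rational estimates used to build the real operations

private
  module _ where
    open +-*-Solver

    *-mono : ∀ {p q r s} → 0ℚ ℚ.≤ r → 0ℚ ℚ.≤ q →
             p ℚ.≤ q → r ℚ.≤ s → p ℚ.* r ℚ.≤ q ℚ.* s
    *-mono {p} {q} {r} {s} 0≤r 0≤q p≤q r≤s = ℚₚ.≤-trans
      (ℚₚ.*-monoʳ-≤-nonNeg r {{ℚ.nonNegative 0≤r}} p≤q)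
      (ℚₚ.*-monoˡ-≤-nonNeg q {{ℚ.nonNegative 0≤q}} r≤s)

    *-nonNeg : ∀ {p q} → 0ℚ ℚ.≤ p → 0ℚ ℚ.≤ q → 0ℚ ℚ.≤ p ℚ.* q
    *-nonNeg {p} {q} 0≤p 0≤q = subst (ℚ._≤ p ℚ.* q) (ℚₚ.*-zeroˡ q)
      (ℚₚ.*-monoʳ-≤-nonNeg q {{ℚ.nonNegative 0≤q}} 0≤p)

    rescale : ∀ K ε → 0ℚ ℚ.< K → 0ℚ ℚ.< ε →
              ∃[ δ ] 0ℚ ℚ.< δ × K ℚ.* δ ≡ ε
    rescale K ε 0<K 0<ε =
      K⁻¹ ℚ.* ε
      , ℚₚ.positive⁻¹ _ {{ℚₚ.pos*pos⇒pos K⁻¹ {{ℚₚ.1/pos⇒pos K}} ε {{ℚ.positive 0<ε}}}}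
      , trans (sym (ℚₚ.*-assoc K K⁻¹ ε))
          (trans (cong (ℚ._* ε) (ℚₚ.*-inverseʳ K {{K≢0}})) (ℚₚ.*-identityˡ ε))
      where
      instance
        K>0 = ℚ.positive 0<K
      K≢0 = ℚₚ.pos⇒nonZero K
      K⁻¹ = (ℚ.1/ K) {{K≢0}}

    half : ∀ ε → 0ℚ ℚ.< ε → 0ℚ ℚ.< ½ ℚ.* ε
    half ε 0<ε = ℚₚ.positive⁻¹ _ {{ℚₚ.pos*pos⇒pos ½ ε {{ℚ.positive 0<ε}}}}

    half+half : ∀ ε → ½ ℚ.* ε ℚ.+ ½ ℚ.* ε ≡ ε
    half+half ε = trans (sym (ℚₚ.*-distribʳ-+ ε ½ ½)) (ℚₚ.*-identityˡ ε)

    cancel : ∀ p q r → p ℚ.- r ≡ (p ℚ.- q) ℚ.+ (q ℚ.- r)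
    cancel = solve 3 (λ p q r → p :- r := (p :- q) :+ (q :- r)) refl

    triangle : ∀ p q r → ℚ.∣ p ℚ.- r ∣ ℚ.≤ ℚ.∣ p ℚ.- q ∣ ℚ.+ ℚ.∣ q ℚ.- r ∣
    triangle p q r = subst (λ t → ℚ.∣ t ∣ ℚ.≤ ℚ.∣ p ℚ.- q ∣ ℚ.+ ℚ.∣ q ℚ.- r ∣)
      (sym (cancel p q r)) (ℚₚ.∣p+q∣≤∣p∣+∣q∣ (p ℚ.- q) (q ℚ.- r))

    neg-diff : ∀ p q → (ℚ.- p) ℚ.- (ℚ.- q) ≡ ℚ.- (p ℚ.- q)
    neg-diff = solve 2 (λ p q → (:- p) :- (:- q) := :- (p :- q)) refl

    swap-diff : ∀ p q → ℚ.∣ p ℚ.- q ∣ ≡ ℚ.∣ q ℚ.- p ∣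
    swap-diff p q = trans
      (cong ℚ.∣_∣ (solve 2 (λ p q → p :- q := :- (q :- p)) refl p q))
      (ℚₚ.∣-p∣≡∣p∣ (q ℚ.- p))

    p≤∣p∣ : ∀ p → p ℚ.≤ ℚ.∣ p ∣
    p≤∣p∣ p with ℚₚ.≤-total 0ℚ p
    ... | inj₁ 0≤p = ℚₚ.≤-reflexive (sym (ℚₚ.0≤p⇒∣p∣≡p 0≤p))
    ... | inj₂ p≤0 = ℚₚ.≤-trans p≤0 (ℚₚ.0≤∣p∣ p)

    p-q≤r⇒p≤r+q : ∀ {p q r} → p ℚ.- q ℚ.≤ r → p ℚ.≤ r ℚ.+ q
    p-q≤r⇒p≤r+q {p} {q} h = subst (ℚ._≤ _)
      (solve 2 (λ p q → p :- q :+ q := p) refl p q) (ℚₚ.+-monoˡ-≤ q h)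

    p≤r+q⇒p-q≤r : ∀ {p q r} → p ℚ.≤ r ℚ.+ q → p ℚ.- q ℚ.≤ r
    p≤r+q⇒p-q≤r {p} {q} {r} h = subst (_ ℚ.≤_)
      (solve 2 (λ q r → r :+ q :- q := r) refl q r) (ℚₚ.+-monoˡ-≤ (ℚ.- q) h)

    ∣∣-≤ : ∀ {p r} → p ℚ.≤ r → ℚ.- p ℚ.≤ r → ℚ.∣ p ∣ ℚ.≤ r
    ∣∣-≤ {p} {r} h₁ h₂ with ℚₚ.∣p∣≡p∨∣p∣≡-p p
    ... | inj₁ e = subst (ℚ._≤ r) (sym e) h₁
    ... | inj₂ e = subst (ℚ._≤ r) (sym e) h₂

    reverse-triangle : ∀ p q → ℚ.∣ ℚ.∣ p ∣ ℚ.- ℚ.∣ q ∣ ∣ ℚ.≤ ℚ.∣ p ℚ.- q ∣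
    reverse-triangle p q = ∣∣-≤ (one p q)
      (subst (ℚ._≤ ℚ.∣ p ℚ.- q ∣)
        (solve 2 (λ a b → b :- a := :- (a :- b)) refl ℚ.∣ p ∣ ℚ.∣ q ∣)
        (subst (ℚ.∣ q ∣ ℚ.- ℚ.∣ p ∣ ℚ.≤_) (swap-diff q p) (one q p)))
      where
      one : ∀ p q → ℚ.∣ p ∣ ℚ.- ℚ.∣ q ∣ ℚ.≤ ℚ.∣ p ℚ.- q ∣
      one p q = p≤r+q⇒p-q≤r (subst (λ t → ℚ.∣ t ∣ ℚ.≤ ℚ.∣ p ℚ.- q ∣ ℚ.+ ℚ.∣ q ∣)
        (solve 2 (λ p q → p :- q :+ q := p) refl p q) (ℚₚ.∣p+q∣≤∣p∣+∣q∣ (p ℚ.- q) q))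

    product-diff : ∀ a b c d {B δ} →
      ℚ.∣ a ∣ ℚ.≤ B → ℚ.∣ d ∣ ℚ.≤ B → ℚ.∣ a ℚ.- c ∣ ℚ.≤ δ → ℚ.∣ b ℚ.- d ∣ ℚ.≤ δ →
      ℚ.∣ a ℚ.* b ℚ.- c ℚ.* d ∣ ℚ.≤ (B ℚ.+ B) ℚ.* δ
    product-diff a b c d {B} {δ} a≤B d≤B ac≤δ bd≤δ = begin
      ℚ.∣ a ℚ.* b ℚ.- c ℚ.* d ∣
        ≡⟨ cong ℚ.∣_∣ (solve 4 (λ a b c d →
             a :* b :- c :* d := a :* (b :- d) :+ d :* (a :- c)) refl a b c d) ⟩
      ℚ.∣ a ℚ.* (b ℚ.- d) ℚ.+ d ℚ.* (a ℚ.- c) ∣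
        ≤⟨ ℚₚ.∣p+q∣≤∣p∣+∣q∣ (a ℚ.* (b ℚ.- d)) (d ℚ.* (a ℚ.- c)) ⟩
      ℚ.∣ a ℚ.* (b ℚ.- d) ∣ ℚ.+ ℚ.∣ d ℚ.* (a ℚ.- c) ∣
        ≡⟨ cong₂ ℚ._+_ (ℚₚ.∣p*q∣≡∣p∣*∣q∣ a (b ℚ.- d)) (ℚₚ.∣p*q∣≡∣p∣*∣q∣ d (a ℚ.- c)) ⟩
      ℚ.∣ a ∣ ℚ.* ℚ.∣ b ℚ.- d ∣ ℚ.+ ℚ.∣ d ∣ ℚ.* ℚ.∣ a ℚ.- c ∣
        ≤⟨ ℚₚ.+-mono-≤
             (*-mono (ℚₚ.0≤∣p∣ (b ℚ.- d)) 0≤B a≤B bd≤δ)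
             (*-mono (ℚₚ.0≤∣p∣ (a ℚ.- c)) 0≤B d≤B ac≤δ) ⟩
      B ℚ.* δ ℚ.+ B ℚ.* δ
        ≡⟨ ℚₚ.*-distribʳ-+ δ B B ⟨
      (B ℚ.+ B) ℚ.* δ ∎
      where
      open ℚₚ.≤-Reasoning
      0≤B = ℚₚ.≤-trans (ℚₚ.0≤∣p∣ a) a≤B

------------------------------------------------------------------------
-- Real numbers as Cauchy sequences of rationals

IsCauchy : (ℕ → ℚ) → Set
IsCauchy s = ∀ ε → 0ℚ ℚ.< ε →
  ∃[ N ] ∀ m n → N ℕ.≤ m → N ℕ.≤ n → ℚ.∣ s m ℚ.- s n ∣ ℚ.≤ ε

record ℝ : Set where
  constructor mkℝ
  field
    seq    : ℕ → ℚ
    cauchy : IsCauchy seq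

open ℝ

infix  4 _≈_ _≤_ _<_
infixl 6 _+_ _-_
infixl 7 _*_
infix  8 -_

_≈_ : ℝ → ℝ → Set
x ≈ y = ∀ ε → 0ℚ ℚ.< ε →
  ∃[ N ] ∀ n → N ℕ.≤ n → ℚ.∣ seq x n ℚ.- seq y n ∣ ℚ.≤ ε

_≤_ : ℝ → ℝ → Set
x ≤ y = ∀ ε → 0ℚ ℚ.< ε →
  ∃[ N ] ∀ n → N ℕ.≤ n → seq x n ℚ.≤ seq y n ℚ.+ ε

_<_ : ℝ → ℝ → Set
x < y = ∃[ ε ] 0ℚ ℚ.< ε ×
  ∃[ N ] ∀ n → N ℕ.≤ n → seq x n ℚ.+ ε ℚ.≤ seq y n

private
  abstract
    const-cauchy : ∀ q → IsCauchy (λ _ → q)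
    const-cauchy q ε 0<ε =
      0 , λ _ _ _ _ → subst (ℚ._≤ ε) (cong ℚ.∣_∣ (sym (ℚₚ.+-inverseʳ q))) (ℚₚ.<⇒≤ 0<ε)

    +-cauchy : ∀ x y → IsCauchy (λ n → seq x n ℚ.+ seq y n)
    +-cauchy x y ε 0<ε =
      let (M , x-close) = cauchy x (½ ℚ.* ε) (half ε 0<ε)
          (N , y-close) = cauchy y (½ ℚ.* ε) (half ε 0<ε)
          open ℚₚ.≤-Reasoning
          open +-*-Solver
      in M ℕ.⊔ N , λ m n m≥ n≥ → begin
        ℚ.∣ (seq x m ℚ.+ seq y m) ℚ.- (seq x n ℚ.+ seq y n) ∣
          ≡⟨ cong ℚ.∣_∣ (solve 4 (λ a b c d →
               (a :+ b) :- (c :+ d) := (a :- c) :+ (b :- d)) refl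
               (seq x m) (seq y m) (seq x n) (seq y n)) ⟩
        ℚ.∣ (seq x m ℚ.- seq x n) ℚ.+ (seq y m ℚ.- seq y n) ∣
          ≤⟨ ℚₚ.∣p+q∣≤∣p∣+∣q∣ (seq x m ℚ.- seq x n) (seq y m ℚ.- seq y n) ⟩
        ℚ.∣ seq x m ℚ.- seq x n ∣ ℚ.+ ℚ.∣ seq y m ℚ.- seq y n ∣
          ≤⟨ ℚₚ.+-mono-≤
               (x-close m n (ℕₚ.m⊔n≤o⇒m≤o M N m≥) (ℕₚ.m⊔n≤o⇒m≤o M N n≥))
               (y-close m n (ℕₚ.m⊔n≤o⇒n≤o M N m≥) (ℕₚ.m⊔n≤o⇒n≤o M N n≥)) ⟩
        ½ ℚ.* ε ℚ.+ ½ ℚ.* ε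
          ≡⟨ half+half ε ⟩
        ε ∎

    neg-cauchy : ∀ x → IsCauchy (λ n → ℚ.- seq x n)
    neg-cauchy x ε 0<ε =
      let (N , close) = cauchy x ε 0<ε
      in N , λ m n m≥ n≥ → subst (ℚ._≤ ε)
        (sym (trans (cong ℚ.∣_∣ (neg-diff (seq x m) (seq x n)))
                    (ℚₚ.∣-p∣≡∣p∣ (seq x m ℚ.- seq x n))))
        (close m n m≥ n≥)

    ∣∣-cauchy : ∀ x → IsCauchy (λ n → ℚ.∣ seq x n ∣)
    ∣∣-cauchy x ε 0<ε =
      let (N , close) = cauchy x ε 0<ε
      in N , λ m n m≥ n≥ →
        ℚₚ.≤-trans (reverse-triangle (seq x m) (seq x n)) (close m n m≥ n≥)

    eventual-bound : ∀ x → ∃[ B ] 0ℚ ℚ.< B × ∃[ N ] ∀ n → N ℕ.≤ n → ℚ.∣ seq x n ∣ ℚ.≤ B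
    eventual-bound x =
      let (N , close) = cauchy x 1ℚ (ℚₚ.positive⁻¹ 1ℚ)
      in 1ℚ ℚ.+ ℚ.∣ seq x N ∣
       , ℚₚ.+-mono-<-≤ (ℚₚ.positive⁻¹ 1ℚ) (ℚₚ.0≤∣p∣ (seq x N))
       , N , λ n n≥ → p-q≤r⇒p≤r+q (ℚₚ.≤-trans
           (p≤∣p∣ (ℚ.∣ seq x n ∣ ℚ.- ℚ.∣ seq x N ∣))
           (ℚₚ.≤-trans (reverse-triangle (seq x n) (seq x N)) (close n N n≥ ℕₚ.≤-refl)))

    *-cauchy : ∀ x y → IsCauchy (λ n → seq x n ℚ.* seq y n)
    *-cauchy x y ε 0<ε =
      let (Bx , Bx>0 , Nx , x-bound) = eventual-bound x
          (By , By>0 , Ny , y-bound) = eventual-bound y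
          B = Bx ℚ.+ By
          B>0 = ℚₚ.+-mono-< Bx>0 By>0
          (δ , δ>0 , δ-eq) = rescale (B ℚ.+ B) ε (ℚₚ.+-mono-< B>0 B>0) 0<ε
          (Mx , x-close) = cauchy x δ δ>0
          (My , y-close) = cauchy y δ δ>0
          N = (Nx ℕ.⊔ Ny) ℕ.⊔ (Mx ℕ.⊔ My)
      in N , λ m n m≥ n≥ →
        let m≥N₁ = ℕₚ.m⊔n≤o⇒m≤o (Nx ℕ.⊔ Ny) (Mx ℕ.⊔ My) m≥
            n≥N₁ = ℕₚ.m⊔n≤o⇒m≤o (Nx ℕ.⊔ Ny) (Mx ℕ.⊔ My) n≥
            m≥N₂ = ℕₚ.m⊔n≤o⇒n≤o (Nx ℕ.⊔ Ny) (Mx ℕ.⊔ My) m≥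
            n≥N₂ = ℕₚ.m⊔n≤o⇒n≤o (Nx ℕ.⊔ Ny) (Mx ℕ.⊔ My) n≥
        in subst (ℚ.∣ seq x m ℚ.* seq y m ℚ.- seq x n ℚ.* seq y n ∣ ℚ.≤_) δ-eq
          (product-diff (seq x m) (seq y m) (seq x n) (seq y n)
            (ℚₚ.≤-trans (x-bound m (ℕₚ.m⊔n≤o⇒m≤o Nx Ny m≥N₁))
              (subst (ℚ._≤ B) (ℚₚ.+-identityʳ Bx) (ℚₚ.+-monoʳ-≤ Bx (ℚₚ.<⇒≤ By>0))))
            (ℚₚ.≤-trans (y-bound n (ℕₚ.m⊔n≤o⇒n≤o Nx Ny n≥N₁))
              (subst (ℚ._≤ B) (ℚₚ.+-identityˡ By) (ℚₚ.+-monoˡ-≤ By (ℚₚ.<⇒≤ Bx>0))))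
            (x-close m n (ℕₚ.m⊔n≤o⇒m≤o Mx My m≥N₂) (ℕₚ.m⊔n≤o⇒m≤o Mx My n≥N₂))
            (y-close m n (ℕₚ.m⊔n≤o⇒n≤o Mx My m≥N₂) (ℕₚ.m⊔n≤o⇒n≤o Mx My n≥N₂)))

fromℚ : ℚ → ℝ
fromℚ q = mkℝ (λ _ → q) (const-cauchy q)

fromℕ : ℕ → ℝ
fromℕ n = fromℚ (+ n ℚ./ 1)

0ℝ 1ℝ : ℝ
0ℝ = fromℚ 0ℚ
1ℝ = fromℚ 1ℚ

_+_ : ℝ → ℝ → ℝ
x + y = mkℝ (λ n → seq x n ℚ.+ seq y n) (+-cauchy x y)

_*_ : ℝ → ℝ → ℝ
x * y = mkℝ (λ n → seq x n ℚ.* seq y n) (*-cauchy x y)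

-_ : ℝ → ℝ
- x = mkℝ (λ n → ℚ.- seq x n) (neg-cauchy x)

_-_ : ℝ → ℝ → ℝ
x - y = x + (- y)

∣_∣ : ℝ → ℝ
∣ x ∣ = mkℝ (λ n → ℚ.∣ seq x n ∣) (∣∣-cauchy x)

∑ ∏ : ∀ {k} → (Fin k → ℝ) → ℝ
∑ = foldr _+_ 0ℝ
∏ = foldr _*_ 1ℝ

------------------------------------------------------------------------
-- Natural logarithm on (0,1)

-- mercator n u = u + u²/2 + … + uⁿ/n, the partial sums of - ln (1 - u).
mercator : ℕ → ℚ → ℚ
mercator zero    u = 0ℚ
mercator (suc n) u = mercator n u ℚ.+ (u ^ suc n) ℚ.* (+ 1 ℚ./ suc n)

private
  module Convergence (c : ℚ) (0<c : 0ℚ ℚ.< c) (c≤1 : c ℚ.≤ 1ℚ) where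
    open +-*-Solver
    open ℚₚ.≤-Reasoning

    ρ : ℚ
    ρ = 1ℚ ℚ.- c

    0≤ρ : 0ℚ ℚ.≤ ρ
    0≤ρ = subst (ℚ._≤ ρ) (ℚₚ.+-inverseʳ c) (ℚₚ.+-monoˡ-≤ (ℚ.- c) c≤1)

    ρ≤1 : ρ ℚ.≤ 1ℚ
    ρ≤1 = p≤r+q⇒p-q≤r {q = c} (subst (ℚ._≤ 1ℚ ℚ.+ c) (ℚₚ.+-identityʳ 1ℚ)
      (ℚₚ.+-monoʳ-≤ 1ℚ (ℚₚ.<⇒≤ 0<c)))

    K : ℚ
    K = proj₁ (rescale c 1ℚ 0<c (ℚₚ.positive⁻¹ 1ℚ))

    0<K : 0ℚ ℚ.< K
    0<K = proj₁ (proj₂ (rescale c 1ℚ 0<c (ℚₚ.positive⁻¹ 1ℚ)))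

    c*K≡1 : c ℚ.* K ≡ 1ℚ
    c*K≡1 = proj₂ (proj₂ (rescale c 1ℚ 0<c (ℚₚ.positive⁻¹ 1ℚ)))

    ^-nonNeg : ∀ {u} n → 0ℚ ℚ.≤ u → 0ℚ ℚ.≤ u ^ n
    ^-nonNeg zero    0≤u = ℚₚ.nonNegative⁻¹ 1ℚ
    ^-nonNeg (suc n) 0≤u = *-nonNeg 0≤u (^-nonNeg n 0≤u)

    ^-mono : ∀ {u} n → 0ℚ ℚ.≤ u → u ℚ.≤ ρ → u ^ n ℚ.≤ ρ ^ n
    ^-mono zero    0≤u u≤ρ = ℚₚ.≤-refl
    ^-mono (suc n) 0≤u u≤ρ = *-mono (^-nonNeg n 0≤u) 0≤ρ u≤ρ (^-mono n 0≤u u≤ρ)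

    ρ^-anti : ∀ n → ρ ^ suc n ℚ.≤ ρ ^ n
    ρ^-anti n = subst (ρ ^ suc n ℚ.≤_) (ℚₚ.*-identityˡ (ρ ^ n))
      (ℚₚ.*-monoʳ-≤-nonNeg (ρ ^ n) {{ℚ.nonNegative (^-nonNeg n 0≤ρ)}} ρ≤1)

    geometric : ℕ → ℚ
    geometric zero    = 0ℚ
    geometric (suc n) = geometric n ℚ.+ ρ ^ n

    geometric-closed : ∀ n → c ℚ.* geometric n ≡ 1ℚ ℚ.- ρ ^ n
    geometric-closed zero    = ℚₚ.*-zeroʳ c
    geometric-closed (suc n) = begin-equality
      c ℚ.* (geometric n ℚ.+ ρ ^ n)       ≡⟨ ℚₚ.*-distribˡ-+ c (geometric n) (ρ ^ n) ⟩
      c ℚ.* geometric n ℚ.+ c ℚ.* ρ ^ n   ≡⟨ cong (ℚ._+ c ℚ.* ρ ^ n) (geometric-closed n) ⟩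
      (1ℚ ℚ.- ρ ^ n) ℚ.+ c ℚ.* ρ ^ n      ≡⟨ solve 2 (λ c r →
        (con 1ℚ :- r) :+ c :* r := con 1ℚ :- (con 1ℚ :- c) :* r) refl c (ρ ^ n) ⟩
      1ℚ ℚ.- ρ ^ suc n                    ∎

    geometric≤K : ∀ n → geometric n ℚ.≤ K
    geometric≤K n = ℚₚ.*-cancelˡ-≤-pos c {{ℚ.positive 0<c}} (begin
      c ℚ.* geometric n ≡⟨ geometric-closed n ⟩
      1ℚ ℚ.- ρ ^ n      ≤⟨ p≤r+q⇒p-q≤r {q = ρ ^ n} (subst (ℚ._≤ 1ℚ ℚ.+ ρ ^ n) (ℚₚ.+-identityʳ 1ℚ)
                             (ℚₚ.+-monoʳ-≤ 1ℚ (^-nonNeg n 0≤ρ))) ⟩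
      1ℚ                ≡⟨ c*K≡1 ⟨
      c ℚ.* K           ∎)

    suc/1 : ∀ n → + suc n ℚ./ 1 ≡ 1ℚ ℚ.+ (+ n ℚ./ 1)
    suc/1 n = ℚₚ.toℚᵘ-injective (≃-trans (ℚₚ.toℚᵘ-fromℚᵘ (ℚᵘ.mkℚᵘ (+ suc n) 0))
      (≃-trans (ℚᵘ.*≡* (solveℤ n))
        (≃-sym (≃-trans (ℚₚ.toℚᵘ-homo-+ 1ℚ (+ n ℚ./ 1))
          (+-congʳ (ℚ.toℚᵘ 1ℚ) (ℚₚ.toℚᵘ-fromℚᵘ (ℚᵘ.mkℚᵘ (+ n) 0)))))))
      where
      open import Data.Rational.Unnormalised.Properties using (≃-trans; ≃-sym; +-congʳ)
      solveℤ : ∀ n → + suc n ℤ.* + 1 ≡ (+ 1 ℤ.* + 1 ℤ.+ + n ℤ.* + 1) ℤ.* + 1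
      solveℤ n = cong (ℤ._* + 1) (cong (λ t → + 1 ℤ.+ t) (sym (ℤₚ.*-identityʳ (+ n))))

    suc*1/suc : ∀ n → (+ suc n ℚ./ 1) ℚ.* (+ 1 ℚ./ suc n) ≡ 1ℚ
    suc*1/suc n = ℚₚ.toℚᵘ-injective (≃-trans
      (ℚₚ.toℚᵘ-homo-* (+ suc n ℚ./ 1) (+ 1 ℚ./ suc n))
      (≃-trans (*-cong (ℚₚ.toℚᵘ-fromℚᵘ (ℚᵘ.mkℚᵘ (+ suc n) 0))
                       (ℚₚ.toℚᵘ-fromℚᵘ (ℚᵘ.mkℚᵘ (+ 1) n)))
        (ℚᵘ.*≡* (trans (ℤₚ.*-identityʳ (+ suc n ℤ.* + 1))
          (trans (ℤₚ.*-comm (+ suc n) (+ 1))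
            (cong (λ t → + 1 ℤ.* t) (sym (cong +_ (ℕₚ.*-identityˡ (suc n))))))))))
      where
      open import Data.Rational.Unnormalised.Properties using (≃-trans; *-cong)

    1/suc-nonNeg : ∀ n → 0ℚ ℚ.≤ + 1 ℚ./ suc n
    1/suc-nonNeg n = ℚₚ.nonNegative⁻¹ _ {{ℚₚ.normalize-nonNeg 1 (suc n)}}

    1/suc-anti : ∀ {m n} → m ℕ.≤ n → + 1 ℚ./ suc n ℚ.≤ + 1 ℚ./ suc m
    1/suc-anti {m} {n} m≤n = ℚₚ.toℚᵘ-cancel-≤
      (≤-respˡ-≃ (≃-sym (ℚₚ.toℚᵘ-fromℚᵘ (ℚᵘ.mkℚᵘ (+ 1) n)))
        (≤-respʳ-≃ (≃-sym (ℚₚ.toℚᵘ-fromℚᵘ (ℚᵘ.mkℚᵘ (+ 1) m)))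
          (ℚᵘ.*≤* (ℤₚ.*-monoˡ-≤-nonNeg (+ 1) (ℤ.+≤+ (ℕ.s≤s m≤n))))))
      where
      open import Data.Rational.Unnormalised.Properties using (≃-sym; ≤-respˡ-≃; ≤-respʳ-≃)

    power-lipschitz : ∀ {u v} n → 0ℚ ℚ.≤ u → u ℚ.≤ ρ → 0ℚ ℚ.≤ v → v ℚ.≤ ρ →
      ℚ.∣ u ^ suc n ℚ.- v ^ suc n ∣ ℚ.≤ (+ suc n ℚ./ 1) ℚ.* (ρ ^ n ℚ.* ℚ.∣ u ℚ.- v ∣)
    power-lipschitz {u} {v} zero _ _ _ _ = ℚₚ.≤-reflexive
      (trans (cong ℚ.∣_∣ (cong₂ ℚ._-_ (ℚₚ.*-identityʳ u) (ℚₚ.*-identityʳ v)))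
        (sym (trans (ℚₚ.*-identityˡ _) (ℚₚ.*-identityˡ _))))
    power-lipschitz {u} {v} (suc n) 0≤u u≤ρ 0≤v v≤ρ = begin
      ℚ.∣ u ℚ.* u ^ suc n ℚ.- v ℚ.* v ^ suc n ∣
        ≡⟨ cong ℚ.∣_∣ (solve 4 (λ u p v q →
             u :* p :- v :* q := u :* (p :- q) :+ q :* (u :- v)) refl
             u (u ^ suc n) v (v ^ suc n)) ⟩
      ℚ.∣ u ℚ.* (u ^ suc n ℚ.- v ^ suc n) ℚ.+ v ^ suc n ℚ.* (u ℚ.- v) ∣
        ≤⟨ ℚₚ.∣p+q∣≤∣p∣+∣q∣ (u ℚ.* (u ^ suc n ℚ.- v ^ suc n)) (v ^ suc n ℚ.* (u ℚ.- v)) ⟩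
      ℚ.∣ u ℚ.* (u ^ suc n ℚ.- v ^ suc n) ∣ ℚ.+ ℚ.∣ v ^ suc n ℚ.* (u ℚ.- v) ∣
        ≡⟨ cong₂ ℚ._+_ (ℚₚ.∣p*q∣≡∣p∣*∣q∣ u (u ^ suc n ℚ.- v ^ suc n))
                       (ℚₚ.∣p*q∣≡∣p∣*∣q∣ (v ^ suc n) (u ℚ.- v)) ⟩
      ℚ.∣ u ∣ ℚ.* ℚ.∣ u ^ suc n ℚ.- v ^ suc n ∣ ℚ.+ ℚ.∣ v ^ suc n ∣ ℚ.* D
        ≡⟨ cong₂ (λ a b → a ℚ.* ℚ.∣ u ^ suc n ℚ.- v ^ suc n ∣ ℚ.+ b ℚ.* D)
             (ℚₚ.0≤p⇒∣p∣≡p 0≤u) (ℚₚ.0≤p⇒∣p∣≡p (^-nonNeg (suc n) 0≤v)) ⟩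
      u ℚ.* ℚ.∣ u ^ suc n ℚ.- v ^ suc n ∣ ℚ.+ v ^ suc n ℚ.* D
        ≤⟨ ℚₚ.+-mono-≤
             (*-mono (ℚₚ.0≤∣p∣ _) 0≤ρ u≤ρ (power-lipschitz n 0≤u u≤ρ 0≤v v≤ρ))
             (ℚₚ.*-monoʳ-≤-nonNeg D {{ℚ.nonNegative (ℚₚ.0≤∣p∣ (u ℚ.- v))}}
               (^-mono (suc n) 0≤v v≤ρ)) ⟩
      ρ ℚ.* (k ℚ.* (ρ ^ n ℚ.* D)) ℚ.+ (ρ ℚ.* ρ ^ n) ℚ.* D
        ≡⟨ cong (ρ ℚ.* (k ℚ.* (ρ ^ n ℚ.* D)) ℚ.+_) (sym (ℚₚ.*-identityˡ _)) ⟩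
      ρ ℚ.* (k ℚ.* (ρ ^ n ℚ.* D)) ℚ.+ 1ℚ ℚ.* ((ρ ℚ.* ρ ^ n) ℚ.* D)
        ≡⟨ solve 5 (λ r k p d o → r :* (k :* (p :* d)) :+ o :* ((r :* p) :* d)
             := (o :+ k) :* ((r :* p) :* d)) refl ρ k (ρ ^ n) D 1ℚ ⟩
      (1ℚ ℚ.+ k) ℚ.* ((ρ ℚ.* ρ ^ n) ℚ.* D)
        ≡⟨ cong (ℚ._* ((ρ ℚ.* ρ ^ n) ℚ.* D)) (sym (suc/1 (suc n))) ⟩
      (+ suc (suc n) ℚ./ 1) ℚ.* ((ρ ℚ.* ρ ^ n) ℚ.* D) ∎
      where
      D = ℚ.∣ u ℚ.- v ∣
      k = + suc n ℚ./ 1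

    mercator-lipschitz : ∀ {u v} n → 0ℚ ℚ.≤ u → u ℚ.≤ ρ → 0ℚ ℚ.≤ v → v ℚ.≤ ρ →
      ℚ.∣ mercator n u ℚ.- mercator n v ∣ ℚ.≤ geometric n ℚ.* ℚ.∣ u ℚ.- v ∣
    mercator-lipschitz {u} {v} zero _ _ _ _ =
      ℚₚ.≤-reflexive (sym (ℚₚ.*-zeroˡ ℚ.∣ u ℚ.- v ∣))
    mercator-lipschitz {u} {v} (suc n) 0≤u u≤ρ 0≤v v≤ρ = begin
      ℚ.∣ (mercator n u ℚ.+ u ^ suc n ℚ.* w) ℚ.- (mercator n v ℚ.+ v ^ suc n ℚ.* w) ∣
        ≡⟨ cong ℚ.∣_∣ (solve 5 (λ a p b q w →
             (a :+ p :* w) :- (b :+ q :* w) := (a :- b) :+ (p :- q) :* w) refl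
             (mercator n u) (u ^ suc n) (mercator n v) (v ^ suc n) w) ⟩
      ℚ.∣ (mercator n u ℚ.- mercator n v) ℚ.+ (u ^ suc n ℚ.- v ^ suc n) ℚ.* w ∣
        ≤⟨ ℚₚ.∣p+q∣≤∣p∣+∣q∣ (mercator n u ℚ.- mercator n v) ((u ^ suc n ℚ.- v ^ suc n) ℚ.* w) ⟩
      ℚ.∣ mercator n u ℚ.- mercator n v ∣ ℚ.+ ℚ.∣ (u ^ suc n ℚ.- v ^ suc n) ℚ.* w ∣
        ≤⟨ ℚₚ.+-mono-≤ (mercator-lipschitz n 0≤u u≤ρ 0≤v v≤ρ) step ⟩
      geometric n ℚ.* D ℚ.+ ρ ^ n ℚ.* D
        ≡⟨ ℚₚ.*-distribʳ-+ D (geometric n) (ρ ^ n) ⟨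
      (geometric n ℚ.+ ρ ^ n) ℚ.* D ∎
      where
      D = ℚ.∣ u ℚ.- v ∣
      w = + 1 ℚ./ suc n
      step : ℚ.∣ (u ^ suc n ℚ.- v ^ suc n) ℚ.* w ∣ ℚ.≤ ρ ^ n ℚ.* D
      step = begin
        ℚ.∣ (u ^ suc n ℚ.- v ^ suc n) ℚ.* w ∣
          ≡⟨ ℚₚ.∣p*q∣≡∣p∣*∣q∣ (u ^ suc n ℚ.- v ^ suc n) w ⟩
        ℚ.∣ u ^ suc n ℚ.- v ^ suc n ∣ ℚ.* ℚ.∣ w ∣
          ≡⟨ cong (ℚ.∣ u ^ suc n ℚ.- v ^ suc n ∣ ℚ.*_) (ℚₚ.0≤p⇒∣p∣≡p (1/suc-nonNeg n)) ⟩
        ℚ.∣ u ^ suc n ℚ.- v ^ suc n ∣ ℚ.* w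
          ≤⟨ ℚₚ.*-monoʳ-≤-nonNeg w {{ℚ.nonNegative (1/suc-nonNeg n)}}
               (power-lipschitz n 0≤u u≤ρ 0≤v v≤ρ) ⟩
        ((+ suc n ℚ./ 1) ℚ.* (ρ ^ n ℚ.* D)) ℚ.* w
          ≡⟨ solve 3 (λ k x w → (k :* x) :* w := (k :* w) :* x) refl
               (+ suc n ℚ./ 1) (ρ ^ n ℚ.* D) w ⟩
        ((+ suc n ℚ./ 1) ℚ.* w) ℚ.* (ρ ^ n ℚ.* D)
          ≡⟨ cong (ℚ._* (ρ ^ n ℚ.* D)) (suc*1/suc n) ⟩
        1ℚ ℚ.* (ρ ^ n ℚ.* D)
          ≡⟨ ℚₚ.*-identityˡ (ρ ^ n ℚ.* D) ⟩
        ρ ^ n ℚ.* D ∎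

    mercator-tail : ∀ {u} N d → 0ℚ ℚ.≤ u → u ℚ.≤ ρ →
      ℚ.∣ mercator (d ℕ.+ N) u ℚ.- mercator N u ∣ ℚ.≤ geometric (d ℕ.+ N) ℚ.* (+ 1 ℚ./ suc N)
    mercator-tail {u} N zero 0≤u u≤ρ = subst (ℚ._≤ geometric N ℚ.* (+ 1 ℚ./ suc N))
      (cong ℚ.∣_∣ (sym (ℚₚ.+-inverseʳ (mercator N u))))
      (*-nonNeg (geometric-nonNeg N) (1/suc-nonNeg N))
      where
      geometric-nonNeg : ∀ n → 0ℚ ℚ.≤ geometric n
      geometric-nonNeg zero    = ℚₚ.≤-refl
      geometric-nonNeg (suc n) = ℚₚ.+-mono-≤ (geometric-nonNeg n) (^-nonNeg n 0≤ρ)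
    mercator-tail {u} N (suc d) 0≤u u≤ρ = begin
      ℚ.∣ (mercator m u ℚ.+ t) ℚ.- mercator N u ∣
        ≡⟨ cong ℚ.∣_∣ (solve 3 (λ a t b → (a :+ t) :- b := (a :- b) :+ t) refl
             (mercator m u) t (mercator N u)) ⟩
      ℚ.∣ (mercator m u ℚ.- mercator N u) ℚ.+ t ∣
        ≤⟨ ℚₚ.∣p+q∣≤∣p∣+∣q∣ (mercator m u ℚ.- mercator N u) t ⟩
      ℚ.∣ mercator m u ℚ.- mercator N u ∣ ℚ.+ ℚ.∣ t ∣
        ≤⟨ ℚₚ.+-mono-≤ (mercator-tail N d 0≤u u≤ρ)
             (subst (ℚ._≤ ρ ^ m ℚ.* w)
               (sym (ℚₚ.0≤p⇒∣p∣≡p (*-nonNeg (^-nonNeg (suc m) 0≤u) (1/suc-nonNeg m))))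
               (*-mono (1/suc-nonNeg m) (^-nonNeg m 0≤ρ)
                 (ℚₚ.≤-trans (^-mono (suc m) 0≤u u≤ρ) (ρ^-anti m))
                 (1/suc-anti (ℕₚ.m≤n+m N d)))) ⟩
      geometric m ℚ.* w ℚ.+ ρ ^ m ℚ.* w
        ≡⟨ ℚₚ.*-distribʳ-+ w (geometric m) (ρ ^ m) ⟨
      (geometric m ℚ.+ ρ ^ m) ℚ.* w ∎
      where
      m = d ℕ.+ N
      t = (u ^ suc m) ℚ.* (+ 1 ℚ./ suc m)
      w = + 1 ℚ./ suc N

    mercator-close : ∀ {u v δ} N m n → N ℕ.≤ m → N ℕ.≤ n →
      0ℚ ℚ.≤ u → u ℚ.≤ ρ → 0ℚ ℚ.≤ v → v ℚ.≤ ρ →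
      + 1 ℚ./ suc N ℚ.≤ δ → ℚ.∣ u ℚ.- v ∣ ℚ.≤ δ →
      ℚ.∣ mercator m u ℚ.- mercator n v ∣ ℚ.≤ (K ℚ.+ K ℚ.+ K) ℚ.* δ
    mercator-close {u} {v} {δ} N m n N≤m N≤n 0≤u u≤ρ 0≤v v≤ρ w≤δ uv≤δ = begin
      ℚ.∣ mercator m u ℚ.- mercator n v ∣
        ≤⟨ triangle (mercator m u) (mercator N v) (mercator n v) ⟩
      ℚ.∣ mercator m u ℚ.- mercator N v ∣ ℚ.+ ℚ.∣ mercator N v ℚ.- mercator n v ∣
        ≤⟨ ℚₚ.+-monoˡ-≤ _ (triangle (mercator m u) (mercator N u) (mercator N v)) ⟩
      ℚ.∣ mercator m u ℚ.- mercator N u ∣ ℚ.+ ℚ.∣ mercator N u ℚ.- mercator N v ∣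
        ℚ.+ ℚ.∣ mercator N v ℚ.- mercator n v ∣
        ≤⟨ ℚₚ.+-mono-≤ (ℚₚ.+-mono-≤ (tail m N≤m 0≤u u≤ρ) lip)
             (subst (ℚ._≤ K ℚ.* δ) (swap-diff (mercator n v) (mercator N v))
               (tail n N≤n 0≤v v≤ρ)) ⟩
      K ℚ.* δ ℚ.+ K ℚ.* δ ℚ.+ K ℚ.* δ
        ≡⟨ solve 2 (λ k d → k :* d :+ k :* d :+ k :* d := (k :+ k :+ k) :* d) refl K δ ⟩
      (K ℚ.+ K ℚ.+ K) ℚ.* δ ∎
      where
      lip : ℚ.∣ mercator N u ℚ.- mercator N v ∣ ℚ.≤ K ℚ.* δ
      lip = ℚₚ.≤-trans (mercator-lipschitz N 0≤u u≤ρ 0≤v v≤ρ)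
        (*-mono (ℚₚ.0≤∣p∣ (u ℚ.- v)) (ℚₚ.<⇒≤ 0<K) (geometric≤K N) uv≤δ)
      tail : ∀ {x} k → N ℕ.≤ k → 0ℚ ℚ.≤ x → x ℚ.≤ ρ →
        ℚ.∣ mercator k x ℚ.- mercator N x ∣ ℚ.≤ K ℚ.* δ
      tail {x} k N≤k 0≤x x≤ρ = ℚₚ.≤-trans
        (subst (λ j → ℚ.∣ mercator j x ℚ.- mercator N x ∣ ℚ.≤ geometric j ℚ.* (+ 1 ℚ./ suc N))
          (ℕₚ.m∸n+n≡m N≤k) (mercator-tail N (k ℕ.∸ N) 0≤x x≤ρ))
        (*-mono (1/suc-nonNeg N) (ℚₚ.<⇒≤ 0<K) (geometric≤K k) w≤δ)

  archimedean : ∀ δ → 0ℚ ℚ.< δ → ∃[ N ] + 1 ℚ./ suc N ℚ.≤ δ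
  archimedean (ℚ.mkℚ (+ zero) d _) (ℚ.*<* (ℤ.+<+ ()))
  archimedean (ℚ.mkℚ (+ suc p) d cop) _ = d , ℚₚ.toℚᵘ-cancel-≤
    (≤-respˡ-≃ (≃-sym (ℚₚ.toℚᵘ-fromℚᵘ (ℚᵘ.mkℚᵘ (+ 1) d)))
      (ℚᵘ.*≤* (ℤₚ.*-monoʳ-≤-nonNeg (+ suc d) (ℤ.+≤+ (ℕ.s≤s (ℕ.z≤n {p}))))))
    where
    open import Data.Rational.Unnormalised.Properties using (≃-sym; ≤-respˡ-≃)
  archimedean (ℚ.mkℚ ℤ.-[1+ p ] d _) (ℚ.*<* ())

  abstract
    ln-cauchy : ∀ x → 0ℝ < x → x < 1ℝ → IsCauchy (λ n → ℚ.- mercator n (1ℚ ℚ.- seq x n))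
    ln-cauchy x (c , 0<c , Nc , c≤x) (d , 0<d , Nd , x≤1-d) ε 0<ε =
      let (δ , 0<δ , δ-eq) = rescale (K ℚ.+ K ℚ.+ K) ε
                               (ℚₚ.+-mono-< (ℚₚ.+-mono-< 0<K 0<K) 0<K) 0<ε
          (M , w≤δ) = archimedean δ 0<δ
          (Nx , close) = cauchy x δ 0<δ
          N₁ = Nc ℕ.⊔ Nd
          N = N₁ ℕ.⊔ (M ℕ.⊔ Nx)
      in N , λ m n m≥ n≥ →
        let m≥N₁ = ℕₚ.m⊔n≤o⇒m≤o N₁ (M ℕ.⊔ Nx) m≥
            n≥N₁ = ℕₚ.m⊔n≤o⇒m≤o N₁ (M ℕ.⊔ Nx) n≥
            m≥N₂ = ℕₚ.m⊔n≤o⇒n≤o N₁ (M ℕ.⊔ Nx) m≥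
            n≥N₂ = ℕₚ.m⊔n≤o⇒n≤o N₁ (M ℕ.⊔ Nx) n≥
        in subst (ℚ._≤ ε) (sym (trans
               (cong ℚ.∣_∣ (neg-diff (mercator m (u m)) (mercator n (u n))))
               (ℚₚ.∣-p∣≡∣p∣ (mercator m (u m) ℚ.- mercator n (u n)))))
             (subst (ℚ.∣ mercator m (u m) ℚ.- mercator n (u n) ∣ ℚ.≤_) δ-eq
               (mercator-close M m n
                 (ℕₚ.m⊔n≤o⇒m≤o M Nx m≥N₂) (ℕₚ.m⊔n≤o⇒m≤o M Nx n≥N₂)
                 (0≤u m (ℕₚ.m⊔n≤o⇒n≤o Nc Nd m≥N₁)) (u≤ρ m (ℕₚ.m⊔n≤o⇒m≤o Nc Nd m≥N₁))
                 (0≤u n (ℕₚ.m⊔n≤o⇒n≤o Nc Nd n≥N₁)) (u≤ρ n (ℕₚ.m⊔n≤o⇒m≤o Nc Nd n≥N₁))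
                 w≤δ
                 (subst (ℚ._≤ δ) (u-diff m n)
                   (close m n (ℕₚ.m⊔n≤o⇒n≤o M Nx m≥N₂) (ℕₚ.m⊔n≤o⇒n≤o M Nx n≥N₂)))))
      where
      u : ℕ → ℚ
      u n = 1ℚ ℚ.- seq x n
      c≤x′ : ∀ n → Nc ℕ.≤ n → c ℚ.≤ seq x n
      c≤x′ n n≥ = subst (ℚ._≤ seq x n) (ℚₚ.+-identityˡ c) (c≤x n n≥)
      x≤1 : ∀ n → Nd ℕ.≤ n → seq x n ℚ.≤ 1ℚ
      x≤1 n n≥ = ℚₚ.≤-trans
        (subst (ℚ._≤ seq x n ℚ.+ d) (ℚₚ.+-identityʳ (seq x n)) (ℚₚ.+-monoʳ-≤ (seq x n) (ℚₚ.<⇒≤ 0<d)))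
        (x≤1-d n n≥)
      c≤1 : c ℚ.≤ 1ℚ
      c≤1 = ℚₚ.≤-trans (c≤x′ (Nc ℕ.⊔ Nd) (ℕₚ.m≤m⊔n Nc Nd)) (x≤1 (Nc ℕ.⊔ Nd) (ℕₚ.m≤n⊔m Nc Nd))
      open Convergence c 0<c c≤1
      0≤u : ∀ n → Nd ℕ.≤ n → 0ℚ ℚ.≤ u n
      0≤u n n≥ = subst (ℚ._≤ u n) (ℚₚ.+-inverseʳ (seq x n)) (ℚₚ.+-monoˡ-≤ (ℚ.- seq x n) (x≤1 n n≥))
      u≤ρ : ∀ n → Nc ℕ.≤ n → u n ℚ.≤ ρ
      u≤ρ n n≥ = ℚₚ.+-monoʳ-≤ 1ℚ (ℚₚ.neg-antimono-≤ (c≤x′ n n≥))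
      u-diff : ∀ m n → ℚ.∣ seq x m ℚ.- seq x n ∣ ≡ ℚ.∣ u m ℚ.- u n ∣
      u-diff m n = trans (swap-diff (seq x m) (seq x n)) (cong ℚ.∣_∣
        (solve 3 (λ o a b → b :- a := (o :- a) :- (o :- b)) refl 1ℚ (seq x m) (seq x n)))
        where open +-*-Solver

-- ln x = - ∑ₖ (1 - x)ᵏ / k.  The bounds on x are only used for convergence.
ln : (x : ℝ) → 0ℝ < x → x < 1ℝ → ℝ
ln x 0<x x<1 = mkℝ (λ n → ℚ.- mercator n (1ℚ ℚ.- seq x n)) (ln-cauchy x 0<x x<1)

1-x<1 : ∀ x → 0ℝ < x → 1ℝ - x < 1ℝ
1-x<1 x (c , 0<c , N , c≤x) = c , 0<c , N , λ n n≥ →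
  subst (1ℚ ℚ.- seq x n ℚ.+ c ℚ.≤_)
    (solve 1 (λ s → con 1ℚ :- s :+ s := con 1ℚ) refl (seq x n))
    (ℚₚ.+-monoʳ-≤ (1ℚ ℚ.- seq x n)
      (subst (ℚ._≤ seq x n) (ℚₚ.+-identityˡ c) (c≤x n n≥)))
  where open +-*-Solver

0<1-x : ∀ x → x < 1ℝ → 0ℝ < 1ℝ - x
0<1-x x (d , 0<d , N , x≤1-d) = d , 0<d , N , λ n n≥ →
  subst (ℚ._≤ 1ℚ ℚ.- seq x n)
    (solve 2 (λ s d → s :+ d :- s := con 0ℚ :+ d) refl (seq x n) d)
    (ℚₚ.+-monoˡ-≤ (ℚ.- seq x n) (x≤1-d n n≥))
  where open +-*-Solver

h : (α : ℝ) → 0ℝ < α → α < 1ℝ → ℝ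
h α 0<α α<1 =
  - (α * ln α 0<α α<1) - (1ℝ - α) * ln (1ℝ - α) (0<1-x α α<1) (1-x<1 α 0<α)

------------------------------------------------------------------------
-- Probability

Continuous : ∀ {k} → ((Fin k → ℝ) → ℝ) → Set
Continuous φ = ∀ x ε → 0ℝ < ε →
  ∃[ δ ] 0ℝ < δ × (∀ y → (∀ i → ∣ y i - x i ∣ < δ) → ∣ φ y - φ x ∣ < ε)

LinearGrowth : ∀ {k} → ((Fin k → ℝ) → ℝ) → Set
LinearGrowth φ = ∃[ C ] ∀ x → ∣ φ x ∣ ≤ C * (1ℝ + ∑ (λ i → ∣ x i ∣))

-- A probability space presented by its Daniell integral: Integrable is the
-- class L¹ and 𝔼 the expectation.  Every measure-theoretic probability space
-- gives rise to one; 𝔼-↓0 is Daniell's form of σ-additivity.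
record ProbabilitySpace : Set₁ where
  field
    Ω          : Set
    Integrable : (Ω → ℝ) → Set
    𝔼          : (X : Ω → ℝ) → Integrable X → ℝ

    integrable-resp : ∀ {X Y : Ω → ℝ} → (∀ ω → X ω ≈ Y ω) → Integrable X → Integrable Y
    integrable-∘    : ∀ {k} (φ : (Fin k → ℝ) → ℝ) → Continuous φ → LinearGrowth φ →
                      (X : Fin k → Ω → ℝ) → (∀ i → Integrable (X i)) →
                      Integrable (λ ω → φ (λ i → X i ω))

    𝔼-1    : ∀ int → 𝔼 (λ _ → 1ℝ) int ≈ 1ℝ
    𝔼-+    : ∀ {X Y : Ω → ℝ} int-X int-Y int-X+Y →
             𝔼 (λ ω → X ω + Y ω) int-X+Y ≈ 𝔼 X int-X + 𝔼 Y int-Y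
    𝔼-*    : ∀ {X : Ω → ℝ} c int-X int-cX → 𝔼 (λ ω → c * X ω) int-cX ≈ c * 𝔼 X int-X
    𝔼-mono : ∀ {X Y : Ω → ℝ} int-X int-Y → (∀ ω → X ω ≤ Y ω) → 𝔼 X int-X ≤ 𝔼 Y int-Y
    𝔼-↓0   : ∀ (X : ℕ → Ω → ℝ) (int : ∀ k → Integrable (X k)) →
             (∀ k ω → X (suc k) ω ≤ X k ω) →
             (∀ ω ε → 0ℝ < ε → ∃[ N ] ∀ k → N ℕ.≤ k → ∣ X k ω ∣ < ε) →
             ∀ ε → 0ℝ < ε → ∃[ N ] ∀ k → N ℕ.≤ k → ∣ 𝔼 (X k) (int k) ∣ < ε

  HasMean : (Ω → ℝ) → ℝ → Set
  HasMean X e = Σ[ int ∈ Integrable X ] 𝔼 X int ≈ e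

open ProbabilitySpace

𝟙 : {P : Set} → Dec P → ℝ
𝟙 (yes _) = 1ℝ
𝟙 (no  _) = 0ℝ

record BoundedContinuous (k : ℕ) : Set where
  field
    fun        : (Fin k → ℝ) → ℝ
    bounded    : ∃[ B ] ∀ x → ∣ fun x ∣ ≤ B
    continuous : Continuous fun

open BoundedContinuous

-- Equality of the laws of two families of random variables: equality of all
-- finite-dimensional distributions, tested on bounded continuous functions.
SameLaw : (S T : ProbabilitySpace) {I : Set} →
          (I → Ω S → ℝ) → (I → Ω T → ℝ) → Set
SameLaw S T {I} X Y = ∀ {k} (t : Fin k → I) (φ : BoundedContinuous k) e →
  HasMean S (λ ω → fun φ (λ i → X (t i) ω)) e ⇔ HasMean T (λ ω → fun φ (λ i → Y (t i) ω)) e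

-- Mutual independence of c families of random variables; the members of one
-- family may depend on each other.
Independent : (S : ProbabilitySpace) {c : ℕ} {I : Fin c → Set} →
              (∀ j → I j → Ω S → ℝ) → Set
Independent S {c} {I} X =
  ∀ {k : Fin c → ℕ} (t : ∀ j → Fin (k j) → I j) (φ : ∀ j → BoundedContinuous (k j))
    (e : Fin c → ℝ) →
  (∀ j → HasMean S (λ ω → fun (φ j) (λ i → X j (t j i) ω)) (e j)) →
  HasMean S (λ ω → ∏ (λ j → fun (φ j) (λ i → X j (t j i) ω))) (∏ e)

------------------------------------------------------------------------
-- Dual-pivot Quickselect

-- The valid parameters (n , m) of the costs F n m: sizes n, ranks 1 ≤ m ≤ n.
-- F n m is unconstrained, and never contributes, for other n and m.
Parameters : Set
Parameters = Σ[ n ∈ ℕ ] Σ[ m ∈ ℕ ] (1 ℕ.≤ m × m ℕ.≤ n)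

restrict : {A : Set} → (ℕ → ℕ → A) → Parameters → A
restrict F (n , m , _) = F n m

-- R₀ = 0, R₁, R₂, R₃ = n + 1
ranks : (n r₁ r₂ : ℕ) → Fin 4 → ℕ
ranks n r₁ r₂ = 0 ∷ r₁ ∷ r₂ ∷ suc n ∷ []

-- 1{R_ℓ < m < R_{ℓ+1}} f_{J,m-R_ℓ} with J = R_{ℓ+1} - R_ℓ - 1, segments ℓ being
-- counted from 0.  The truncated subtractions are exact whenever the indicator
-- is nonzero.
segmentCost : (R : Fin 4 → ℕ) (m : ℕ) (ℓ : Fin 3) → (ℕ → ℕ → ℝ) → ℝ
segmentCost R m ℓ f = 𝟙 ((lo ℕₚ.<? m) ×-dec (m ℕₚ.<? hi)) * f (hi ℕ.∸ lo ℕ.∸ 1) (m ℕ.∸ lo)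
  where
  lo = R (inject₁ ℓ)
  hi = R (suc ℓ)

-- The four mutually independent families of a round: the vector (R₁, R₂, A),
-- whose entries may depend on each other, and the three copies of F.
FamilyIndex : Fin 4 → Set
FamilyIndex zero    = Fin 3
FamilyIndex (suc _) = Parameters

families : {Ω : Set} → (R₁ R₂ : Ω → ℕ) (A : Ω → ℝ) → (Fin 3 → ℕ → ℕ → Ω → ℝ) →
           ∀ j → FamilyIndex j → Ω → ℝ
families R₁ R₂ A copy zero    = (λ ω → fromℕ (R₁ ω)) ∷ (λ ω → fromℕ (R₂ ω)) ∷ A ∷ []
families R₁ R₂ A copy (suc ℓ) = restrict (copy ℓ)

-- A realisation, on some probability space, of the right-hand side of the
-- distributional recurrence for inputs of size n.
record PartitioningRound (S : ProbabilitySpace) (F : ℕ → ℕ → Ω S → ℝ) (n : ℕ) : Set₁ where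
  field
    space : ProbabilitySpace
    R₁ R₂ : Ω space → ℕ
    A     : Ω space → ℝ
    copy  : Fin 3 → ℕ → ℕ → Ω space → ℝ

  R : Ω space → Fin 4 → ℕ
  R ω = ranks n (R₁ ω) (R₂ ω)

  field
    pivots-distinct : ∀ ω → 1 ℕ.≤ R₁ ω × R₁ ω ℕ.< R₂ ω × R₂ ω ℕ.≤ n
    pivots-uniform  : ∀ r₁ r₂ → 1 ℕ.≤ r₁ → r₁ ℕ.< r₂ → r₂ ℕ.≤ n →
      Σ[ int ∈ Integrable space (λ ω → 𝟙 ((R₁ ω ℕₚ.≟ r₁) ×-dec (R₂ ω ℕₚ.≟ r₂))) ]
        fromℕ (n C 2) * 𝔼 space _ int ≈ 1ℝ

    A-integrable    : Integrable space A
    copy-integrable : ∀ ℓ p → Integrable space (restrict (copy ℓ) p)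
    copy-law        : ∀ ℓ → SameLaw S space (restrict F) (restrict (copy ℓ))
    independent     : Independent space (families R₁ R₂ A copy)

    recurrence : ∀ m → 1 ℕ.≤ m → m ℕ.≤ n →
      SameLaw S space {⊤} (λ _ → F n m)
        (λ _ ω → A ω + ∑ (λ ℓ → segmentCost (R ω) m ℓ (λ j k → copy ℓ j k ω)))

-- The costs F n m of selecting the m-th smallest of n elements.
record DualPivotQuickselect : Set₁ where
  field
    space        : ProbabilitySpace
    F            : ℕ → ℕ → Ω space → ℝ
    F-integrable : ∀ p → Integrable space (restrict F p)
    n₀           : ℕ
    small        : ∃[ C ] ∀ n m → n ℕ.< n₀ → 1 ℕ.≤ m → m ℕ.≤ n → ∀ ω → ∣ F n m ω ∣ ≤ C
    round        : ∀ n → n₀ ℕ.≤ n → PartitioningRound space F n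

  𝔼F : ∀ n m → 1 ℕ.≤ m → m ℕ.≤ n → ℝ
  𝔼F n m 1≤m m≤n = 𝔼 space (F n m) (F-integrable (n , m , 1≤m , m≤n))

  𝔼A : ∀ n → n₀ ℕ.≤ n → ℝ
  𝔼A n n₀≤n = 𝔼 (PartitioningRound.space (round n n₀≤n)) _
                (PartitioningRound.A-integrable (round n n₀≤n))

-- Write P = m and Q = n + 1 - m, and H for the harmonic numbers.  Averaging the
-- distributional recurrence over the pairs of pivots gives a linear recurrence for the
-- expected costs.  Its operator, applied to functions of n, P and Q built from harmonic
-- numbers, can be summed in closed form by discrete antidifferentiation:
--   G = (n + 1) H n - P H P - Q H Q + 3 n / 2  solves it for the toll n up to a bounded error,
--   B = H P + H Q                              is a supersolution for the toll 1.
-- Hence |𝔼 F - a G| ≤ K B = O(log n), so that 𝔼 F / n and a G / n have the same limit; and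
-- G / n tends to 3/2 + h α since H n - H m tends to - ln α when m / n does to α.  The last fact
-- follows by comparing the increments of the Mercator series between consecutive multiples
-- of 1 / n with the terms of the harmonic sum.
--
-- Equality of laws and independence only concern bounded continuous functions; Daniell's
-- monotone continuity, applied to truncations, transfers them to the means.

module Submission where

-- The position of the sought element is recorded by the numbers `p` and `q` of elements below and
-- above it. A recursive call shrinks one or both of them, and the three kinds of pivot pairs become
-- sums over a triangle, a rectangle and a triangle. A function `w (p + q) - u p - u q` sums over
-- all three regions as soon as `w` and `u` have two explicit antiderivatives; with x H x in the
-- role of x ln x, the expected entropy limit suggests the shape of G.
--
-- A bounded error in the toll recurs in every recursive call, so it cannot be dropped; B is its
-- accumulated price, and dies on division by n.
--
-- Two obstacles shape the rest. A recursive call reads its copy of F at random parameters, while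
-- independence concerns fixed ones: hence a round is rewritten as a sum over all pairs of pivots,
-- the event of each pair being expressed by a continuous bump. And a real number is a sequence of
-- rationals, where the index into `ln` is also the length of its Mercator sum: hence truncation
-- errors are beaten by letting the index grow after n is fixed.

module Rational where

  import Algebra.Definitions.RawSemiring as RawSemiring
  open import Data.Empty using (⊥-elim)
  open import Data.Integer.Base using (+_)
  import Data.Integer.Base as ℤ
  import Data.Integer.Properties as ℤₚ
  open import Data.Nat.Base as ℕ using (ℕ; zero; suc)
  import Data.Nat.Properties as ℕₚ
  open import Data.Product.Base using (∃-syntax; _×_; _,_; proj₁; proj₂)
  open import Data.Rational.Base
  open import Data.Rational.Properties
  open import Data.Rational.Solver using (module +-*-Solver)
  import Data.Rational.Unnormalised.Base as ℚᵘ
  open ℚᵘ using (mkℚᵘ; *≡*; *≤*)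
  import Data.Rational.Unnormalised.Properties as ℚᵘₚ
  open import Data.Sum.Base using (inj₁; inj₂)
  open import Relation.Binary.PropositionalEquality
    using (_≡_; refl; sym; trans; cong; cong₂; subst; subst₂)
  open import Defs using (mercator)
  open RawSemiring +-*-rawSemiring using (_^_)
  open +-*-Solver using (solve; con; _:+_; _:*_; _:-_; :-_; _:=_)

  -- Natural numbers, reciprocals and inequalities among the rationals

  fromℚᵘ-homo-+ : ∀ x y → fromℚᵘ (x ℚᵘ.+ y) ≡ fromℚᵘ x + fromℚᵘ y
  fromℚᵘ-homo-+ x y = toℚᵘ-injective (ℚᵘₚ.≃-trans (toℚᵘ-fromℚᵘ (x ℚᵘ.+ y)) (ℚᵘₚ.≃-sym
    (ℚᵘₚ.≃-trans (toℚᵘ-homo-+ (fromℚᵘ x) (fromℚᵘ y))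
      (ℚᵘₚ.+-cong (toℚᵘ-fromℚᵘ x) (toℚᵘ-fromℚᵘ y)))))

  fromℚᵘ-homo-* : ∀ x y → fromℚᵘ (x ℚᵘ.* y) ≡ fromℚᵘ x * fromℚᵘ y
  fromℚᵘ-homo-* x y = toℚᵘ-injective (ℚᵘₚ.≃-trans (toℚᵘ-fromℚᵘ (x ℚᵘ.* y)) (ℚᵘₚ.≃-sym
    (ℚᵘₚ.≃-trans (toℚᵘ-homo-* (fromℚᵘ x) (fromℚᵘ y))
      (ℚᵘₚ.*-cong (toℚᵘ-fromℚᵘ x) (toℚᵘ-fromℚᵘ y)))))

  ι : ℕ → ℚ
  ι n = + n / 1

  1/[1+_] : ℕ → ℚ
  1/[1+ n ] = + 1 / suc n

  abstract
    ι-suc : ∀ n → ι (suc n) ≡ 1ℚ + ι n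
    ι-suc n = trans
      (fromℚᵘ-cong {mkℚᵘ (+ suc n) 0} {mkℚᵘ (+ 1) 0 ℚᵘ.+ mkℚᵘ (+ n) 0} (*≡* (eq (+ n))))
      (fromℚᵘ-homo-+ (mkℚᵘ (+ 1) 0) (mkℚᵘ (+ n) 0))
      where
      eq : ∀ k → (+ 1 ℤ.+ k) ℤ.* + 1 ≡ (+ 1 ℤ.* + 1 ℤ.+ k ℤ.* + 1) ℤ.* + 1
      eq k = cong (λ t → (+ 1 ℤ.+ t) ℤ.* + 1) (sym (ℤₚ.*-identityʳ k))

    /≡*1/ : ∀ m n → + m / suc n ≡ ι m * 1/[1+ n ]
    /≡*1/ m n = trans
      (fromℚᵘ-cong {mkℚᵘ (+ m) n} {mkℚᵘ (+ m) 0 ℚᵘ.* mkℚᵘ (+ 1) n}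
        (*≡* (cong₂ ℤ._*_ (sym (ℤₚ.*-identityʳ (+ m))) (cong (λ k → + suc k) (ℕₚ.+-identityʳ n)))))
      (fromℚᵘ-homo-* (mkℚᵘ (+ m) 0) (mkℚᵘ (+ 1) n))

    ι*1/ : ∀ n → ι (suc n) * 1/[1+ n ] ≡ 1ℚ
    ι*1/ n = trans (sym (/≡*1/ (suc n) n))
      (fromℚᵘ-cong {mkℚᵘ (+ suc n) n} {mkℚᵘ (+ 1) 0} (*≡* (ℤₚ.*-comm (+ suc n) (+ 1))))

    0≤ι : ∀ n → 0ℚ ≤ ι n
    0≤ι n = nonNegative⁻¹ (ι n) {{normalize-nonNeg n 1}}

    0<1/ : ∀ n → 0ℚ < 1/[1+ n ]
    0<1/ n = positive⁻¹ _ {{normalize-pos 1 (suc n)}}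

  0≤1/ : ∀ n → 0ℚ ≤ 1/[1+ n ]
  0≤1/ n = <⇒≤ (0<1/ n)

  ι-+ : ∀ m n → ι (m ℕ.+ n) ≡ ι m + ι n
  ι-+ zero    n = sym (+-identityˡ (ι n))
  ι-+ (suc m) n = trans (ι-suc (m ℕ.+ n)) (trans (cong (_+_ 1ℚ) (ι-+ m n))
    (trans (sym (+-assoc 1ℚ (ι m) (ι n))) (cong (_+ ι n) (sym (ι-suc m)))))

  module _ where

    -- Inequalities are proved by exhibiting the difference as a nonnegative expression.
    ≤-by : ∀ {x y} d → 0ℚ ≤ d → y ≡ x + d → x ≤ y
    ≤-by {x} d 0≤d eq = subst (x ≤_) (sym eq)
      (subst (_≤ x + d) (+-identityʳ x) (+-monoʳ-≤ x 0≤d))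

    0≤- : ∀ {x y} → x ≤ y → 0ℚ ≤ y - x
    0≤- {x} {y} x≤y = subst (_≤ y - x) (+-inverseʳ x) (+-monoˡ-≤ (- x) x≤y)

    0≤+ : ∀ {x y} → 0ℚ ≤ x → 0ℚ ≤ y → 0ℚ ≤ x + y
    0≤+ {x} {y} 0≤x 0≤y = +-mono-≤ 0≤x 0≤y

    0≤* : ∀ {x y} → 0ℚ ≤ x → 0ℚ ≤ y → 0ℚ ≤ x * y
    0≤* {x} {y} 0≤x 0≤y = subst (_≤ x * y) (*-zeroˡ y)
      (*-monoʳ-≤-nonNeg y {{nonNegative 0≤y}} 0≤x)

    *-mono : ∀ {p q r s} → 0ℚ ≤ p → p ≤ q → 0ℚ ≤ r → r ≤ s → p * r ≤ q * s
    *-mono {p} {q} {r} {s} 0≤p p≤q 0≤r r≤s =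
      ≤-by (p * (s - r) + (q - p) * r + (q - p) * (s - r))
        (0≤+ (0≤+ (0≤* 0≤p (0≤- r≤s)) (0≤* (0≤- p≤q) 0≤r)) (0≤* (0≤- p≤q) (0≤- r≤s)))
        (solve 4 (λ p q r s → q :* s :=
          p :* r :+ (p :* (s :- r) :+ (q :- p) :* r :+ (q :- p) :* (s :- r))) refl p q r s)

    ι-mono : ∀ {m n} → m ℕ.≤ n → ι m ≤ ι n
    ι-mono {m} m≤n with ℕₚ.m≤n⇒∃[o]m+o≡n m≤n
    ... | k , refl = ≤-by (ι k) (0≤ι k) (ι-+ m k)

    1≤ι-suc : ∀ n → 1ℚ ≤ ι (suc n)
    1≤ι-suc n = ≤-by (ι n) (0≤ι n) (ι-suc n)

    0<ι-suc : ∀ n → 0ℚ < ι (suc n)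
    0<ι-suc n = <-≤-trans (positive⁻¹ 1ℚ) (1≤ι-suc n)

    -- The difference is (n - m) / ((m + 1) (n + 1)). The ring solver knows no reciprocals, so the
    -- products `ι (suc n) * 1/[1+ n ]` are inserted and removed as 1 by hand; the same device
    -- recurs wherever a quotient occurs.
    1/-anti : ∀ {m n} → m ℕ.≤ n → 1/[1+ n ] ≤ 1/[1+ m ]
    1/-anti {m} {n} m≤n = ≤-by
      ((ι (suc n) - ι (suc m)) * (1/[1+ m ] * 1/[1+ n ]))
      (0≤* (0≤- (ι-mono (ℕ.s≤s m≤n))) (0≤* (0≤1/ m) (0≤1/ n)))
      (begin
        r                             ≡⟨ *-identityʳ r ⟨
        r * 1ℚ                        ≡⟨ cong (r *_) (ι*1/ n) ⟨
        r * (N * s)                   ≡⟨ solve 4 (λ M N r s → r :* (N :* s) :=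
                                            s :* (M :* r) :+ (N :- M) :* (r :* s)) refl M N r s ⟩
        s * (M * r) + (N - M) * (r * s) ≡⟨ cong (λ z → s * z + (N - M) * (r * s)) (ι*1/ m) ⟩
        s * 1ℚ + (N - M) * (r * s)    ≡⟨ cong (_+ (N - M) * (r * s)) (*-identityʳ s) ⟩
        s + (N - M) * (r * s)         ∎)
      where
      open Relation.Binary.PropositionalEquality.≡-Reasoning
      M = ι (suc m)
      N = ι (suc n)
      r = 1/[1+ m ]
      s = 1/[1+ n ]

    ≤-ι : ∀ q → ∃[ n ] q ≤ ι n
    ≤-ι (mkℚ (+ n) d c) = n , subst (_≤ ι n) (fromℚᵘ-toℚᵘ (mkℚ (+ n) d c))
      (toℚᵘ-cancel-≤ (ℚᵘₚ.≤-respˡ-≃ (ℚᵘₚ.≃-sym (toℚᵘ-fromℚᵘ (mkℚᵘ (+ n) d)))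
        (ℚᵘₚ.≤-respʳ-≃ (ℚᵘₚ.≃-sym (toℚᵘ-fromℚᵘ (mkℚᵘ (+ n) 0)))
          (*≤* (ℤₚ.*-monoˡ-≤-nonNeg (+ n) (ℤ.+≤+ (ℕ.s≤s ℕ.z≤n)))))))
    ≤-ι q@(mkℚ ℤ.-[1+ n ] d c) = 0 , nonPositive⁻¹ q

    1/[_]⁺ : ∀ {q} → 0ℚ < q → ℚ
    1/[_]⁺ {q} 0<q = (1/ q) {{pos⇒nonZero q {{positive 0<q}}}}

    *-1/⁺ : ∀ {q} (0<q : 0ℚ < q) → q * 1/[ 0<q ]⁺ ≡ 1ℚ
    *-1/⁺ {q} 0<q = *-inverseʳ q {{pos⇒nonZero q {{positive 0<q}}}}

    0<1/⁺ : ∀ {q} (0<q : 0ℚ < q) → 0ℚ < 1/[ 0<q ]⁺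
    0<1/⁺ {q} 0<q = positive⁻¹ _ {{1/pos⇒pos q {{positive 0<q}}}}

    0<* : ∀ {x y} → 0ℚ < x → 0ℚ < y → 0ℚ < x * y
    0<* {x} {y} 0<x 0<y = positive⁻¹ _ {{pos*pos⇒pos x {{positive 0<x}} y {{positive 0<y}}}}

    archimedean : ∀ ε → 0ℚ < ε → ∃[ n ] 1/[1+ n ] ≤ ε
    archimedean ε 0<ε with ≤-ι 1/[ 0<ε ]⁺
    ... | n , ε⁻¹≤n = n , ≤-by ((ι (suc n) - e) * (ε * r))
          (0≤* (0≤- (≤-trans ε⁻¹≤n (ι-mono (ℕₚ.n≤1+n n)))) (0≤* (<⇒≤ 0<ε) (0≤1/ n)))
          (begin
            ε                               ≡⟨ *-identityʳ ε ⟨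
            ε * 1ℚ                          ≡⟨ cong (ε *_) (ι*1/ n) ⟨
            ε * (N * r)                     ≡⟨ solve 4 (λ N e ε r → ε :* (N :* r) :=
                                                 r :* (ε :* e) :+ (N :- e) :* (ε :* r)) refl N e ε r ⟩
            r * (ε * e) + (N - e) * (ε * r) ≡⟨ cong (λ z → r * z + (N - e) * (ε * r)) (*-1/⁺ 0<ε) ⟩
            r * 1ℚ + (N - e) * (ε * r)      ≡⟨ cong (_+ (N - e) * (ε * r)) (*-identityʳ r) ⟩
            r + (N - e) * (ε * r)           ∎)
      where
      open Relation.Binary.PropositionalEquality.≡-Reasoning
      N = ι (suc n)
      e = 1/[ 0<ε ]⁺
      r = 1/[1+ n ]

    p≤∣p∣ : ∀ p → p ≤ ∣ p ∣
    p≤∣p∣ p with ∣p∣≡p∨∣p∣≡-p p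
    ... | inj₁ e = ≤-reflexive (sym e)
    ... | inj₂ e = ≤-trans (≤-by (- p) (subst (0ℚ ≤_) e (0≤∣p∣ p))
                     (sym (+-inverseʳ p))) (0≤∣p∣ p)

    -p≤∣p∣ : ∀ p → - p ≤ ∣ p ∣
    -p≤∣p∣ p = subst (- p ≤_) (∣-p∣≡∣p∣ p) (p≤∣p∣ (- p))

    ∣∣≤ : ∀ {p r} → p ≤ r → - p ≤ r → ∣ p ∣ ≤ r
    ∣∣≤ {p} {r} p≤r -p≤r with ∣p∣≡p∨∣p∣≡-p p
    ... | inj₁ e = subst (_≤ r) (sym e) p≤r
    ... | inj₂ e = subst (_≤ r) (sym e) -p≤r

  -- Sums over pairs of pivots

  ∑< : ℕ → (ℕ → ℚ) → ℚ
  ∑< zero    f = 0ℚ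
  ∑< (suc n) f = ∑< n f + f n

  -- Closed forms are verified by their increments, so that an antiderivative only has to be
  -- guessed, never derived.
  ∑<-telescope : ∀ (U u : ℕ → ℚ) → U 0 ≡ 0ℚ → (∀ k → U (suc k) ≡ U k + u k) →
                 ∀ n → ∑< n u ≡ U n
  ∑<-telescope U u U₀ step zero    = sym U₀
  ∑<-telescope U u U₀ step (suc n) =
    trans (cong (_+ u n) (∑<-telescope U u U₀ step n)) (sym (step n))

  ∑<-cong : ∀ {f g : ℕ → ℚ} → (∀ k → f k ≡ g k) → ∀ n → ∑< n f ≡ ∑< n g
  ∑<-cong f≡g zero    = refl
  ∑<-cong f≡g (suc n) = cong₂ _+_ (∑<-cong f≡g n) (f≡g n)

  -- With p = m - 1 elements below the sought one and q = n - m above it: the pairs of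
  -- pivots above, on both sides of, and below the sought element, each contributing
  -- the cost g i j of its recursive call, which has i elements below and j above.
  ∑pivots : (ℕ → ℕ → ℚ) → ℕ → ℕ → ℚ
  ∑pivots g p q = ∑< q (λ k → ∑< k (λ j → g p j)) + ∑< p (λ i → ∑< q (λ k → g i k))
                + ∑< p (λ k → ∑< k (λ j → g j q))

  ∑pivots-cong : ∀ {f g : ℕ → ℕ → ℚ} → (∀ i j → f i j ≡ g i j) → ∀ p q →
                 ∑pivots f p q ≡ ∑pivots g p q
  ∑pivots-cong f≡g p q = cong₂ _+_ (cong₂ _+_
    (∑<-cong (λ k → ∑<-cong (λ j → f≡g p j) k) q)
    (∑<-cong (λ i → ∑<-cong (λ k → f≡g i k) q) p))
    (∑<-cong (λ k → ∑<-cong (λ j → f≡g j q) k) p)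

  -- Two antiderivatives suffice because each kind of pivot pair is summed over two indices: a row
  -- needs the first one, a triangle or rectangle the second.
  module Separable
    (w W₁ W₂ u U₁ U₂ : ℕ → ℚ)
    (W₁-zero : W₁ 0 ≡ 0ℚ) (W₁-suc : ∀ k → W₁ (suc k) ≡ W₁ k + w k)
    (W₂-zero : W₂ 0 ≡ 0ℚ) (W₂-suc : ∀ k → W₂ (suc k) ≡ W₂ k + W₁ k)
    (U₁-zero : U₁ 0 ≡ 0ℚ) (U₁-suc : ∀ k → U₁ (suc k) ≡ U₁ k + u k)
    (U₂-zero : U₂ 0 ≡ 0ℚ) (U₂-suc : ∀ k → U₂ (suc k) ≡ U₂ k + U₁ k)
    where

    sep : ℕ → ℕ → ℚ
    sep p q = w (p ℕ.+ q) - u p - u q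

    sep-sym : ∀ p q → sep p q ≡ sep q p
    sep-sym p q = trans (cong (λ k → w k - u p - u q) (ℕₚ.+-comm p q))
      (solve 3 (λ a b c → a :- b :- c := a :- c :- b) refl (w (q ℕ.+ p)) (u p) (u q))

    row : ∀ p k → ∑< k (sep p) ≡ W₁ (p ℕ.+ k) - W₁ p - ι k * u p - U₁ k
    row p = ∑<-telescope (λ k → W₁ (p ℕ.+ k) - W₁ p - ι k * u p - U₁ k) (sep p) base step
      where
      base : W₁ (p ℕ.+ 0) - W₁ p - ι 0 * u p - U₁ 0 ≡ 0ℚ
      base rewrite ℕₚ.+-identityʳ p | U₁-zero =
        solve 2 (λ a b → a :- a :- con 0ℚ :* b :- con 0ℚ := con 0ℚ) refl (W₁ p) (u p)
      step : ∀ k → W₁ (p ℕ.+ suc k) - W₁ p - ι (suc k) * u p - U₁ (suc k)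
                 ≡ W₁ (p ℕ.+ k) - W₁ p - ι k * u p - U₁ k + sep p k
      step k rewrite ℕₚ.+-suc p k | W₁-suc (p ℕ.+ k) | U₁-suc k | ι-suc k =
        solve 7 (λ a b c d e f g → (a :+ b) :- c :- (con 1ℚ :+ d) :* e :- (f :+ g)
          := a :- c :- d :* e :- f :+ (b :- e :- g)) refl
          (W₁ (p ℕ.+ k)) (w (p ℕ.+ k)) (W₁ p) (ι k) (u p) (U₁ k) (u k)

    -- The coefficient of `u p` counts the pairs j < k < q, since that summand is constant on the
    -- triangle.
    triangle : ∀ p q → ∑< q (λ k → ∑< k (sep p))
      ≡ W₂ (p ℕ.+ q) - W₂ p - ι q * W₁ p - ½ * (ι q * (ι q - 1ℚ)) * u p - U₂ q
    triangle p q = trans (∑<-cong (row p) q)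
      (∑<-telescope (λ q → W₂ (p ℕ.+ q) - W₂ p - ι q * W₁ p - ½ * (ι q * (ι q - 1ℚ)) * u p - U₂ q)
        (λ k → W₁ (p ℕ.+ k) - W₁ p - ι k * u p - U₁ k) base step q)
      where
      base : W₂ (p ℕ.+ 0) - W₂ p - ι 0 * W₁ p - ½ * (ι 0 * (ι 0 - 1ℚ)) * u p - U₂ 0 ≡ 0ℚ
      base rewrite ℕₚ.+-identityʳ p | U₂-zero =
        solve 3 (λ a b c → a :- a :- con 0ℚ :* b :- con ½ :* (con 0ℚ :* (con 0ℚ :- con 1ℚ)) :* c
          :- con 0ℚ := con 0ℚ) refl (W₂ p) (W₁ p) (u p)
      step : ∀ q → W₂ (p ℕ.+ suc q) - W₂ p - ι (suc q) * W₁ p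
                     - ½ * (ι (suc q) * (ι (suc q) - 1ℚ)) * u p - U₂ (suc q)
                 ≡ W₂ (p ℕ.+ q) - W₂ p - ι q * W₁ p - ½ * (ι q * (ι q - 1ℚ)) * u p - U₂ q
                     + (W₁ (p ℕ.+ q) - W₁ p - ι q * u p - U₁ q)
      step q rewrite ℕₚ.+-suc p q | W₂-suc (p ℕ.+ q) | U₂-suc q | ι-suc q =
        solve 8 (λ a b c x d e f g →
          (a :+ b) :- c :- (con 1ℚ :+ x) :* d
            :- con ½ :* ((con 1ℚ :+ x) :* ((con 1ℚ :+ x) :- con 1ℚ)) :* e :- (f :+ g)
          := a :- c :- x :* d :- con ½ :* (x :* (x :- con 1ℚ)) :* e :- f
            :+ (b :- d :- x :* e :- g)) refl
          (W₂ (p ℕ.+ q)) (W₁ (p ℕ.+ q)) (W₂ p) (ι q) (W₁ p) (u p) (U₂ q) (U₁ q)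

    rectangle : ∀ p q → ∑< p (λ i → ∑< q (sep i))
      ≡ W₂ (p ℕ.+ q) - W₂ q - W₂ p - ι q * U₁ p - ι p * U₁ q
    rectangle p q = trans (∑<-cong (λ i → row i q) p)
      (∑<-telescope (λ p → W₂ (p ℕ.+ q) - W₂ q - W₂ p - ι q * U₁ p - ι p * U₁ q)
        (λ i → W₁ (i ℕ.+ q) - W₁ i - ι q * u i - U₁ q) base step p)
      where
      base : W₂ q - W₂ q - W₂ 0 - ι q * U₁ 0 - ι 0 * U₁ q ≡ 0ℚ
      base rewrite U₁-zero | W₂-zero =
        solve 3 (λ a x b → a :- a :- con 0ℚ :- x :* con 0ℚ :- con 0ℚ :* b := con 0ℚ) refl
          (W₂ q) (ι q) (U₁ q)
      step : ∀ p → W₂ (suc p ℕ.+ q) - W₂ q - W₂ (suc p) - ι q * U₁ (suc p) - ι (suc p) * U₁ q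
                 ≡ W₂ (p ℕ.+ q) - W₂ q - W₂ p - ι q * U₁ p - ι p * U₁ q
                     + (W₁ (p ℕ.+ q) - W₁ p - ι q * u p - U₁ q)
      step p rewrite W₂-suc (p ℕ.+ q) | W₂-suc p | U₁-suc p | ι-suc p =
        solve 10 (λ a b c d e x f g y h →
          (a :+ b) :- c :- (d :+ e) :- x :* (f :+ g) :- (con 1ℚ :+ y) :* h
          := a :- c :- d :- x :* f :- y :* h :+ (b :- e :- x :* g :- h)) refl
          (W₂ (p ℕ.+ q)) (W₁ (p ℕ.+ q)) (W₂ q) (W₂ p) (W₁ p) (ι q) (U₁ p) (u p) (ι p) (U₁ q)

    ∑pivots-sep : ∀ p q → ∑pivots sep p q ≡
      (W₂ (p ℕ.+ q) - W₂ p - ι q * W₁ p - ½ * (ι q * (ι q - 1ℚ)) * u p - U₂ q)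
      + (W₂ (p ℕ.+ q) - W₂ q - W₂ p - ι q * U₁ p - ι p * U₁ q)
      + (W₂ (p ℕ.+ q) - W₂ q - ι p * W₁ q - ½ * (ι p * (ι p - 1ℚ)) * u q - U₂ p)
    ∑pivots-sep p q = cong₂ _+_ (cong₂ _+_ (triangle p q) (rectangle p q))
      -- Pairs of pivots below the sought element form the mirror image of those above it.
      (trans (∑<-cong (λ k → ∑<-cong (λ j → sep-sym j q) k) p)
        (trans (triangle q p)
          (cong (λ s → W₂ s - W₂ q - ι p * W₁ q - ½ * (ι p * (ι p - 1ℚ)) * u q - U₂ p)
            (ℕₚ.+-comm q p))))

  -- Harmonic numbers

  3/2 : ℚ
  3/2 = + 3 / 2

  harmonic : ℕ → ℚ
  harmonic zero    = 0ℚ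
  harmonic (suc n) = harmonic n + 1/[1+ n ]

  -- For n = k + 1: the discrete antiderivatives of H n, namely binom(n,1) (H n - 1)
  -- and binom(n,2) (H n - 3/2); likewise those of n H n.
  h₀ h₁ h₂ l₀ l₁ l₂ c₀ c₁ c₂ : ℕ → ℚ
  h₀ k = harmonic (suc k)
  h₁ k = (1ℚ + ι k) * (harmonic (suc k) - 1ℚ)
  h₂ k = ½ * ((1ℚ + ι k) * ι k) * (harmonic (suc k) - 3/2)
  l₀ k = (1ℚ + ι k) * harmonic (suc k)
  l₁ k = ½ * ((1ℚ + ι k) * ι k) * (harmonic (suc k) - ½)
  l₂ k = + 1 / 6 * ((1ℚ + ι k) * ι k * (ι k - 1ℚ)) * (harmonic (suc k) - + 5 / 6)
  c₀ k = 1ℚ + ι k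
  c₁ k = ½ * ((1ℚ + ι k) * ι k)
  c₂ k = + 1 / 6 * ((1ℚ + ι k) * ι k * (ι k - 1ℚ))

  private
    -- (n + 1) (H (n + 1) - H n) = 1 at n = k + 1
    absorb : ∀ k {x y} b c → x ≡ b + c * ((1ℚ + (1ℚ + ι k)) * 1/[1+ suc k ]) → b + c ≡ y → x ≡ y
    absorb k b c x≡ b+c≡y = trans x≡
      (trans (cong (λ z → b + c * z) unit) (trans (cong (_+_ b) (*-identityʳ c)) b+c≡y))
      where
      unit : (1ℚ + (1ℚ + ι k)) * 1/[1+ suc k ] ≡ 1ℚ
      unit = trans (cong (λ t → (1ℚ + t) * 1/[1+ suc k ]) (sym (ι-suc k)))
        (trans (cong (_* 1/[1+ suc k ]) (sym (ι-suc (suc k)))) (ι*1/ (suc k)))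

  -- The four harmonic identities are cases of ∑ C(j,r) H j = C(n,r+1) (H n - 1/(r+1)), summed over
  -- j < n. Each summation subtracts one more reciprocal, whence the shifts 1 and 1 + 1/2 for H n,
  -- and 1/2 and 1/2 + 1/3 for n H n. Each proof is a pair of polynomial identities, between which
  -- `absorb` replaces (n + 1) / (n + 1) by 1.
  h₁-suc : ∀ k → h₁ (suc k) ≡ h₁ k + h₀ k
  h₁-suc k rewrite ι-suc k = absorb k
    ((1ℚ + (1ℚ + ι k)) * (harmonic (suc k) - 1ℚ))
    (1ℚ)
    (solve 3 (λ t H r → let T = con 1ℚ :+ t ; U = con 1ℚ :+ T in
      U :* ((H :+ r) :- con (1ℚ))
      := U :* (H :- con (1ℚ)) :+ con 1ℚ :* (U :* r)) refl
      (ι k) (harmonic (suc k)) 1/[1+ suc k ])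
    (solve 2 (λ t H → let T = con 1ℚ :+ t ; U = con 1ℚ :+ T in
      U :* (H :- con (1ℚ)) :+ con 1ℚ
      := T :* (H :- con (1ℚ)) :+ H) refl
      (ι k) (harmonic (suc k)))

  h₂-suc : ∀ k → h₂ (suc k) ≡ h₂ k + h₁ k
  h₂-suc k rewrite ι-suc k = absorb k
    (½ * ((1ℚ + (1ℚ + ι k)) * (1ℚ + ι k)) * (harmonic (suc k) - 3/2))
    (½ * (1ℚ + ι k))
    (solve 3 (λ t H r → let T = con 1ℚ :+ t ; U = con 1ℚ :+ T in
      con ½ :* (U :* T) :* ((H :+ r) :- con (3/2))
      := con ½ :* (U :* T) :* (H :- con (3/2)) :+ con ½ :* T :* (U :* r)) refl
      (ι k) (harmonic (suc k)) 1/[1+ suc k ])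
    (solve 2 (λ t H → let T = con 1ℚ :+ t ; U = con 1ℚ :+ T in
      con ½ :* (U :* T) :* (H :- con (3/2)) :+ con ½ :* T
      := con ½ :* (T :* t) :* (H :- con (3/2)) :+ T :* (H :- con 1ℚ)) refl
      (ι k) (harmonic (suc k)))

  l₁-suc : ∀ k → l₁ (suc k) ≡ l₁ k + l₀ k
  l₁-suc k rewrite ι-suc k = absorb k
    (½ * ((1ℚ + (1ℚ + ι k)) * (1ℚ + ι k)) * (harmonic (suc k) - ½))
    (½ * (1ℚ + ι k))
    (solve 3 (λ t H r → let T = con 1ℚ :+ t ; U = con 1ℚ :+ T in
      con ½ :* (U :* T) :* ((H :+ r) :- con (½))
      := con ½ :* (U :* T) :* (H :- con (½)) :+ con ½ :* T :* (U :* r)) refl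
      (ι k) (harmonic (suc k)) 1/[1+ suc k ])
    (solve 2 (λ t H → let T = con 1ℚ :+ t ; U = con 1ℚ :+ T in
      con ½ :* (U :* T) :* (H :- con (½)) :+ con ½ :* T
      := con ½ :* (T :* t) :* (H :- con (½)) :+ T :* H) refl
      (ι k) (harmonic (suc k)))

  l₂-suc : ∀ k → l₂ (suc k) ≡ l₂ k + l₁ k
  l₂-suc k rewrite ι-suc k = absorb k
    (+ 1 / 6 * ((1ℚ + (1ℚ + ι k)) * (1ℚ + ι k) * ((1ℚ + ι k) - 1ℚ)) * (harmonic (suc k) - + 5 / 6))
    (+ 1 / 6 * ((1ℚ + ι k) * ι k))
    (solve 3 (λ t H r → let T = con 1ℚ :+ t ; U = con 1ℚ :+ T in
      con (+ 1 / 6) :* (U :* T :* (T :- con 1ℚ)) :* ((H :+ r) :- con (+ 5 / 6))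
      := con (+ 1 / 6) :* (U :* T :* (T :- con 1ℚ)) :* (H :- con (+ 5 / 6))
        :+ con (+ 1 / 6) :* (T :* t) :* (U :* r)) refl
      (ι k) (harmonic (suc k)) 1/[1+ suc k ])
    (solve 2 (λ t H → let T = con 1ℚ :+ t ; U = con 1ℚ :+ T in
      con (+ 1 / 6) :* (U :* T :* (T :- con 1ℚ)) :* (H :- con (+ 5 / 6)) :+ con (+ 1 / 6) :* (T :* t)
      := con (+ 1 / 6) :* (T :* t :* (t :- con 1ℚ)) :* (H :- con (+ 5 / 6))
        :+ con ½ :* (T :* t) :* (H :- con ½)) refl
      (ι k) (harmonic (suc k)))

  c₁-suc : ∀ k → c₁ (suc k) ≡ c₁ k + c₀ k
  c₁-suc k rewrite ι-suc k = solve 1 (λ t →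
    con ½ :* ((con 1ℚ :+ (con 1ℚ :+ t)) :* (con 1ℚ :+ t))
    := con ½ :* ((con 1ℚ :+ t) :* t) :+ (con 1ℚ :+ t)) refl (ι k)

  c₂-suc : ∀ k → c₂ (suc k) ≡ c₂ k + c₁ k
  c₂-suc k rewrite ι-suc k = solve 1 (λ t →
    con (+ 1 / 6) :* ((con 1ℚ :+ (con 1ℚ :+ t)) :* (con 1ℚ :+ t) :* ((con 1ℚ :+ t) :- con 1ℚ))
    := con (+ 1 / 6) :* ((con 1ℚ :+ t) :* t :* (t :- con 1ℚ)) :+ con ½ :* ((con 1ℚ :+ t) :* t)) refl (ι k)

  -- The solution G and the supersolution B

  private
    combine : (ℕ → ℚ) → (ℕ → ℚ) → (ℕ → ℚ) → ℕ → ℚ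
    combine a b c k = a k + b k + 3/2 * c k

    combine-suc : ∀ (a b c a′ b′ c′ : ℕ → ℚ) →
      (∀ k → a (suc k) ≡ a k + a′ k) → (∀ k → b (suc k) ≡ b k + b′ k) →
      (∀ k → c (suc k) ≡ c k + c′ k) →
      ∀ k → combine a b c (suc k) ≡ combine a b c k + combine a′ b′ c′ k
    combine-suc a b c a′ b′ c′ a-suc b-suc c-suc k rewrite a-suc k | b-suc k | c-suc k =
      solve 6 (λ a b c d e f → a :+ d :+ (b :+ e) :+ con 3/2 :* (c :+ f)
        := a :+ b :+ con 3/2 :* c :+ (d :+ e :+ con 3/2 :* f)) refl
        (a k) (b k) (c k) (a′ k) (b′ k) (c′ k)

    neg-suc : ∀ (a b : ℕ → ℚ) → (∀ k → a (suc k) ≡ a k + b k) → ∀ k → - a (suc k) ≡ - a k + - b k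
    neg-suc a b a-suc k rewrite a-suc k = neg-distrib-+ (a k) (b k)

  w₀ w₁ w₂ : ℕ → ℚ
  w₀ = combine l₀ h₀ c₀
  w₁ = combine l₁ h₁ c₁
  w₂ = combine l₂ h₂ c₂

  -- The number of pairs of pivots for n = p + q + 1 elements.
  pairs : ℕ → ℕ → ℚ
  pairs p q = ½ * ((1ℚ + (ι p + ι q)) * (ι p + ι q))

  private
    module Leading = Separable w₀ w₁ w₂ l₀ l₁ l₂
      refl (combine-suc l₁ h₁ c₁ l₀ h₀ c₀ l₁-suc h₁-suc c₁-suc)
      refl (combine-suc l₂ h₂ c₂ l₁ h₁ c₁ l₂-suc h₂-suc c₂-suc)
      refl l₁-suc refl l₂-suc

    module Logarithmic = Separable (λ _ → 0ℚ) (λ _ → 0ℚ) (λ _ → 0ℚ)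
      (λ k → - h₀ k) (λ k → - h₁ k) (λ k → - h₂ k)
      refl (λ _ → refl) refl (λ _ → refl)
      refl (neg-suc h₁ h₀ h₁-suc) refl (neg-suc h₂ h₁ h₂-suc)

  -- With P = p + 1 = m and Q = q + 1 = n + 1 - m:
  -- (n + 1) H n - P H P - Q H Q + 3 n / 2
  leading : ℕ → ℕ → ℚ
  leading = Leading.sep

  logarithmic : ℕ → ℕ → ℚ
  logarithmic p q = harmonic (suc p) + harmonic (suc q)

  -- The number of pairs times the amount by which the tolls actually solved by `leading` and
  -- `logarithmic` exceed `n` and 1. Both polynomials are quadratic, like `pairs`, and have
  -- nonnegative coefficients.
  residual slack : ℕ → ℕ → ℚ
  residual p q = + 5 / 4 * (ι p * ι p + ι q * ι q) + + 1 / 4 * (ι p + ι q) + + 4 / 1 * (ι p * ι q)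
  slack p q = ι p * ι q + + 1 / 4 * (ι p * ι p + ι q * ι q) + + 5 / 4 * (ι p + ι q)

  private
    -- With `c` = C(s+1,3) one has 3 `c` = `D` (s - 1), so the coefficient of `H` is `D` (s + 2) on
    -- both sides; only the polynomial `D` (20/3 + 5 s / 6) is left over.
    above : ∀ s H → let D = ½ * ((1ℚ + s) * s)
                        c = + 1 / 6 * ((1ℚ + s) * s * (s - 1ℚ)) in
      D * ((1ℚ + s) * H + H + 3/2 * (1ℚ + s))
      ≡ D * (+ 20 / 3 + + 5 / 6 * s)
        + + 3 / 1 * (c * (H - + 5 / 6) + D * (H - 3/2) + 3/2 * c)
    above = solve 2 (λ s H →
      let D = con ½ :* ((con 1ℚ :+ s) :* s)
          c = con (+ 1 / 6) :* ((con 1ℚ :+ s) :* s :* (s :- con 1ℚ)) in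
      D :* ((con 1ℚ :+ s) :* H :+ H :+ con 3/2 :* (con 1ℚ :+ s))
      := D :* (con (+ 20 / 3) :+ con (+ 5 / 6) :* s)
        :+ con (+ 3 / 1) :* (c :* (H :- con (+ 5 / 6)) :+ D :* (H :- con 3/2) :+ con 3/2 :* c)) refl

    remainder : ℚ → ℚ → ℚ
    remainder x y = + 1 / 12 * ((1ℚ + x) * x * (x - 1ℚ)) - 3/2 * ((1ℚ + x) * x)
      + y * (+ 1 / 4 * ((1ℚ + x) * x) - (1ℚ + x))

    -- The right-hand side gathers, with opposite sign, what `∑pivots leading` contains of H P
    -- alone, from all three regions. The coefficients of `P` agree, and what they leave is named
    -- `remainder`.
    side : ∀ x y P → let d = ½ * ((1ℚ + x) * x)
                         c = + 1 / 6 * ((1ℚ + x) * x * (x - 1ℚ)) in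
      ½ * ((1ℚ + (x + y)) * (x + y)) * ((1ℚ + x) * P)
      ≡ + 2 / 1 * (c * (P - + 5 / 6) + d * (P - 3/2) + 3/2 * c)
        + y * (d * (P - ½) + (1ℚ + x) * (P - 1ℚ) + 3/2 * d)
        + ½ * (y * (y - 1ℚ)) * ((1ℚ + x) * P)
        + y * (d * (P - ½)) + c * (P - + 5 / 6) - remainder x y
    side = solve 3 (λ x y P →
      let d = con ½ :* ((con 1ℚ :+ x) :* x)
          c = con (+ 1 / 6) :* ((con 1ℚ :+ x) :* x :* (x :- con 1ℚ)) in
      con ½ :* ((con 1ℚ :+ (x :+ y)) :* (x :+ y)) :* ((con 1ℚ :+ x) :* P)
      := con (+ 2 / 1) :* (c :* (P :- con (+ 5 / 6)) :+ d :* (P :- con 3/2) :+ con 3/2 :* c)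
        :+ y :* (d :* (P :- con ½) :+ (con 1ℚ :+ x) :* (P :- con 1ℚ) :+ con 3/2 :* d)
        :+ con ½ :* (y :* (y :- con 1ℚ)) :* ((con 1ℚ :+ x) :* P)
        :+ y :* (d :* (P :- con ½)) :+ c :* (P :- con (+ 5 / 6))
        :- (con (+ 1 / 12) :* ((con 1ℚ :+ x) :* x :* (x :- con 1ℚ)) :- con 3/2 :* ((con 1ℚ :+ x) :* x)
          :+ y :* (con (+ 1 / 4) :* ((con 1ℚ :+ x) :* x) :- (con 1ℚ :+ x)))) refl

    -- The cubic terms on the left add up to s³ / 2, just as those of `pairs p q * (1ℚ + s)` do.
    -- This determines the coefficient 3/2 of n in `leading`: any other would leave a residual of
    -- cubic order.
    remainders : ∀ p q → let s = ι p + ι q in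
      pairs p q * (+ 20 / 3 + + 5 / 6 * s) + remainder (ι p) (ι q) + remainder (ι q) (ι p)
      ≡ pairs p q * (1ℚ + s) + residual p q
    remainders p q = solve 2 (λ x y →
      let s = x :+ y
          D = con ½ :* ((con 1ℚ :+ s) :* s)
          r = λ x y → con (+ 1 / 12) :* ((con 1ℚ :+ x) :* x :* (x :- con 1ℚ))
                :- con 3/2 :* ((con 1ℚ :+ x) :* x)
                :+ y :* (con (+ 1 / 4) :* ((con 1ℚ :+ x) :* x) :- (con 1ℚ :+ x)) in
      D :* (con (+ 20 / 3) :+ con (+ 5 / 6) :* s) :+ r x y :+ r y x
      := D :* (con 1ℚ :+ s)
        :+ (con (+ 5 / 4) :* (x :* x :+ y :* y) :+ con (+ 1 / 4) :* (x :+ y) :+ con (+ 4 / 1) :* (x :* y)))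
      refl (ι p) (ι q)

  leading-recurrence : ∀ p q → pairs p q * leading p q
    ≡ pairs p q * (1ℚ + (ι p + ι q)) + residual p q + ∑pivots leading p q
  leading-recurrence p q = begin
    D * (w₀ s - l₀ p - l₀ q)
      ≡⟨ solve 4 (λ D w x y → D :* (w :- x :- y) := D :* w :- D :* x :- D :* y) refl
           D (w₀ s) (l₀ p) (l₀ q) ⟩
    D * w₀ s - D * l₀ p - D * l₀ q
      -- H n, H P and H Q are treated separately: multiplied by `D`, each part of `leading` is its
      -- own share of `∑pivots leading` up to a polynomial.
      ≡⟨ cong₂ _-_ (cong₂ _-_ top (side (ι p) (ι q) (h₀ p)))
           (trans (cong (λ t → ½ * ((1ℚ + t) * t) * l₀ q) (+-comm (ι p) (ι q)))
             (side (ι q) (ι p) (h₀ q))) ⟩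
    E + + 3 / 1 * w₂ s - left p q - left q p
      ≡⟨ combination E (w₂ s) (remainder (ι p) (ι q)) (remainder (ι q) (ι p))
           (w₂ p) (ι q * w₁ p) (½ * (ι q * (ι q - 1ℚ)) * l₀ p) (ι q * l₁ p) (l₂ p)
           (w₂ q) (ι p * w₁ q) (½ * (ι p * (ι p - 1ℚ)) * l₀ q) (ι p * l₁ q) (l₂ q) ⟩
    E + remainder (ι p) (ι q) + remainder (ι q) (ι p) + _
      ≡⟨ cong₂ _+_ (remainders p q) (sym (Leading.∑pivots-sep p q)) ⟩
    pairs p q * (1ℚ + (ι p + ι q)) + residual p q + ∑pivots leading p q ∎
    where
    open Relation.Binary.PropositionalEquality.≡-Reasoning
    s = p ℕ.+ q
    D = pairs p q
    E = D * (+ 20 / 3 + + 5 / 6 * (ι p + ι q))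
    left : ℕ → ℕ → ℚ
    left p q = + 2 / 1 * w₂ p + ι q * w₁ p + ½ * (ι q * (ι q - 1ℚ)) * l₀ p + ι q * l₁ p + l₂ p
      - remainder (ι p) (ι q)
    top : D * w₀ s ≡ E + + 3 / 1 * w₂ s
    top = subst (λ t → ½ * ((1ℚ + t) * t) * w₀ s
        ≡ ½ * ((1ℚ + t) * t) * (+ 20 / 3 + + 5 / 6 * t) + + 3 / 1 * w₂ s)
      (ι-+ p q) (above (ι s) (h₀ s))
    combination : ∀ e w r r′ a b c d f a′ b′ c′ d′ f′ →
      e + + 3 / 1 * w - (+ 2 / 1 * a + b + c + d + f - r) - (+ 2 / 1 * a′ + b′ + c′ + d′ + f′ - r′)
      ≡ e + r + r′ + ((w - a - b - c - f′) + (w - a′ - a - d - d′) + (w - a′ - b′ - c′ - f))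
    combination = solve 14 (λ e w r r′ a b c d f a′ b′ c′ d′ f′ →
      e :+ con (+ 3 / 1) :* w :- (con (+ 2 / 1) :* a :+ b :+ c :+ d :+ f :- r)
        :- (con (+ 2 / 1) :* a′ :+ b′ :+ c′ :+ d′ :+ f′ :- r′)
      := e :+ r :+ r′ :+ ((w :- a :- b :- c :- f′) :+ (w :- a′ :- a :- d :- d′)
        :+ (w :- a′ :- b′ :- c′ :- f))) refl

  private
    logarithmic≡ : ∀ p q → Logarithmic.sep p q ≡ logarithmic p q
    logarithmic≡ p q = solve 2 (λ P Q → con 0ℚ :- :- P :- :- Q := P :+ Q) refl (h₀ p) (h₀ q)

  private
    logarithmic-side : ∀ x y P →
      ½ * ((1ℚ + (x + y)) * (x + y)) * P
      ≡ ½ * (y * (y - 1ℚ)) * P + y * ((1ℚ + x) * (P - 1ℚ)) + ½ * ((1ℚ + x) * x) * (P - 3/2)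
        + (y * (1ℚ + x) + + 3 / 4 * ((1ℚ + x) * x))
    logarithmic-side = solve 3 (λ x y P →
      con ½ :* ((con 1ℚ :+ (x :+ y)) :* (x :+ y)) :* P
      := con ½ :* (y :* (y :- con 1ℚ)) :* P :+ y :* ((con 1ℚ :+ x) :* (P :- con 1ℚ))
        :+ con ½ :* ((con 1ℚ :+ x) :* x) :* (P :- con 3/2)
        :+ (y :* (con 1ℚ :+ x) :+ con (+ 3 / 4) :* ((con 1ℚ :+ x) :* x))) refl

    logarithmic-remainders : ∀ p q → let x = ι p; y = ι q in
      (y * (1ℚ + x) + + 3 / 4 * ((1ℚ + x) * x)) + (x * (1ℚ + y) + + 3 / 4 * ((1ℚ + y) * y))
      ≡ pairs p q + slack p q
    logarithmic-remainders p q = solve 2 (λ x y →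
      (y :* (con 1ℚ :+ x) :+ con (+ 3 / 4) :* ((con 1ℚ :+ x) :* x))
        :+ (x :* (con 1ℚ :+ y) :+ con (+ 3 / 4) :* ((con 1ℚ :+ y) :* y))
      := con ½ :* ((con 1ℚ :+ (x :+ y)) :* (x :+ y))
        :+ (x :* y :+ con (+ 1 / 4) :* (x :* x :+ y :* y) :+ con (+ 5 / 4) :* (x :+ y))) refl (ι p) (ι q)

  logarithmic-recurrence : ∀ p q → pairs p q * logarithmic p q
    ≡ pairs p q + slack p q + ∑pivots logarithmic p q
  logarithmic-recurrence p q = begin
    pairs p q * (h₀ p + h₀ q)
      ≡⟨ *-distribˡ-+ (pairs p q) (h₀ p) (h₀ q) ⟩
    pairs p q * h₀ p + pairs p q * h₀ q
      ≡⟨ cong₂ _+_ (logarithmic-side x y (h₀ p))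
           (trans (cong (λ t → ½ * ((1ℚ + t) * t) * h₀ q) (+-comm x y))
             (logarithmic-side y x (h₀ q))) ⟩
    (a + y * h₁ p + h₂ p + e) + (a′ + x * h₁ q + h₂ q + e′)
      ≡⟨ solve 10 (λ y x e e′ a b c a′ b′ c′ →
           (a :+ y :* b :+ c :+ e) :+ (a′ :+ x :* b′ :+ c′ :+ e′)
           := (e :+ e′) :+ (a :+ y :* b :+ c :+ (a′ :+ x :* b′ :+ c′))) refl
           y x e e′ a (h₁ p) (h₂ p) a′ (h₁ q) (h₂ q) ⟩
    (e + e′) + (a + y * h₁ p + h₂ p + (a′ + x * h₁ q + h₂ q))
      ≡⟨ cong₂ _+_ (logarithmic-remainders p q)
           (solve 10 (λ x y t t′ H H′ b c b′ c′ → let o = con 0ℚ in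
             t :* H :+ y :* b :+ c :+ (t′ :* H′ :+ x :* b′ :+ c′)
             := (o :- o :- y :* o :- t :* (:- H) :- (:- c′))
               :+ (o :- o :- o :- y :* (:- b) :- x :* (:- b′))
               :+ (o :- o :- x :* o :- t′ :* (:- H′) :- (:- c))) refl
             x y (½ * (y * (y - 1ℚ))) (½ * (x * (x - 1ℚ))) (h₀ p) (h₀ q) (h₁ p) (h₂ p) (h₁ q) (h₂ q)) ⟩
    pairs p q + slack p q + _
      ≡⟨ cong (_+_ (pairs p q + slack p q))
           (trans (sym (Logarithmic.∑pivots-sep p q)) (∑pivots-cong logarithmic≡ p q)) ⟩
    pairs p q + slack p q + ∑pivots logarithmic p q ∎
    where
    open Relation.Binary.PropositionalEquality.≡-Reasoning
    x = ι p
    y = ι q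
    a = ½ * (y * (y - 1ℚ)) * h₀ p
    a′ = ½ * (x * (x - 1ℚ)) * h₀ q
    e = y * (1ℚ + x) + + 3 / 4 * ((1ℚ + x) * x)
    e′ = x * (1ℚ + y) + + 3 / 4 * ((1ℚ + y) * y)

  0≤residual : ∀ p q → 0ℚ ≤ residual p q
  0≤residual p q = 0≤+ (0≤+
    (0≤* (nonNegative⁻¹ (+ 5 / 4)) (0≤+ (0≤* (0≤ι p) (0≤ι p)) (0≤* (0≤ι q) (0≤ι q))))
    (0≤* (nonNegative⁻¹ (+ 1 / 4)) (0≤+ (0≤ι p) (0≤ι q))))
    (0≤* (nonNegative⁻¹ (+ 4 / 1)) (0≤* (0≤ι p) (0≤ι q)))

  residual≤ : ∀ p q → residual p q ≤ + 4 / 1 * pairs p q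
  residual≤ p q = ≤-by
    (+ 3 / 4 * (ι p * ι p + ι q * ι q) + + 7 / 4 * (ι p + ι q))
    (0≤+ (0≤* (nonNegative⁻¹ (+ 3 / 4)) (0≤+ (0≤* (0≤ι p) (0≤ι p)) (0≤* (0≤ι q) (0≤ι q))))
      (0≤* (nonNegative⁻¹ (+ 7 / 4)) (0≤+ (0≤ι p) (0≤ι q))))
    (solve 2 (λ x y → con (+ 4 / 1) :* (con ½ :* ((con 1ℚ :+ (x :+ y)) :* (x :+ y)))
      := con (+ 5 / 4) :* (x :* x :+ y :* y) :+ con (+ 1 / 4) :* (x :+ y) :+ con (+ 4 / 1) :* (x :* y)
        :+ (con (+ 3 / 4) :* (x :* x :+ y :* y) :+ con (+ 7 / 4) :* (x :+ y))) refl (ι p) (ι q))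

  0≤slack : ∀ p q → 0ℚ ≤ slack p q
  0≤slack p q = 0≤+ (0≤+ (0≤* (0≤ι p) (0≤ι q))
    (0≤* (nonNegative⁻¹ (+ 1 / 4)) (0≤+ (0≤* (0≤ι p) (0≤ι p)) (0≤* (0≤ι q) (0≤ι q)))))
    (0≤* (nonNegative⁻¹ (+ 5 / 4)) (0≤+ (0≤ι p) (0≤ι q)))

  0≤harmonic : ∀ n → 0ℚ ≤ harmonic n
  0≤harmonic zero    = ≤-refl
  0≤harmonic (suc n) = 0≤+ (0≤harmonic n) (0≤1/ n)

  -- The Mercator series

  cancel-* : ∀ {c x y} → 0ℚ < c → c * x ≤ c * y → x ≤ y
  cancel-* {c} 0<c = *-cancelˡ-≤-pos c {{positive 0<c}}

  *-monoˡ : ∀ {c x y} → 0ℚ ≤ c → x ≤ y → c * x ≤ c * y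
  *-monoˡ {c} 0≤c x≤y = *-monoˡ-≤-nonNeg c {{nonNegative 0≤c}} x≤y

  ^-nonNeg : ∀ {u} n → 0ℚ ≤ u → 0ℚ ≤ u ^ n
  ^-nonNeg zero    0≤u = nonNegative⁻¹ 1ℚ
  ^-nonNeg (suc n) 0≤u = 0≤* 0≤u (^-nonNeg n 0≤u)

  ^-mono : ∀ {u v} n → 0ℚ ≤ u → u ≤ v → u ^ n ≤ v ^ n
  ^-mono zero    0≤u u≤v = ≤-refl
  ^-mono (suc n) 0≤u u≤v = *-mono 0≤u u≤v (^-nonNeg n 0≤u) (^-mono n 0≤u u≤v)

  ^-≤1 : ∀ {u} n → 0ℚ ≤ u → u ≤ 1ℚ → u ^ n ≤ 1ℚ
  ^-≤1 zero    0≤u u≤1 = ≤-refl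
  ^-≤1 (suc n) 0≤u u≤1 = *-mono 0≤u u≤1 (^-nonNeg n 0≤u) (^-≤1 n 0≤u u≤1)

  -- Induction works since (1 - c) (1 + (N + 1) c) falls short of 1 + N c by (N + 1) c².
  bernoulli : ∀ c → 0ℚ ≤ c → c ≤ 1ℚ → ∀ N → (1ℚ - c) ^ N * (1ℚ + ι N * c) ≤ 1ℚ
  bernoulli c 0≤c c≤1 zero    = ≤-reflexive (solve 1 (λ c →
    con 1ℚ :* (con 1ℚ :+ con 0ℚ :* c) := con 1ℚ) refl c)
  bernoulli c 0≤c c≤1 (suc N) = ≤-trans
    (≤-by ((1ℚ - c) ^ N * ((ι N + 1ℚ) * (c * c)))
      (0≤* (^-nonNeg N (0≤- c≤1)) (0≤* (0≤+ (0≤ι N) (nonNegative⁻¹ 1ℚ)) (0≤* 0≤c 0≤c)))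
      (trans (solve 3 (λ c b t → b :* (con 1ℚ :+ t :* c)
          := (con 1ℚ :- c) :* b :* (con 1ℚ :+ (con 1ℚ :+ t) :* c) :+ b :* ((t :+ con 1ℚ) :* (c :* c)))
          refl c ((1ℚ - c) ^ N) (ι N))
        (cong (λ t → (1ℚ - c) ^ suc N * (1ℚ + t * c) + (1ℚ - c) ^ N * ((ι N + 1ℚ) * (c * c)))
          (sym (ι-suc N)))))
    (bernoulli c 0≤c c≤1 N)

  module _ {u v} (0≤v : 0ℚ ≤ v) (v≤u : v ≤ u) where
    private
      0≤u = ≤-trans 0≤v v≤u
      D = u - v

    -- Together with `^-diff-≥` a mean value theorem for powers, with the derivative taken at the
    -- larger endpoint here and at the smaller one there.
    ^-diff-≤ : ∀ k → u ^ suc k - v ^ suc k ≤ ι (suc k) * (u ^ k * D)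
    ^-diff-≤ zero    = ≤-reflexive (solve 2 (λ u v → u :* con 1ℚ :- v :* con 1ℚ
      := con 1ℚ :* (con 1ℚ :* (u :- v))) refl u v)
    ^-diff-≤ (suc k) = ≤-by
      (u * (ι (suc k) * (u ^ k * D) - (u ^ suc k - v ^ suc k)) + (u ^ suc k - v ^ suc k) * D)
      (0≤+ (0≤* 0≤u (0≤- (^-diff-≤ k))) (0≤* (0≤- (^-mono (suc k) 0≤v v≤u)) (0≤- v≤u)))
      (trans (cong (_* (u ^ suc k * D)) (ι-suc (suc k)))
        (solve 5 (λ u v n x y → (con 1ℚ :+ n) :* (u :* x :* (u :- v))
          := u :* (u :* x) :- v :* y
            :+ (u :* (n :* (x :* (u :- v)) :- (u :* x :- y)) :+ (u :* x :- y) :* (u :- v))) refl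
          u v (ι (suc k)) (u ^ k) (v ^ suc k)))

    ^-diff-≥ : ∀ k → ι (suc k) * (v ^ k * D) ≤ u ^ suc k - v ^ suc k
    ^-diff-≥ zero    = ≤-reflexive (solve 2 (λ u v → con 1ℚ :* (con 1ℚ :* (u :- v))
      := u :* con 1ℚ :- v :* con 1ℚ) refl u v)
    ^-diff-≥ (suc k) = ≤-by
      (v * ((u ^ suc k - v ^ suc k) - ι (suc k) * (v ^ k * D)) + (u ^ suc k - v ^ suc k) * D)
      (0≤+ (0≤* 0≤v (0≤- (^-diff-≥ k))) (0≤* (0≤- (^-mono (suc k) 0≤v v≤u)) (0≤- v≤u)))
      (trans (solve 5 (λ u v n x y → u :* y :- v :* (v :* x)
          := (con 1ℚ :+ n) :* (v :* x :* (u :- v))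
            :+ (v :* ((y :- v :* x) :- n :* (x :* (u :- v))) :+ (y :- v :* x) :* (u :- v))) refl
          u v (ι (suc k)) (v ^ k) (u ^ suc k))
        (cong (λ t → t * (v ^ suc k * D) + (v * ((u ^ suc k - v ^ suc k) - ι (suc k) * (v ^ k * D))
          + (u ^ suc k - v ^ suc k) * D)) (sym (ι-suc (suc k)))))

    private
      term-diff : ∀ k a → ι (suc k) * a * 1/[1+ k ] ≡ a
      term-diff k a = trans (solve 3 (λ n a r → n :* a :* r := a :* (n :* r)) refl
        (ι (suc k)) a 1/[1+ k ]) (trans (cong (a *_) (ι*1/ k)) (*-identityʳ a))

      term-≤ : ∀ k → (u ^ suc k - v ^ suc k) * 1/[1+ k ] ≤ u ^ k * D
      term-≤ k = subst ((u ^ suc k - v ^ suc k) * 1/[1+ k ] ≤_) (term-diff k (u ^ k * D))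
        (*-monoʳ-≤-nonNeg 1/[1+ k ] {{nonNegative (0≤1/ k)}} (^-diff-≤ k))

      term-≥ : ∀ k → v ^ k * D ≤ (u ^ suc k - v ^ suc k) * 1/[1+ k ]
      term-≥ k = subst (_≤ (u ^ suc k - v ^ suc k) * 1/[1+ k ]) (term-diff k (v ^ k * D))
        (*-monoʳ-≤-nonNeg 1/[1+ k ] {{nonNegative (0≤1/ k)}} (^-diff-≥ k))

    -- A mean value estimate for - ln (1 - x), whose derivative is 1 / (1 - x). The differences of
    -- the terms are at most `u ^ k * D`, a geometric series; its sum is cleared of the denominator
    -- 1 - u, so that u = 1 needs no exception.
    mercator-diff-≤ : u ≤ 1ℚ → ∀ N → (1ℚ - u) * (mercator N u - mercator N v) ≤ D * (1ℚ - u ^ N)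
    mercator-diff-≤ u≤1 zero    = ≤-reflexive (solve 2 (λ u d →
      (con 1ℚ :- u) :* (con 0ℚ :- con 0ℚ) := d :* (con 1ℚ :- con 1ℚ)) refl u D)
    mercator-diff-≤ u≤1 (suc N) = ≤-by
      ((D * (1ℚ - u ^ N) - (1ℚ - u) * (mercator N u - mercator N v))
        + (1ℚ - u) * (u ^ N * D - (u ^ suc N - v ^ suc N) * 1/[1+ N ]))
      (0≤+ (0≤- (mercator-diff-≤ u≤1 N)) (0≤* (0≤- u≤1) (0≤- (term-≤ N))))
      (solve 7 (λ u d x y a b r → d :* (con 1ℚ :- u :* x)
        := (con 1ℚ :- u) :* ((a :+ u :* x :* r) :- (b :+ y :* r))
          :+ ((d :* (con 1ℚ :- x) :- (con 1ℚ :- u) :* (a :- b))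
            :+ (con 1ℚ :- u) :* (x :* d :- (u :* x :- y) :* r))) refl
        u D (u ^ N) (v ^ suc N) (mercator N u) (mercator N v) 1/[1+ N ])

    mercator-diff-≥ : u ≤ 1ℚ → ∀ N → D * (1ℚ - v ^ N) ≤ (1ℚ - v) * (mercator N u - mercator N v)
    mercator-diff-≥ u≤1 zero    = ≤-reflexive (solve 2 (λ v d →
      d :* (con 1ℚ :- con 1ℚ) := (con 1ℚ :- v) :* (con 0ℚ :- con 0ℚ)) refl v D)
    mercator-diff-≥ u≤1 (suc N) = ≤-by
      (((1ℚ - v) * (mercator N u - mercator N v) - D * (1ℚ - v ^ N))
        + (1ℚ - v) * ((u ^ suc N - v ^ suc N) * 1/[1+ N ] - v ^ N * D))
      (0≤+ (0≤- (mercator-diff-≥ u≤1 N)) (0≤* (0≤- (≤-trans v≤u u≤1)) (0≤- (term-≥ N))))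
      (solve 7 (λ v d x y a b r →
        (con 1ℚ :- v) :* ((a :+ y :* r) :- (b :+ v :* x :* r))
        := d :* (con 1ℚ :- v :* x)
          :+ (((con 1ℚ :- v) :* (a :- b) :- d :* (con 1ℚ :- x))
            :+ (con 1ℚ :- v) :* ((y :- v :* x) :* r :- x :* d))) refl
        v D (v ^ N) (u ^ suc N) (mercator N u) (mercator N v) 1/[1+ N ])

    mercator-mono : u ≤ 1ℚ → ∀ N → mercator N v ≤ mercator N u
    mercator-mono u≤1 zero    = ≤-refl
    mercator-mono u≤1 (suc N) = +-mono-≤ (mercator-mono u≤1 N)
      (*-monoʳ-≤-nonNeg 1/[1+ N ] {{nonNegative (0≤1/ N)}} (^-mono (suc N) 0≤v v≤u))

  ∣-∣-comm : ∀ x y → ∣ x - y ∣ ≡ ∣ y - x ∣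
  ∣-∣-comm x y = trans (sym (∣-p∣≡∣p∣ (x - y)))
    (cong ∣_∣ (solve 2 (λ x y → :- (x :- y) := y :- x) refl x y))

  private
    mercator-lipschitz-ordered : ∀ {c} → 0ℚ ≤ c → ∀ {u v} → 0ℚ ≤ v → v ≤ u → u ≤ 1ℚ - c →
      ∀ N → c * ∣ mercator N u - mercator N v ∣ ≤ ∣ u - v ∣
    mercator-lipschitz-ordered {c} 0≤c {u} {v} 0≤v v≤u u≤ N = subst₂ (λ s t → c * s ≤ t)
      (sym (0≤p⇒∣p∣≡p 0≤Δ)) (sym (0≤p⇒∣p∣≡p (0≤- v≤u)))
      (≤-trans
        (≤-by ((1ℚ - c - u) * Δ) (0≤* (0≤- u≤) 0≤Δ)
          (solve 3 (λ c u d → (con 1ℚ :- u) :* d := c :* d :+ (con 1ℚ :- c :- u) :* d) refl c u Δ))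
        (≤-trans (mercator-diff-≤ 0≤v v≤u u≤1 N)
          (≤-by ((u - v) * u ^ N) (0≤* (0≤- v≤u) (^-nonNeg N (≤-trans 0≤v v≤u)))
            (solve 2 (λ d x → d := d :* (con 1ℚ :- x) :+ d :* x) refl (u - v) (u ^ N)))))
      where
      Δ = mercator N u - mercator N v
      u≤1 = ≤-trans u≤ (≤-by c 0≤c (solve 1 (λ c → con 1ℚ := con 1ℚ :- c :+ c) refl c))
      0≤Δ = 0≤- (mercator-mono 0≤v v≤u u≤1 N)

  mercator-lipschitz : ∀ {c} → 0ℚ ≤ c → ∀ {u v} → 0ℚ ≤ u → u ≤ 1ℚ - c → 0ℚ ≤ v → v ≤ 1ℚ - c →
    ∀ N → c * ∣ mercator N u - mercator N v ∣ ≤ ∣ u - v ∣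
  mercator-lipschitz {c} 0≤c {u} {v} 0≤u u≤ 0≤v v≤ N with ≤-total v u
  ... | inj₁ v≤u = mercator-lipschitz-ordered 0≤c 0≤v v≤u u≤ N
  ... | inj₂ u≤v = subst₂ (λ s t → c * s ≤ t)
      (∣-∣-comm (mercator N v) (mercator N u)) (∣-∣-comm v u)
      (mercator-lipschitz-ordered 0≤c 0≤u u≤v v≤ N)

  mercator-0 : ∀ N → mercator N 0ℚ ≡ 0ℚ
  mercator-0 zero    = refl
  mercator-0 (suc N) = trans (cong₂ _+_ (mercator-0 N)
    (trans (cong (_* 1/[1+ N ]) (*-zeroˡ (0ℚ ^ N))) (*-zeroˡ 1/[1+ N ]))) refl

  ∣mercator∣≤ : ∀ {c v} → 0ℚ ≤ c → 0ℚ ≤ v → v ≤ 1ℚ - c → ∀ N → c * ∣ mercator N v ∣ ≤ 1ℚ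
  ∣mercator∣≤ {c} {v} 0≤c 0≤v v≤ N = subst (λ t → c * ∣ t ∣ ≤ 1ℚ)
    (trans (cong (λ t → mercator N v - t) (mercator-0 N)) (+-identityʳ (mercator N v)))
    (≤-trans (mercator-lipschitz 0≤c 0≤v v≤ ≤-refl (≤-trans 0≤v v≤) N)
      (subst (_≤ 1ℚ) (sym (trans (cong ∣_∣ (+-identityʳ v)) (0≤p⇒∣p∣≡p 0≤v)))
        (≤-trans v≤ (≤-by c 0≤c (solve 1 (λ c → con 1ℚ := con 1ℚ :- c :+ c) refl c)))))

  -- - ln (j / n) is, up to the truncation of the Mercator series, a sum of
  -- increments between 1 / (i + 1) and 1 / i over j ≤ i < n.
  module _ (k : ℕ) (N : ℕ) where
    private
      r = 1/[1+ k ]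

      arg : ℕ → ℚ
      arg j = 1ℚ - ι j * r

      arg-end : arg (suc k) ≡ 0ℚ
      arg-end = trans (cong (_-_ 1ℚ) (ι*1/ k)) (+-inverseʳ 1ℚ)

      arg-step : ∀ j → arg j - arg (suc j) ≡ r
      arg-step j = trans (cong (λ t → arg j - (1ℚ - t * r)) (ι-suc j))
        (solve 2 (λ j r → (con 1ℚ :- j :* r) :- (con 1ℚ :- (con 1ℚ :+ j) :* r) := r) refl (ι j) r)

      arg-nonNeg : ∀ {j} → j ℕ.≤ suc k → 0ℚ ≤ arg j
      arg-nonNeg {j} j≤n = subst (_≤ arg j) arg-end
        (+-monoʳ-≤ 1ℚ (neg-antimono-≤ (*-monoʳ-≤-nonNeg r {{nonNegative (0≤1/ k)}} (ι-mono j≤n))))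

      arg-mono : ∀ j → arg (suc j) ≤ arg j
      arg-mono j = +-monoʳ-≤ 1ℚ (neg-antimono-≤
        (*-monoʳ-≤-nonNeg r {{nonNegative (0≤1/ k)}} (ι-mono (ℕₚ.n≤1+n j))))

      arg≤1 : ∀ j → arg j ≤ 1ℚ
      arg≤1 j = ≤-by (ι j * r) (0≤* (0≤ι j) (0≤1/ k))
        (solve 1 (λ x → con 1ℚ := con 1ℚ :- x :+ x) refl (ι j * r))

      L : ℕ → ℚ
      L j = mercator N (arg j)

      L-end : L (suc k) ≡ 0ℚ
      L-end = trans (cong (mercator N) arg-end) (mercator-0 N)

      divide : ∀ j {x} y → r * y ≤ ι (suc j) * r * x → 1/[1+ j ] * y ≤ x
      divide j {x} y h = cancel-* (0<* (0<ι-suc j) (0<1/ k)) (subst (_≤ ι (suc j) * r * x)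
        (trans (sym (trans (cong (_* (r * y)) (ι*1/ j)) (*-identityˡ (r * y))))
          (solve 4 (λ n s r y → n :* s :* (r :* y) := n :* r :* (s :* y)) refl (ι (suc j)) 1/[1+ j ] r y))
        h)

      multiply : ∀ j {x} → ι (suc j) * r * x ≤ r → x ≤ 1/[1+ j ]
      multiply j {x} h = cancel-* (0<* (0<ι-suc j) (0<1/ k)) (≤-trans h (≤-reflexive
        (trans (sym (trans (cong (_* r) (ι*1/ j)) (*-identityˡ r)))
          (solve 3 (λ n s r → n :* s :* r := n :* r :* s) refl (ι (suc j)) 1/[1+ j ] r))))

      1-1- : ∀ x → 1ℚ - (1ℚ - x) ≡ x
      1-1- = solve 1 (λ x → con 1ℚ :- (con 1ℚ :- x) := x) refl

      step-≤ : ∀ j → suc j ℕ.≤ k → L (suc j) - L (suc (suc j)) ≤ 1/[1+ j ]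
      step-≤ j j<k = multiply j (≤-trans (subst₂ _≤_
          (cong (_* (L (suc j) - L (suc (suc j)))) (1-1- (ι (suc j) * r)))
          (cong (_* (1ℚ - arg (suc j) ^ N)) (arg-step (suc j)))
          (mercator-diff-≤ (arg-nonNeg (ℕ.s≤s j<k)) (arg-mono (suc j)) (arg≤1 (suc j)) N))
        (≤-by (r * arg (suc j) ^ N)
          (0≤* (0≤1/ k) (^-nonNeg N (arg-nonNeg (ℕₚ.m≤n⇒m≤1+n j<k))))
          (solve 2 (λ r x → r := r :* (con 1ℚ :- x) :+ r :* x) refl r (arg (suc j) ^ N))))

      -- The factor lost by truncating the series depends on `j`. Since `b` will bound all arguments
      -- that occur, one common factor can be taken out of the whole harmonic sum.
      step-≥ : ∀ j {b} → suc j ℕ.≤ suc k → arg (suc j) ≤ b →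
               1/[1+ j ] * (1ℚ - b ^ N) ≤ L j - L (suc j)
      step-≥ j {b} j≤k a≤b = divide j (1ℚ - b ^ N) (≤-trans
        (*-monoˡ (0≤1/ k) (+-monoʳ-≤ 1ℚ (neg-antimono-≤ (^-mono N (arg-nonNeg j≤k) a≤b))))
        (subst₂ _≤_
          (cong (_* (1ℚ - arg (suc j) ^ N)) (arg-step j))
          (cong (_* (L j - L (suc j))) (1-1- (ι (suc j) * r)))
          (mercator-diff-≥ (arg-nonNeg j≤k) (arg-mono j) (arg≤1 j) N)))

    -- The increment from (j + 1) / n to (j + 2) / n is bounded by 1 / (j + 1), so this harmonic sum
    -- starts and ends one place earlier than the one in `harmonic≤mercator` for the same argument.
    mercator≤harmonic : ∀ d j → d ℕ.+ j ≡ k →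
      mercator N (1ℚ - ι (suc j) * 1/[1+ k ]) ≤ harmonic k - harmonic j
    mercator≤harmonic zero    j refl = ≤-reflexive (trans L-end (sym (+-inverseʳ (harmonic j))))
    mercator≤harmonic (suc d) j eq = ≤-by
      ((harmonic k - harmonic (suc j) - L (suc (suc j))) + (1/[1+ j ] - (L (suc j) - L (suc (suc j)))))
      (0≤+ (0≤- (mercator≤harmonic d (suc j) (trans (ℕₚ.+-suc d j) eq)))
        (0≤- (step-≤ j (subst (suc j ℕ.≤_) eq (ℕ.s≤s (ℕₚ.m≤n+m j d))))))
      (solve 5 (λ a b c d r → a :- b := c :+ ((a :- (b :+ r) :- d) :+ (r :- (c :- d)))) refl
        (harmonic k) (harmonic j) (L (suc j)) (L (suc (suc j))) 1/[1+ j ])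

    harmonic≤mercator : ∀ {b} d j → d ℕ.+ j ≡ suc k → 1ℚ - ι j * 1/[1+ k ] ≤ b →
      (1ℚ - b ^ N) * (harmonic (suc k) - harmonic j) ≤ mercator N (1ℚ - ι j * 1/[1+ k ])
    harmonic≤mercator {b} zero    j refl a≤b = ≤-reflexive (trans
      (solve 2 (λ b h → b :* (h :- h) := con 0ℚ) refl (1ℚ - b ^ N) (harmonic (suc k))) (sym L-end))
    harmonic≤mercator {b} (suc d) j eq a≤b = ≤-by
      ((L (suc j) - B * (harmonic (suc k) - harmonic (suc j))) + ((L j - L (suc j)) - 1/[1+ j ] * B))
      (0≤+ (0≤- (harmonic≤mercator d (suc j) (trans (ℕₚ.+-suc d j) eq) a′≤b))
        (0≤- (step-≥ j (subst (suc j ℕ.≤_) eq (ℕ.s≤s (ℕₚ.m≤n+m j d))) a′≤b)))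
      (solve 6 (λ B h g l m r → l := B :* (h :- g)
        :+ ((m :- B :* (h :- (g :+ r))) :+ ((l :- m) :- r :* B))) refl
        B (harmonic (suc k)) (harmonic j) (L j) (L (suc j)) 1/[1+ j ])
      where
      B = 1ℚ - b ^ N
      a′≤b = ≤-trans (arg-mono j) a≤b

  -- Growth of the harmonic numbers, decay of powers

  ∣+∣≤ : ∀ {x y r s} → ∣ x ∣ ≤ r → ∣ y ∣ ≤ s → ∣ x + y ∣ ≤ r + s
  ∣+∣≤ {x} {y} x≤ y≤ = ≤-trans (∣p+q∣≤∣p∣+∣q∣ x y) (+-mono-≤ x≤ y≤)

  1/≤1 : ∀ n → 1/[1+ n ] ≤ 1ℚ
  1/≤1 n = 1/-anti {0} {n} ℕ.z≤n

  harmonic≤ι : ∀ n → harmonic n ≤ ι n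
  harmonic≤ι zero    = ≤-refl
  harmonic≤ι (suc n) = ≤-trans (+-mono-≤ (harmonic≤ι n) (1/≤1 n))
    (≤-reflexive (trans (+-comm (ι n) 1ℚ) (sym (ι-suc n))))

  harmonic-mono : ∀ {m n} → m ℕ.≤ n → harmonic m ≤ harmonic n
  harmonic-mono {m} m≤n with ℕₚ.m≤n⇒∃[o]m+o≡n m≤n
  ... | k , refl = go k
    where
    go : ∀ k → harmonic m ≤ harmonic (m ℕ.+ k)
    go zero    = ≤-reflexive (cong harmonic (sym (ℕₚ.+-identityʳ m)))
    go (suc k) = subst (λ n → harmonic m ≤ harmonic n) (sym (ℕₚ.+-suc m k))
      (≤-trans (go k) (≤-by 1/[1+ m ℕ.+ k ] (0≤1/ (m ℕ.+ k)) refl))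

  -- The first `suc k` terms are at most 1 each and all later ones at most `1/[1+ k ]`. This makes H
  -- n / n small without any appeal to the logarithm.
  harmonic≤ : ∀ k n → harmonic n ≤ ι (suc k) + 1/[1+ k ] * ι n
  harmonic≤ k zero    = 0≤+ (0≤ι (suc k)) (0≤* (0≤1/ k) (0≤ι 0))
  harmonic≤ k (suc n) with ℕₚ.≤-total k n
  ... | inj₁ k≤n = ≤-trans (+-mono-≤ (harmonic≤ k n) (1/-anti k≤n)) (≤-reflexive (trans
    (solve 3 (λ a r n → a :+ r :* n :+ r := a :+ r :* (con 1ℚ :+ n)) refl (ι (suc k)) 1/[1+ k ] (ι n))
    (cong (λ t → ι (suc k) + 1/[1+ k ] * t) (sym (ι-suc n)))))
  ... | inj₂ n≤k = ≤-trans (harmonic≤ι (suc n)) (≤-trans (ι-mono (ℕ.s≤s n≤k))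
    (≤-by (1/[1+ k ] * ι (suc n)) (0≤* (0≤1/ k) (0≤ι (suc n))) refl))

  harmonic-sublinear : ∀ η → 0ℚ < η →
    ∃[ N ] ∀ n → N ℕ.≤ n → harmonic (suc n) * 1/[1+ n ] ≤ η
  harmonic-sublinear η 0<η =
    let θ = ½ * η
        0<θ = 0<* {½} {η} (positive⁻¹ ½) 0<η
        (k , 1/k≤θ) = archimedean θ 0<θ
        -- Chosen so that the bounded part k + 1 contributes at most `θ` after division by n + 1.
        (N , 1/N≤) = archimedean (θ * 1/[1+ k ]) (0<* 0<θ (0<1/ k))
    in N , λ n N≤n →
      let r = 1/[1+ n ] in
      ≤-trans (*-monoʳ-≤-nonNeg r {{nonNegative (0≤1/ n)}} (harmonic≤ k (suc n))) (
      ≤-by (ι (suc k) * (θ * 1/[1+ k ] - r) + (θ - 1/[1+ k ]))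
        (0≤+ (0≤* (0≤ι (suc k)) (0≤- (≤-trans (1/-anti N≤n) 1/N≤))) (0≤- 1/k≤θ))
        (begin
          η
            ≡⟨ solve 1 (λ η → η := con ½ :* η :* con 1ℚ :+ con ½ :* η) refl η ⟩
          θ * 1ℚ + θ
            ≡⟨ cong (λ t → θ * t + θ) (ι*1/ k) ⟨
          θ * (ι (suc k) * 1/[1+ k ]) + θ
            ≡⟨ solve 4 (λ θ a s r → θ :* (a :* s) :+ θ
                 := a :* r :+ s :* con 1ℚ :+ (a :* (θ :* s :- r) :+ (θ :- s))) refl
                 θ (ι (suc k)) 1/[1+ k ] r ⟩
          ι (suc k) * r + 1/[1+ k ] * 1ℚ + _
            ≡⟨ cong (λ t → ι (suc k) * r + 1/[1+ k ] * t + (ι (suc k) * (θ * 1/[1+ k ] - r) + (θ - 1/[1+ k ])))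
                 (ι*1/ n) ⟨
          ι (suc k) * r + 1/[1+ k ] * (ι (suc n) * r) + _
            ≡⟨ cong (λ t → t + (ι (suc k) * (θ * 1/[1+ k ] - r) + (θ - 1/[1+ k ])))
                 (solve 4 (λ a s n r → a :* r :+ s :* (n :* r) := (a :+ s :* n) :* r) refl
                   (ι (suc k)) 1/[1+ k ] (ι (suc n)) r) ⟩
          (ι (suc k) + 1/[1+ k ] * ι (suc n)) * r + _ ∎))
    where open Relation.Binary.PropositionalEquality.≡-Reasoning

  -- By `bernoulli`, the power is at most 1 / (1 + N c); any N above T / (θ c) therefore suffices.
  geometric-vanishes : ∀ {c} → 0ℚ < c → c ≤ 1ℚ → ∀ T {θ} → 0ℚ < θ →
    ∃[ K ] ∀ N → K ℕ.≤ N → (1ℚ - c) ^ N * T ≤ θ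
  geometric-vanishes {c} 0<c c≤1 T {θ} 0<θ =
    let 0<θc = 0<* 0<θ 0<c
        e = 1/[ 0<θc ]⁺
        (K , T/θc≤K) = ≤-ι (T * e)
    in K , λ N K≤N →
      let b = (1ℚ - c) ^ N
          0≤b = ^-nonNeg N (0≤- c≤1)
          T≤ : T ≤ θ * (1ℚ + ι N * c)
          T≤ = ≤-by (θ + (ι N - T * e) * (θ * c))
            (0≤+ (<⇒≤ 0<θ) (0≤* (0≤- (≤-trans T/θc≤K (ι-mono K≤N))) (<⇒≤ 0<θc)))
            (trans (solve 5 (λ θ n c T e → θ :* (con 1ℚ :+ n :* c)
                := T :* (θ :* c :* e) :+ (θ :+ (n :- T :* e) :* (θ :* c))) refl θ (ι N) c T e)
              (trans (cong (λ t → T * t + (θ + (ι N - T * e) * (θ * c))) (*-1/⁺ 0<θc))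
                (cong (_+ (θ + (ι N - T * e) * (θ * c))) (*-identityʳ T))))
      in ≤-trans (*-monoˡ 0≤b T≤)
          (≤-by (θ * (1ℚ - b * (1ℚ + ι N * c))) (0≤* (<⇒≤ 0<θ) (0≤- (bernoulli c (<⇒≤ 0<c) c≤1 N)))
            (solve 3 (λ θ b s → θ := b :* (θ :* s) :+ θ :* (con 1ℚ :- b :* s)) refl
              θ b (1ℚ + ι N * c)))

  -- Convergence of G / n to 3/2 + h

  module _ {c} (0<c : 0ℚ < c) (c≤1 : c ≤ 1ℚ) where
    private
      0≤c = <⇒≤ 0<c
      c⁻¹ = 1/[ 0<c ]⁺
      0≤c⁻¹ = <⇒≤ (0<1/⁺ 0<c)

      ≤c⁻¹* : ∀ {x y} → c * x ≤ y → x ≤ c⁻¹ * y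
      ≤c⁻¹* {x} {y} cx≤y = subst (_≤ c⁻¹ * y)
        (trans (solve 3 (λ c e x → e :* (c :* x) := c :* e :* x) refl c c⁻¹ x)
          (trans (cong (_* x) (*-1/⁺ 0<c)) (*-identityˡ x)))
        (*-monoˡ 0≤c⁻¹ cx≤y)

    -- The three errors come from `x * (A - X)`, harmonic against Mercator sum at one point;
    -- `x * (X - Y)`, the Lipschitz bound with constant 1 / c; and `(x - y) * Y`, the boundedness of
    -- the series on [0 , 1 - c]. Estimating `A` by n is crude but harmless, as `N` will be chosen
    -- after n.
    entropy-term : ∀ k i d → d ℕ.+ i ≡ k → ∀ N {δ y} →
      c ≤ ι (suc i) * 1/[1+ k ] → c ≤ y → y ≤ 1ℚ → ∣ ι (suc i) * 1/[1+ k ] - y ∣ ≤ δ →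
      ∣ ι (suc i) * 1/[1+ k ] * (harmonic (suc k) - harmonic (suc i)) - y * mercator N (1ℚ - y) ∣
      ≤ 1/[1+ k ] + (1ℚ - c) ^ N * ι (suc k) + (c⁻¹ * δ + δ * (c⁻¹ * 1ℚ))
    entropy-term k i d d+i≡k N {δ} {y} c≤x c≤y y≤1 x-y = subst (λ t → ∣ t ∣ ≤ _)
      (solve 5 (λ x y A X Y → (x :* (A :- X) :+ x :* (X :- Y)) :+ (x :- y) :* Y := x :* A :- y :* Y) refl
        x y A X Y)
      (subst (∣ x * (A - X) + x * (X - Y) + (x - y) * Y ∣ ≤_)
        (+-assoc (r + b * n) (c⁻¹ * δ) (δ * (c⁻¹ * 1ℚ)))
        (∣+∣≤ {x * (A - X) + x * (X - Y)} {(x - y) * Y} (∣+∣≤ {x * (A - X)} {x * (X - Y)} first second) third))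
      where
      r = 1/[1+ k ]
      n = ι (suc k)
      x = ι (suc i) * r
      A = harmonic (suc k) - harmonic (suc i)
      X = mercator N (1ℚ - x)
      Y = mercator N (1ℚ - y)
      b = (1ℚ - c) ^ N
      i≤k : i ℕ.≤ k
      i≤k = subst (i ℕ.≤_) d+i≡k (ℕₚ.m≤n+m i d)
      0≤x = ≤-trans 0≤c c≤x
      x≤1 : x ≤ 1ℚ
      x≤1 = subst (x ≤_) (ι*1/ k) (*-monoʳ-≤-nonNeg r {{nonNegative (0≤1/ k)}} (ι-mono (ℕ.s≤s i≤k)))
      0≤A = 0≤- (harmonic-mono (ℕ.s≤s i≤k))
      A≤n : A ≤ n
      A≤n = ≤-by (harmonic (suc i) + (n - harmonic (suc k)))
        (0≤+ (0≤harmonic (suc i)) (0≤- (harmonic≤ι (suc k))))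
        (solve 3 (λ n h g → n := h :- g :+ (g :+ (n :- h))) refl n (harmonic (suc k)) (harmonic (suc i)))
      0≤b : 0ℚ ≤ b
      0≤b = ^-nonNeg N (0≤- c≤1)
      first : ∣ x * (A - X) ∣ ≤ r + b * n
      first = ∣∣≤
        (≤-by (r + (b * (n - A) + (b * A * (1ℚ - x) + x * (X - (1ℚ - b) * A))))
          (0≤+ (0≤1/ k) (0≤+ (0≤* 0≤b (0≤- A≤n)) (0≤+ (0≤* (0≤* 0≤b 0≤A) (0≤- x≤1))
            (0≤* 0≤x (0≤- (harmonic≤mercator k N d (suc i)
              (trans (ℕₚ.+-suc d i) (cong suc d+i≡k))
              (+-monoʳ-≤ 1ℚ (neg-antimono-≤ c≤x))))))))
          (solve 6 (λ r b n A x X → r :+ b :* n := x :* (A :- X)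
            :+ (r :+ (b :* (n :- A) :+ (b :* A :* (con 1ℚ :- x) :+ x :* (X :- (con 1ℚ :- b) :* A))))) refl
            r b n A x X))
        (≤-by (b * n + (x * r + x * (harmonic k - harmonic i - X)))
          (0≤+ (0≤* 0≤b (0≤ι (suc k))) (0≤+ (0≤* 0≤x (0≤1/ k))
            (0≤* 0≤x (0≤- (mercator≤harmonic k N d i d+i≡k)))))
          -- Here x / (i + 1) = 1 / n: the offset by one place in `mercator≤harmonic` costs exactly
          -- the `r` in the bound.
          (trans (cong (_+ b * n) (trans (sym (*-identityˡ r)) (trans (cong (_* r) (sym (ι*1/ i)))
              (solve 3 (λ j s r → j :* s :* r := j :* r :* s) refl (ι (suc i)) 1/[1+ i ] r))))
            (solve 7 (λ x s bn h r g X → x :* s :+ bn := :- (x :* ((h :+ r) :- (g :+ s) :- X))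
              :+ (bn :+ (x :* r :+ x :* (h :- g :- X)))) refl
              x 1/[1+ i ] (b * n) (harmonic k) r (harmonic i) X)))
      u≤ : ∀ {z} → c ≤ z → 1ℚ - z ≤ 1ℚ - c
      u≤ c≤z = +-monoʳ-≤ 1ℚ (neg-antimono-≤ c≤z)
      second : ∣ x * (X - Y) ∣ ≤ c⁻¹ * δ
      second = ≤-trans
        (≤-reflexive (trans (∣p*q∣≡∣p∣*∣q∣ x (X - Y)) (cong (_* ∣ X - Y ∣) (0≤p⇒∣p∣≡p 0≤x))))
        (≤-trans (*-monoʳ-≤-nonNeg ∣ X - Y ∣ {{nonNegative (0≤∣p∣ (X - Y))}} x≤1)
          (≤-trans (≤-reflexive (*-identityˡ ∣ X - Y ∣))
            (≤c⁻¹* (≤-trans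
              (mercator-lipschitz 0≤c (0≤- x≤1) (u≤ c≤x) (0≤- y≤1) (u≤ c≤y) N)
              (≤-trans (≤-reflexive (trans
                (cong ∣_∣ (solve 2 (λ x y → (con 1ℚ :- x) :- (con 1ℚ :- y) := y :- x) refl x y))
                (∣-∣-comm y x))) x-y)))))
      third : ∣ (x - y) * Y ∣ ≤ δ * (c⁻¹ * 1ℚ)
      third = ≤-trans (≤-reflexive (∣p*q∣≡∣p∣*∣q∣ (x - y) Y))
        (*-mono (0≤∣p∣ (x - y)) x-y (0≤∣p∣ Y) (≤c⁻¹* (∣mercator∣≤ 0≤c (0≤- y≤1) (u≤ c≤y) N)))

  -- The argument `1ℚ - (1ℚ - y)` is left unsimplified to agree with the approximants of
  -- `ln (1ℝ - α)`.
  entropy : ℕ → ℚ → ℚ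
  entropy N y = y * mercator N (1ℚ - y) + (1ℚ - y) * mercator N (1ℚ - (1ℚ - y))

  -- P + Q is n + 1, not n. Writing Q H Q as Q H q + 1 with q = Q - 1 gives weights (p + 1) / n and
  -- q / n that add up to 1, over which H n can be distributed; the surplus H n - H q - 1 is only
  -- logarithmic.
  leading-entropy : ∀ p q → let k = p ℕ.+ q; r = 1/[1+ k ]; H = harmonic (suc k) in
    r * leading p q ≡ 3/2 + (ι (suc p) * r * (H - harmonic (suc p)) + ι q * r * (H - harmonic q))
      + (H - harmonic q - 1ℚ) * r
  leading-entropy p q = begin
    r * (w₀ k - l₀ p - l₀ q)
      ≡⟨ solve 8 (λ r K P Q H h g s →
           r :* ((con 1ℚ :+ K) :* H :+ H :+ con 3/2 :* (con 1ℚ :+ K) :- (con 1ℚ :+ P) :* h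
             :- (con 1ℚ :+ Q) :* (g :+ s))
           := con 3/2 :* ((con 1ℚ :+ K) :* r)
             :+ ((con 1ℚ :+ K) :* r :* H :- (con 1ℚ :+ P) :* r :* h :- Q :* r :* g)
             :+ (H :- g :- (con 1ℚ :+ Q) :* s) :* r) refl
           r (ι k) (ι p) (ι q) H (harmonic (suc p)) (harmonic q) 1/[1+ q ] ⟩
    3/2 * ((1ℚ + ι k) * r) + ((1ℚ + ι k) * r * H - (1ℚ + ι p) * r * harmonic (suc p) - ι q * r * harmonic q)
      + (H - harmonic q - (1ℚ + ι q) * 1/[1+ q ]) * r
      ≡⟨ cong₂ _+_ (cong₂ (λ a b → 3/2 * a
             + (b * r * H - (1ℚ + ι p) * r * harmonic (suc p) - ι q * r * harmonic q))
           (one k) (trans (cong (_+_ 1ℚ) (ι-+ p q)) (sym (+-assoc 1ℚ (ι p) (ι q)))))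
           (cong (λ t → (H - harmonic q - t) * r) (one q)) ⟩
    3/2 * 1ℚ + ((1ℚ + ι p + ι q) * r * H - (1ℚ + ι p) * r * harmonic (suc p) - ι q * r * harmonic q)
      + (H - harmonic q - 1ℚ) * r
      ≡⟨ cong (_+ (H - harmonic q - 1ℚ) * r) (trans
           (solve 6 (λ P Q r H h g → con 3/2 :* con 1ℚ :+ ((P :+ Q) :* r :* H :- P :* r :* h :- Q :* r :* g)
             := con 3/2 :+ (P :* r :* (H :- h) :+ Q :* r :* (H :- g))) refl
             (1ℚ + ι p) (ι q) r H (harmonic (suc p)) (harmonic q))
           (cong (λ t → 3/2 + (t * r * (H - harmonic (suc p)) + ι q * r * (H - harmonic q)))
             (sym (ι-suc p)))) ⟩
    3/2 + (ι (suc p) * r * (H - harmonic (suc p)) + ι q * r * (H - harmonic q))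
      + (H - harmonic q - 1ℚ) * r ∎
    where
    open Relation.Binary.PropositionalEquality.≡-Reasoning
    k = p ℕ.+ q
    r = 1/[1+ k ]
    H = harmonic (suc k)
    one : ∀ j → (1ℚ + ι j) * 1/[1+ j ] ≡ 1ℚ
    one j = trans (cong (_* 1/[1+ j ]) (sym (ι-suc j))) (ι*1/ j)

  -- The order of the quantifiers matters: `δ` and `n₀` are uniform, but `K` depends on `p` and `q`,
  -- because the truncation error (1 - c)^N n is small only when `N` is large compared with n. In
  -- the application `y` is the term of α with index `N`.
  leading-limit : ∀ {c} → 0ℚ < c → ∀ η → 0ℚ < η →
    ∃[ δ ] 0ℚ < δ × ∃[ n₀ ] ∀ p q → n₀ ℕ.≤ p ℕ.+ q → let x = ι (suc p) * 1/[1+ p ℕ.+ q ] in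
    c ≤ x → x ≤ 1ℚ - c →
    ∃[ K ] ∀ N → K ℕ.≤ N → ∀ y → c ≤ y → y ≤ 1ℚ - c → ∣ x - y ∣ ≤ δ →
    ∣ 1/[1+ p ℕ.+ q ] * leading p q - (3/2 + entropy N y) ∣ ≤ η
  leading-limit {c} 0<c η 0<η =
    c * θ , 0<* 0<c 0<θ , n₁ ℕ.⊔ n₂ , main
    where
    0≤c = <⇒≤ 0<c
    -- Ten shares: three for 1 / n, two for the truncation, four for the distance of `x` from `y`,
    -- one for H n / n.
    θ = + 1 / 10 * η
    0<θ : 0ℚ < θ
    0<θ = 0<* {+ 1 / 10} {η} (positive⁻¹ (+ 1 / 10)) 0<η
    n₁ = proj₁ (archimedean θ 0<θ)
    n₂ = proj₁ (harmonic-sublinear θ 0<θ)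
    c⁻¹ = 1/[ 0<c ]⁺
    main : ∀ p q → n₁ ℕ.⊔ n₂ ℕ.≤ p ℕ.+ q → let x = ι (suc p) * 1/[1+ p ℕ.+ q ] in
      c ≤ x → x ≤ 1ℚ - c →
      ∃[ K ] ∀ N → K ℕ.≤ N → ∀ y → c ≤ y → y ≤ 1ℚ - c → ∣ x - y ∣ ≤ c * θ →
      ∣ 1/[1+ p ℕ.+ q ] * leading p q - (3/2 + entropy N y) ∣ ≤ η
    -- Without elements above the sought one, `x` is 1, contrary to `x ≤ 1ℚ - c`. In the other case
    -- both weights are positive multiples of 1 / n, as `entropy-term` demands.
    main p zero n≥ c≤x x≤ = ⊥-elim (<-irrefl refl (<-≤-trans 0<c
      (≤-by (1ℚ - c - 1ℚ) (0≤- (subst (_≤ 1ℚ - c)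
          (trans (cong (λ k → ι (suc p) * 1/[1+ k ]) (ℕₚ.+-identityʳ p)) (ι*1/ p)) x≤))
        (solve 1 (λ c → con 0ℚ := c :+ (con 1ℚ :- c :- con 1ℚ)) refl c))))
    main p q@(suc q₁) n≥ c≤x x≤ = K , λ N K≤N y c≤y y≤ x-y →
      let b = (1ℚ - c) ^ N
          c≤1-y : c ≤ 1ℚ - y
          c≤1-y = ≤-by (1ℚ - c - y) (0≤- y≤) (solve 2 (λ c y → con 1ℚ :- y := c :+ (con 1ℚ :- c :- y)) refl c y)
          y≤1 : y ≤ 1ℚ
          y≤1 = ≤-by (1ℚ - c - y + c) (0≤+ (0≤- y≤) 0≤c)
            (solve 2 (λ c y → con 1ℚ := y :+ (con 1ℚ :- c :- y :+ c)) refl c y)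
          1-y≤1 : 1ℚ - y ≤ 1ℚ
          1-y≤1 = ≤-by y (≤-trans 0≤c c≤y) (solve 1 (λ y → con 1ℚ := con 1ℚ :- y :+ y) refl y)
          e₁ = entropy-term 0<c c≤1 k p q (ℕₚ.+-comm q p) N c≤x c≤y y≤1 x-y
          e₂ = entropy-term 0<c c≤1 k q₁ (suc p) (sym (ℕₚ.+-suc p q₁)) N
                 (subst (c ≤_) (sym x′≡) (≤-by (1ℚ - c - x) (0≤- x≤)
                   (solve 2 (λ c x → con 1ℚ :- x := c :+ (con 1ℚ :- c :- x)) refl c x)))
                 c≤1-y 1-y≤1
                 (subst (_≤ c * θ) (trans (∣-∣-comm x y) (cong ∣_∣ (trans
                   (solve 2 (λ x y → y :- x := (con 1ℚ :- x) :- (con 1ℚ :- y)) refl x y)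
                   (cong (_- (1ℚ - y)) (sym x′≡))))) x-y)
          T₁ = x * (H - harmonic (suc p)) - y * mercator N (1ℚ - y)
          T₂ = ι q * r * (H - harmonic q) - (1ℚ - y) * mercator N (1ℚ - (1ℚ - y))
      in begin
        ∣ r * leading p q - (3/2 + entropy N y) ∣
          ≡⟨ cong (λ t → ∣ t - (3/2 + entropy N y) ∣) (leading-entropy p q) ⟩
        ∣ 3/2 + (x * (H - harmonic (suc p)) + ι q * r * (H - harmonic q))
            + (H - harmonic q - 1ℚ) * r - (3/2 + entropy N y) ∣
          ≡⟨ cong ∣_∣ (solve 6 (λ h a a′ e m m′ → h :+ (a :+ a′) :+ e :- (h :+ (m :+ m′))
               := (a :- m) :+ (a′ :- m′) :+ e) refl 3/2 (x * (H - harmonic (suc p)))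
               (ι q * r * (H - harmonic q)) ((H - harmonic q - 1ℚ) * r)
               (y * mercator N (1ℚ - y)) ((1ℚ - y) * mercator N (1ℚ - (1ℚ - y)))) ⟩
        ∣ T₁ + T₂ + (H - harmonic q - 1ℚ) * r ∣
          ≤⟨ ∣+∣≤ {T₁ + T₂} {(H - harmonic q - 1ℚ) * r} (∣+∣≤ {T₁} {T₂} e₁ e₂) small ⟩
        (r + b * n + (c⁻¹ * (c * θ) + c * θ * (c⁻¹ * 1ℚ)))
          + (r + b * n + (c⁻¹ * (c * θ) + c * θ * (c⁻¹ * 1ℚ))) + (θ + r)
          ≡⟨ solve 5 (λ r b c e θ →
               (r :+ b :+ (e :* (c :* θ) :+ c :* θ :* (e :* con 1ℚ)))
               :+ (r :+ b :+ (e :* (c :* θ) :+ c :* θ :* (e :* con 1ℚ))) :+ (θ :+ r)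
               := con (+ 3 / 1) :* r :+ con (+ 2 / 1) :* b :+ con (+ 4 / 1) :* (c :* e) :* θ :+ θ) refl
               r (b * n) c c⁻¹ θ ⟩
        + 3 / 1 * r + + 2 / 1 * (b * n) + + 4 / 1 * (c * c⁻¹) * θ + θ
          ≤⟨ ≤-by (+ 3 / 1 * (θ - r) + + 2 / 1 * (θ - b * n))
               (0≤+ (0≤* (nonNegative⁻¹ (+ 3 / 1)) (0≤- r≤θ))
                 (0≤* (nonNegative⁻¹ (+ 2 / 1)) (0≤- (proj₂ vanish N K≤N))))
               (trans (solve 3 (λ η r b → let θ = con (+ 1 / 10) :* η in
                   η := con (+ 3 / 1) :* r :+ con (+ 2 / 1) :* b :+ con (+ 4 / 1) :* con 1ℚ :* θ :+ θ
                   :+ (con (+ 3 / 1) :* (θ :- r) :+ con (+ 2 / 1) :* (θ :- b))) refl η r (b * n))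
                 (cong (λ t → + 3 / 1 * r + + 2 / 1 * (b * n) + + 4 / 1 * t * θ + θ
                   + (+ 3 / 1 * (θ - r) + + 2 / 1 * (θ - b * n))) (sym (*-1/⁺ 0<c)))) ⟩
        η ∎
      where
      open ≤-Reasoning
      k = p ℕ.+ q
      r = 1/[1+ k ]
      n = ι (suc k)
      H = harmonic (suc k)
      x = ι (suc p) * r
      c≤1 : c ≤ 1ℚ
      c≤1 = ≤-by (x - c + (1ℚ - c - x) + c) (0≤+ (0≤+ (0≤- c≤x) (0≤- x≤)) 0≤c)
        (solve 2 (λ c x → con 1ℚ := c :+ (x :- c :+ (con 1ℚ :- c :- x) :+ c)) refl c x)
      vanish = geometric-vanishes 0<c c≤1 n 0<θ
      K = proj₁ vanish
      x′≡ : ι q * r ≡ 1ℚ - x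
      x′≡ = trans (solve 3 (λ p q r → q :* r := (p :+ q) :* r :- p :* r) refl (ι (suc p)) (ι q) r)
        (cong (_- x) (trans (cong (_* r) (sym (ι-+ (suc p) q))) (ι*1/ k)))
      r≤θ : r ≤ θ
      r≤θ = ≤-trans (1/-anti (ℕₚ.m⊔n≤o⇒m≤o n₁ n₂ n≥)) (proj₂ (archimedean θ 0<θ))
      Hr≤θ : H * r ≤ θ
      Hr≤θ = proj₂ (harmonic-sublinear θ 0<θ) k (ℕₚ.m⊔n≤o⇒n≤o n₁ n₂ n≥)
      small : ∣ (H - harmonic q - 1ℚ) * r ∣ ≤ θ + r
      small = ∣∣≤
        (≤-by (θ - H * r + (harmonic q * r + (r + r)))
          (0≤+ (0≤- Hr≤θ) (0≤+ (0≤* (0≤harmonic q) (0≤1/ k)) (0≤+ (0≤1/ k) (0≤1/ k))))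
          (solve 4 (λ θ H g r → θ :+ r := (H :- g :- con 1ℚ) :* r :+ (θ :- H :* r :+ (g :* r :+ (r :+ r)))) refl
            θ H (harmonic q) r))
        (≤-by (θ + (H - harmonic q) * r)
          (0≤+ (<⇒≤ 0<θ)
            (0≤* (0≤- (harmonic-mono (ℕₚ.m≤n⇒m≤1+n (ℕₚ.m≤n+m q p)))) (0≤1/ k)))
          (solve 4 (λ θ H g r → θ :+ r := :- ((H :- g :- con 1ℚ) :* r) :+ (θ :+ (H :- g) :* r)) refl
            θ H (harmonic q) r))

open Rational
open import Defs
open import Data.Integer.Base using (+_)
open import Data.Nat.Base as ℕ using (ℕ; NonZero)
open import Data.Product.Base using (∃-syntax; _×_)
open import Data.Rational.Base using (_/_)

open import Data.Empty using (⊥-elim)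
open import Data.Fin.Base using (Fin; zero; suc)
open import Data.Nat.Base using (zero; suc; z≤n; s≤s)
open import Data.Nat.Combinatorics
  using (nC1≡n; nCk+nC[k+1]≡[n+1]C[k+1]) renaming (_C_ to _choose_)
open import Data.Nat.Induction using (<-wellFounded)
import Data.Nat.Properties as ℕₚ
open import Data.Product.Base using (_,_; proj₁; proj₂)
open import Data.Rational.Base as ℚ using (ℚ; 0ℚ; 1ℚ; ½)
import Data.Rational.Properties as ℚₚ
open import Data.Rational.Solver using (module +-*-Solver)
open import Data.Sum.Base using (_⊎_; inj₁; inj₂; [_,_]′)
open import Data.Unit.Base using (tt)
open import Data.Vec.Functional using ([]; _∷_)
open import Function.Bundles using (Equivalence)
open import Induction.WellFounded using (Acc; acc)
open import Relation.Binary.PropositionalEquality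
  using (_≡_; _≢_; refl; sym; trans; cong; cong₂; subst; subst₂)
open import Relation.Nullary using (¬_)
open import Relation.Nullary.Decidable.Core using (Dec; yes; no; _×-dec_)
open ℝ
open BoundedContinuous
open +-*-Solver using (solve; con; _:+_; _:*_; _:-_; :-_; _:=_)

-- Real numbers

-- The operations on reals act term by term, so with this and `≤-pointwise` the algebra of reals is
-- left to the ring solver for rationals; only steps with genuine limits need an ε.
≈-pointwise : ∀ {x y} → (∀ n → seq x n ≡ seq y n) → x ≈ y
≈-pointwise {x} {y} eq ε 0<ε = 0 , λ n _ → subst (ℚ._≤ ε)
  (cong ℚ.∣_∣ (sym (trans (cong (ℚ._- seq y n) (eq n)) (ℚₚ.+-inverseʳ (seq y n))))) (ℚₚ.<⇒≤ 0<ε)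

≤-pointwise : ∀ {x y} → (∀ n → seq x n ℚ.≤ seq y n) → x ≤ y
≤-pointwise {x} {y} h ε 0<ε = 0 , λ n _ → ℚₚ.≤-trans (h n)
  (≤-by ε (ℚₚ.<⇒≤ 0<ε) refl)

½-pos : ∀ {ε} → 0ℚ ℚ.< ε → 0ℚ ℚ.< ½ ℚ.* ε
½-pos {ε} = 0<* {½} {ε} (ℚₚ.positive⁻¹ ½)

½+½ : ∀ x ε → x ℚ.+ ½ ℚ.* ε ℚ.+ ½ ℚ.* ε ≡ x ℚ.+ ε
½+½ = solve 2 (λ x ε → x :+ con ½ :* ε :+ con ½ :* ε := x :+ ε) refl

≤-refl : ∀ {x} → x ≤ x
≤-refl {x} = ≤-pointwise {x} {x} (λ _ → ℚₚ.≤-refl)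

≤-trans : ∀ {x y z} → x ≤ y → y ≤ z → x ≤ z
≤-trans {x} {y} {z} x≤y y≤z ε 0<ε =
  let (M , p) = x≤y (½ ℚ.* ε) (½-pos 0<ε)
      (N , q) = y≤z (½ ℚ.* ε) (½-pos 0<ε)
  in M ℕ.⊔ N , λ n n≥ → ℚₚ.≤-trans (p n (ℕₚ.m⊔n≤o⇒m≤o M N n≥))
    (ℚₚ.≤-trans (ℚₚ.+-monoˡ-≤ (½ ℚ.* ε) (q n (ℕₚ.m⊔n≤o⇒n≤o M N n≥)))
      (ℚₚ.≤-reflexive (½+½ (seq z n) ε)))

≈⇒≤ : ∀ {x y} → x ≈ y → x ≤ y
≈⇒≤ {x} {y} x≈y ε 0<ε = let (N , p) = x≈y ε 0<ε in N , λ n n≥ →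
  ≤-by (ε ℚ.- (seq x n ℚ.- seq y n)) (0≤- (ℚₚ.≤-trans (p≤∣p∣ (seq x n ℚ.- seq y n)) (p n n≥)))
    (solve 3 (λ x y e → y :+ e := x :+ (e :- (x :- y))) refl (seq x n) (seq y n) ε)

≤-antisym : ∀ {x y} → x ≤ y → y ≤ x → x ≈ y
≤-antisym {x} {y} x≤y y≤x ε 0<ε =
  let (M , p) = x≤y ε 0<ε
      (N , q) = y≤x ε 0<ε
  in M ℕ.⊔ N , λ n n≥ → ∣∣≤
    (≤-by (seq y n ℚ.+ ε ℚ.- seq x n) (0≤- (p n (ℕₚ.m⊔n≤o⇒m≤o M N n≥)))
      (solve 3 (λ x y e → e := x :- y :+ (y :+ e :- x)) refl (seq x n) (seq y n) ε))
    (≤-by (seq x n ℚ.+ ε ℚ.- seq y n) (0≤- (q n (ℕₚ.m⊔n≤o⇒n≤o M N n≥)))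
      (solve 3 (λ x y e → e := :- (x :- y) :+ (x :+ e :- y)) refl (seq x n) (seq y n) ε))

≈-sym : ∀ {x y} → x ≈ y → y ≈ x
≈-sym {x} {y} x≈y ε 0<ε = let (N , p) = x≈y ε 0<ε in N , λ n n≥ →
  subst (ℚ._≤ ε) (∣-∣-comm (seq x n) (seq y n)) (p n n≥)

≈⇒≥ : ∀ {x y} → x ≈ y → y ≤ x
≈⇒≥ {x} {y} x≈y = ≈⇒≤ {y} {x} (≈-sym {x} {y} x≈y)

≈-refl : ∀ {x} → x ≈ x
≈-refl {x} = ≈-pointwise {x} {x} (λ _ → refl)

≈-trans : ∀ {x y z} → x ≈ y → y ≈ z → x ≈ z
≈-trans {x} {y} {z} p q = ≤-antisym {x} {z}
  (≤-trans {x} {y} {z} (≈⇒≤ {x} {y} p) (≈⇒≤ {y} {z} q))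
  (≤-trans {z} {y} {x} (≈⇒≥ {y} {z} q) (≈⇒≥ {x} {y} p))

+-mono-≤ : ∀ {x y u v} → x ≤ y → u ≤ v → x + u ≤ y + v
+-mono-≤ {x} {y} {u} {v} x≤y u≤v ε 0<ε =
  let (M , p) = x≤y (½ ℚ.* ε) (½-pos 0<ε)
      (N , q) = u≤v (½ ℚ.* ε) (½-pos 0<ε)
  in M ℕ.⊔ N , λ n n≥ → ℚₚ.≤-trans
    (ℚₚ.+-mono-≤ (p n (ℕₚ.m⊔n≤o⇒m≤o M N n≥)) (q n (ℕₚ.m⊔n≤o⇒n≤o M N n≥)))
    (ℚₚ.≤-reflexive (solve 3 (λ y v e → (y :+ con ½ :* e) :+ (v :+ con ½ :* e) := y :+ v :+ e) refl
      (seq y n) (seq v n) ε))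

+-cong : ∀ {x y u v} → x ≈ y → u ≈ v → x + u ≈ y + v
+-cong {x} {y} {u} {v} p q = ≤-antisym {x + u} {y + v}
  (+-mono-≤ {x} {y} {u} {v} (≈⇒≤ {x} {y} p) (≈⇒≤ {u} {v} q))
  (+-mono-≤ {y} {x} {v} {u} (≈⇒≥ {x} {y} p) (≈⇒≥ {u} {v} q))

upper-bound : ∀ x → ∃[ K ] 0ℚ ℚ.≤ K × ∣ x ∣ ≤ fromℚ K
upper-bound x =
  let (N , close) = cauchy x 1ℚ (ℚₚ.positive⁻¹ 1ℚ)
      K = 1ℚ ℚ.+ ℚ.∣ seq x N ∣
  in K , 0≤+ (ℚₚ.nonNegative⁻¹ 1ℚ) (ℚₚ.0≤∣p∣ (seq x N)) , λ ε 0<ε → N , λ n n≥ →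
    ℚₚ.≤-trans
      (subst (λ t → ℚ.∣ t ∣ ℚ.≤ K)
        (solve 2 (λ a b → a :- b :+ b := a) refl (seq x n) (seq x N))
        (∣+∣≤ {seq x n ℚ.- seq x N} {seq x N} (close n N n≥ ℕₚ.≤-refl) ℚₚ.≤-refl))
      (≤-by ε (ℚₚ.<⇒≤ 0<ε) refl)

*-cancelˡ-≤ : ∀ {D} → 0ℚ ℚ.< D → ∀ {x y} → fromℚ D * x ≤ fromℚ D * y → x ≤ y
*-cancelˡ-≤ {D} 0<D {x} {y} h ε 0<ε =
  let (N , p) = h (D ℚ.* ε) (0<* 0<D 0<ε) in N , λ n n≥ →
    cancel-* 0<D (ℚₚ.≤-trans (p n n≥) (ℚₚ.≤-reflexive (sym (ℚₚ.*-distribˡ-+ D (seq y n) ε))))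

*-monoˡ-≤ : ∀ {D} → 0ℚ ℚ.< D → ∀ {x y} → x ≤ y → fromℚ D * x ≤ fromℚ D * y
*-monoˡ-≤ {D} 0<D {x} {y} h ε 0<ε =
  let (N , p) = h (1/[ 0<D ]⁺ ℚ.* ε) (0<* (0<1/⁺ 0<D) 0<ε) in N , λ n n≥ →
    ℚₚ.≤-trans (*-monoˡ (ℚₚ.<⇒≤ 0<D) (p n n≥)) (ℚₚ.≤-reflexive (trans
      (solve 4 (λ D y r e → D :* (y :+ r :* e) := D :* y :+ D :* r :* e) refl D (seq y n) 1/[ 0<D ]⁺ ε)
      (cong (D ℚ.* seq y n ℚ.+_) (trans (cong (ℚ._* ε) (*-1/⁺ 0<D)) (ℚₚ.*-identityˡ ε)))))

*-congˡ : ∀ c {x y} → x ≈ y → c * x ≈ c * y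
*-congˡ c {x} {y} x≈y ε 0<ε =
  let (N₁ , close) = cauchy c 1ℚ (ℚₚ.positive⁻¹ 1ℚ)
      K = 1ℚ ℚ.+ ℚ.∣ seq c N₁ ∣
      0<K = ℚₚ.<-≤-trans (ℚₚ.positive⁻¹ 1ℚ) (≤-by ℚ.∣ seq c N₁ ∣ (ℚₚ.0≤∣p∣ (seq c N₁)) refl)
      (N₂ , p) = x≈y (1/[ 0<K ]⁺ ℚ.* ε) (0<* (0<1/⁺ 0<K) 0<ε)
  in N₁ ℕ.⊔ N₂ , λ n n≥ →
    let c≤K : ℚ.∣ seq c n ∣ ℚ.≤ K
        c≤K = subst (λ t → ℚ.∣ t ∣ ℚ.≤ K)
          (solve 2 (λ a b → a :- b :+ b := a) refl (seq c n) (seq c N₁))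
          (∣+∣≤ {seq c n ℚ.- seq c N₁} {seq c N₁}
            (close n N₁ (ℕₚ.m⊔n≤o⇒m≤o N₁ N₂ n≥) ℕₚ.≤-refl) ℚₚ.≤-refl)
    in subst₂ ℚ._≤_
      (trans (sym (ℚₚ.∣p*q∣≡∣p∣*∣q∣ (seq c n) (seq x n ℚ.- seq y n))) (cong ℚ.∣_∣
        (solve 3 (λ c x y → c :* (x :- y) := c :* x :- c :* y) refl (seq c n) (seq x n) (seq y n))))
      (trans (sym (ℚₚ.*-assoc K 1/[ 0<K ]⁺ ε))
        (trans (cong (ℚ._* ε) (*-1/⁺ 0<K)) (ℚₚ.*-identityˡ ε)))
      (*-mono (ℚₚ.0≤∣p∣ (seq c n)) c≤K (ℚₚ.0≤∣p∣ (seq x n ℚ.- seq y n))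
        (p n (ℕₚ.m⊔n≤o⇒n≤o N₁ N₂ n≥)))

fromℚ-< : ∀ {p q} → p ℚ.< q → fromℚ p < fromℚ q
fromℚ-< {p} {q} p<q = q ℚ.- p , 0<q-p , 0 , λ _ _ → ℚₚ.≤-reflexive
  (solve 2 (λ p q → p :+ (q :- p) := q) refl p q)
  where
  0<q-p : 0ℚ ℚ.< q ℚ.- p
  0<q-p = subst (ℚ._< q ℚ.- p) (ℚₚ.+-inverseʳ p) (ℚₚ.+-monoˡ-< (ℚ.- p) p<q)

≤-<-trans : ∀ {x y z} → x ≤ y → y < z → x < z
≤-<-trans {x} {y} {z} x≤y (ε , 0<ε , N , q) =
  let (M , p) = x≤y (½ ℚ.* ε) (½-pos 0<ε) in
  ½ ℚ.* ε , ½-pos 0<ε , M ℕ.⊔ N , λ n n≥ → ℚₚ.≤-trans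
    (ℚₚ.+-monoˡ-≤ (½ ℚ.* ε) (p n (ℕₚ.m⊔n≤o⇒m≤o M N n≥)))
    (ℚₚ.≤-trans (ℚₚ.≤-reflexive (½+½ (seq y n) ε)) (q n (ℕₚ.m⊔n≤o⇒n≤o M N n≥)))

<⇒≤ : ∀ {x y} → x < y → x ≤ y
<⇒≤ {x} {y} (c , 0<c , N , p) ε 0<ε = N , λ n n≥ →
  ≤-by ((seq y n ℚ.- (seq x n ℚ.+ c)) ℚ.+ c ℚ.+ ε)
    (0≤+ (0≤+ (0≤- (p n n≥)) (ℚₚ.<⇒≤ 0<c)) (ℚₚ.<⇒≤ 0<ε))
    (solve 4 (λ x y c e → y :+ e := x :+ ((y :- (x :+ c)) :+ c :+ e)) refl (seq x n) (seq y n) c ε)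

rational-below : ∀ {ε} → 0ℝ < ε → ∃[ q ] 0ℚ ℚ.< q × fromℚ q < ε
rational-below {ε} (c , 0<c , N , p) = ½ ℚ.* c , ½-pos 0<c , ½ ℚ.* c , ½-pos 0<c , N , λ n n≥ →
  ℚₚ.≤-trans (ℚₚ.≤-reflexive (solve 1 (λ c → con ½ :* c :+ con ½ :* c := con 0ℚ :+ c) refl c)) (p n n≥)

∣∣-≤ : ∀ {x y} → x ≤ y → - x ≤ y → ∣ x ∣ ≤ y
∣∣-≤ {x} {y} p q ε 0<ε =
  let (M , p′) = p ε 0<ε
      (N , q′) = q ε 0<ε
  in M ℕ.⊔ N , λ n n≥ → ∣∣≤ (p′ n (ℕₚ.m⊔n≤o⇒m≤o M N n≥)) (q′ n (ℕₚ.m⊔n≤o⇒n≤o M N n≥))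

x≤∣x∣ : ∀ {x} → x ≤ ∣ x ∣
x≤∣x∣ {x} = ≤-pointwise {x} {∣ x ∣} (λ n → p≤∣p∣ (seq x n))

-- Comparison of solutions of the recurrence

sum : ℕ → (ℕ → ℝ) → ℝ
sum zero    f = 0ℝ
sum (suc n) f = sum n f + f n

∑pivotsℝ : (ℕ → ℕ → ℝ) → ℕ → ℕ → ℝ
∑pivotsℝ g p q = sum q (λ k → sum k (λ j → g p j)) + sum p (λ i → sum q (λ k → g i k))
               + sum p (λ k → sum k (λ j → g j q))

seq-sum : ∀ n (f : ℕ → ℝ) N → seq (sum n f) N ≡ ∑< n (λ i → seq (f i) N)
seq-sum zero    f N = refl
seq-sum (suc n) f N = cong (ℚ._+ seq (f n) N) (seq-sum n f N)

seq-sum-sum : ∀ n (m : ℕ → ℕ) (f : ℕ → ℕ → ℝ) N →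
  seq (sum n (λ i → sum (m i) (f i))) N ≡ ∑< n (λ i → ∑< (m i) (λ j → seq (f i j) N))
seq-sum-sum n m f N = trans (seq-sum n (λ i → sum (m i) (f i)) N)
  (∑<-cong (λ i → seq-sum (m i) (f i) N) n)

seq-∑pivots : ∀ (g : ℕ → ℕ → ℝ) p q N → seq (∑pivotsℝ g p q) N ≡ ∑pivots (λ i j → seq (g i j) N) p q
seq-∑pivots g p q N = cong₂ ℚ._+_ (cong₂ ℚ._+_
  (seq-sum-sum q (λ k → k) (λ k j → g p j) N) (seq-sum-sum p (λ _ → q) g N))
  (seq-sum-sum p (λ k → k) (λ k j → g j q) N)

∑<-linear : ∀ a b (f g : ℕ → ℚ) n →
  ∑< n (λ i → a ℚ.* f i ℚ.+ b ℚ.* g i) ≡ a ℚ.* ∑< n f ℚ.+ b ℚ.* ∑< n g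
∑<-linear a b f g zero    = solve 2 (λ a b → con 0ℚ := a :* con 0ℚ :+ b :* con 0ℚ) refl a b
∑<-linear a b f g (suc n) = trans
  (cong (ℚ._+ (a ℚ.* f n ℚ.+ b ℚ.* g n)) (∑<-linear a b f g n))
  (solve 6 (λ a b F f G g → a :* F :+ b :* G :+ (a :* f :+ b :* g) := a :* (F :+ f) :+ b :* (G :+ g)) refl
    a b (∑< n f) (f n) (∑< n g) (g n))

∑pivots-linear : ∀ a b (f g : ℕ → ℕ → ℚ) p q →
  ∑pivots (λ i j → a ℚ.* f i j ℚ.+ b ℚ.* g i j) p q
  ≡ a ℚ.* ∑pivots f p q ℚ.+ b ℚ.* ∑pivots g p q
∑pivots-linear a b f g p q = trans
  (cong₂ ℚ._+_ (cong₂ ℚ._+_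
    (double q (λ k → k) (λ k j → f p j) (λ k j → g p j))
    (double p (λ _ → q) f g))
    (double p (λ k → k) (λ k j → f j q) (λ k j → g j q)))
  (solve 8 (λ a b F₁ G₁ F₂ G₂ F₃ G₃ →
    (a :* F₁ :+ b :* G₁) :+ (a :* F₂ :+ b :* G₂) :+ (a :* F₃ :+ b :* G₃)
    := a :* (F₁ :+ F₂ :+ F₃) :+ b :* (G₁ :+ G₂ :+ G₃)) refl
    a b (∑< q (λ k → ∑< k (λ j → f p j))) (∑< q (λ k → ∑< k (λ j → g p j)))
    (∑< p (λ i → ∑< q (f i))) (∑< p (λ i → ∑< q (g i)))
    (∑< p (λ k → ∑< k (λ j → f j q))) (∑< p (λ k → ∑< k (λ j → g j q))))
  where
  double : ∀ n (m : ℕ → ℕ) (f g : ℕ → ℕ → ℚ) →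
    ∑< n (λ i → ∑< (m i) (λ j → a ℚ.* f i j ℚ.+ b ℚ.* g i j))
    ≡ a ℚ.* ∑< n (λ i → ∑< (m i) (f i)) ℚ.+ b ℚ.* ∑< n (λ i → ∑< (m i) (g i))
  double n m f g = trans (∑<-cong (λ i → ∑<-linear a b (f i) (g i) (m i)) n)
    (∑<-linear a b (λ i → ∑< (m i) (f i)) (λ i → ∑< (m i) (g i)) n)

∑pivots-scale : ∀ a (f : ℕ → ℕ → ℚ) p q → ∑pivots (λ i j → a ℚ.* f i j) p q ≡ a ℚ.* ∑pivots f p q
∑pivots-scale a f p q = trans
  (∑pivots-cong (λ i j → solve 2 (λ a x → a :* x := a :* x :+ con 0ℚ :* x) refl a (f i j)) p q)
  (trans (∑pivots-linear a 0ℚ f f p q)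
    (solve 2 (λ a x → a :* x :+ con 0ℚ :* x := a :* x) refl a (∑pivots f p q)))

sum-mono : ∀ n {f g : ℕ → ℝ} → (∀ i → i ℕ.< n → f i ≤ g i) → sum n f ≤ sum n g
sum-mono zero    f≤g = ≤-refl {0ℝ}
sum-mono (suc n) {f} {g} f≤g = +-mono-≤ {sum n f} {sum n g} {f n} {g n}
  (sum-mono n (λ i i<n → f≤g i (ℕₚ.m<n⇒m<1+n i<n))) (f≤g n ℕₚ.≤-refl)

∑pivotsℝ-mono : ∀ {f g : ℕ → ℕ → ℝ} p q → (∀ i j → i ℕ.+ j ℕ.< p ℕ.+ q → f i j ≤ g i j) →
  ∑pivotsℝ f p q ≤ ∑pivotsℝ g p q
∑pivotsℝ-mono {f} {g} p q f≤g =
  +-mono-≤ {f₁ + f₂} {g₁ + g₂} {f₃} {g₃}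
    (+-mono-≤ {f₁} {g₁} {f₂} {g₂}
      (sum-mono q (λ k k<q → sum-mono k (λ j j<k →
        f≤g p j (ℕₚ.+-monoʳ-< p (ℕₚ.<-trans j<k k<q)))))
      (sum-mono p (λ i i<p → sum-mono q (λ k k<q → f≤g i k (ℕₚ.+-mono-< i<p k<q)))))
    (sum-mono p (λ k k<p → sum-mono k (λ j j<k →
      f≤g j q (ℕₚ.+-monoˡ-< q (ℕₚ.<-trans j<k k<p)))))
  where
  f₁ = sum q (λ k → sum k (λ j → f p j))
  g₁ = sum q (λ k → sum k (λ j → g p j))
  f₂ = sum p (λ i → sum q (λ k → f i k))
  g₂ = sum p (λ i → sum q (λ k → g i k))
  f₃ = sum p (λ k → sum k (λ j → f j q))
  g₃ = sum p (λ k → sum k (λ j → g j q))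


4ℚ : ℚ
4ℚ = + 4 ℚ./ 1

0<pairs : ∀ p q → 1 ℕ.≤ p ℕ.+ q → 0ℚ ℚ.< pairs p q
0<pairs p q 1≤s = subst (λ t → 0ℚ ℚ.< ½ ℚ.* ((1ℚ ℚ.+ t) ℚ.* t)) (ι-+ p q)
  (½-pos (0<* {1ℚ ℚ.+ ι (p ℕ.+ q)} {ι (p ℕ.+ q)}
    (ℚₚ.<-≤-trans (ℚₚ.positive⁻¹ 1ℚ) (≤-by (ι (p ℕ.+ q)) (0≤ι (p ℕ.+ q)) refl))
    (ℚₚ.<-≤-trans (ℚₚ.positive⁻¹ 1ℚ) (ι-mono 1≤s))))

1≤logarithmic : ∀ p q → 1ℚ ℚ.≤ logarithmic p q
1≤logarithmic p q = ℚₚ.≤-trans (harmonic-mono {1} {suc p} (ℕ.s≤s ℕ.z≤n))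
  (≤-by (harmonic (suc q)) (0≤harmonic (suc q)) refl)

private
  estimate : ∀ a c K p q (let D = pairs p q) →
    D ℚ.* (a ℚ.* (1ℚ ℚ.+ (ι p ℚ.+ ι q)) ℚ.+ c)
      ℚ.+ (a ℚ.* ∑pivots leading p q ℚ.+ K ℚ.* ∑pivots logarithmic p q)
    ≡ D ℚ.* (a ℚ.* leading p q ℚ.+ K ℚ.* logarithmic p q)
      ℚ.+ D ℚ.* c ℚ.- (a ℚ.* residual p q ℚ.+ K ℚ.* (D ℚ.+ slack p q))
  estimate a c K p q = trans
    (solve 9 (λ D a n c G K B r s →
      D :* (a :* n :+ c) :+ (a :* G :+ K :* B)
      := a :* (D :* n :+ r :+ G) :+ K :* (D :+ s :+ B) :+ D :* c :- (a :* r :+ K :* (D :+ s))) refl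
      D a n̂ c (∑pivots leading p q) K (∑pivots logarithmic p q) (residual p q) (slack p q))
    (trans
      (cong₂ (λ x y → a ℚ.* x ℚ.+ K ℚ.* y ℚ.+ D ℚ.* c ℚ.- (a ℚ.* residual p q ℚ.+ K ℚ.* (D ℚ.+ slack p q)))
        (sym (leading-recurrence p q)) (sym (logarithmic-recurrence p q)))
      (cong (λ x → x ℚ.+ D ℚ.* c ℚ.- (a ℚ.* residual p q ℚ.+ K ℚ.* (D ℚ.+ slack p q)))
        (solve 5 (λ a D G K B → a :* (D :* G) :+ K :* (D :* B) := D :* (a :* G :+ K :* B)) refl
          a D (leading p q) K (logarithmic p q))))
    where
    D = pairs p q
    n̂ = 1ℚ ℚ.+ (ι p ℚ.+ ι q)

  -- The sign of `a` is arbitrary, so the residual, which lies between 0 and 4 `D`, may cost up to 4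
  -- |a| `D`. This is the origin of the 4 in `toll`.
  estimate-≤ : ∀ a c K p q (let D = pairs p q) → 0ℚ ℚ.≤ K →
    D ℚ.* (a ℚ.* (1ℚ ℚ.+ (ι p ℚ.+ ι q)) ℚ.+ c)
      ℚ.+ (a ℚ.* ∑pivots leading p q ℚ.+ K ℚ.* ∑pivots logarithmic p q)
    ℚ.≤ D ℚ.* (ℚ.∣ a ∣ ℚ.* 4ℚ ℚ.+ c)
      ℚ.+ (D ℚ.* (a ℚ.* leading p q ℚ.+ K ℚ.* logarithmic p q) ℚ.- D ℚ.* K)
  estimate-≤ a c K p q 0≤K = subst (ℚ._≤ D ℚ.* (v ℚ.* 4ℚ ℚ.+ c) ℚ.+ (X ℚ.- D ℚ.* K)) (sym (estimate a c K p q))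
    (≤-by ((v ℚ.+ a) ℚ.* r ℚ.+ (v ℚ.* (4ℚ ℚ.* D ℚ.- r) ℚ.+ K ℚ.* slack p q))
      (0≤+ (0≤* (subst (λ t → 0ℚ ℚ.≤ v ℚ.+ t) (solve 1 (λ a → :- :- a := a) refl a) (0≤- (-p≤∣p∣ a)))
          (0≤residual p q))
        (0≤+ (0≤* (ℚₚ.0≤∣p∣ a) (0≤- (residual≤ p q))) (0≤* 0≤K (0≤slack p q))))
      (solve 8 (λ D v c X K a r s →
        D :* (v :* con 4ℚ :+ c) :+ (X :- D :* K)
        := X :+ D :* c :- (a :* r :+ K :* (D :+ s))
          :+ ((v :+ a) :* r :+ (v :* (con 4ℚ :* D :- r) :+ K :* s))) refl
        D v c X K a r (slack p q)))
    where
    D = pairs p q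
    v = ℚ.∣ a ∣
    r = residual p q
    X = D ℚ.* (a ℚ.* leading p q ℚ.+ K ℚ.* logarithmic p q)

module _ (f : ℕ → ℕ → ℝ) (a C : ℝ) (K : ℚ) where
  private
    bound : ℕ → ℕ → ℝ
    bound p q = a * fromℚ (leading p q) + fromℚ (K ℚ.* logarithmic p q)

    excess : ℕ → ℕ → ℝ
    excess p q = fromℚ (pairs p q) * bound p q - fromℚ (pairs p q) * fromℚ K

    toll : ℝ
    toll = ∣ a ∣ * fromℚ 4ℚ + C

    cost : ℕ → ℕ → ℝ
    cost p q = fromℚ (pairs p q) * (a * fromℚ (1ℚ ℚ.+ (ι p ℚ.+ ι q)) + C)

    bound-recurrence : 0ℚ ℚ.≤ K → ∀ p q →
      cost p q + ∑pivotsℝ bound p q ≤ fromℚ (pairs p q) * toll + excess p q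
    bound-recurrence 0≤K p q = ≤-pointwise {cost p q + ∑pivotsℝ bound p q}
      {fromℚ (pairs p q) * toll + excess p q} (λ n →
        subst (λ x → seq (cost p q) n ℚ.+ x ℚ.≤ seq (fromℚ (pairs p q) * toll + excess p q) n)
          (sym (trans (seq-∑pivots bound p q n) (∑pivots-linear (seq a n) K leading logarithmic p q)))
          (estimate-≤ (seq a n) (seq C n) K p q 0≤K))

  -- Strong induction on `p + q`. Once `bound` replaces `f` in the sum over the pivots, the
  -- supersolution leaves a surplus of K for every pair, which pays for the bounded part of the
  -- toll. For small inputs `logarithmic` is at least 1, so that K alone suffices.
  comparison : (s₀ : ℕ) → 0ℚ ℚ.≤ K → 1 ℕ.≤ s₀ →
    (∀ p q → p ℕ.+ q ℕ.< s₀ → f p q ≤ a * fromℚ (leading p q) + fromℚ K) →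
    ∣ a ∣ * fromℚ 4ℚ + C ≤ fromℚ K →
    (∀ p q → s₀ ℕ.≤ p ℕ.+ q → fromℚ (pairs p q) * f p q
      ≤ fromℚ (pairs p q) * (a * fromℚ (1ℚ ℚ.+ (ι p ℚ.+ ι q)) + C) + ∑pivotsℝ f p q) →
    ∀ p q → f p q ≤ a * fromℚ (leading p q) + fromℚ (K ℚ.* logarithmic p q)
  comparison s₀ 0≤K 1≤s₀ small toll≤K step p₀ q₀ = go p₀ q₀ (<-wellFounded (p₀ ℕ.+ q₀))
    where
    base : ∀ p q → p ℕ.+ q ℕ.< s₀ → f p q ≤ bound p q
    base p q s<s₀ = ≤-trans {f p q} {a * fromℚ (leading p q) + fromℚ K} {bound p q} (small p q s<s₀)
      (≤-pointwise {a * fromℚ (leading p q) + fromℚ K} {bound p q}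
        (λ n → ℚₚ.+-monoʳ-≤ (seq a n ℚ.* leading p q)
          (≤-by (K ℚ.* (logarithmic p q ℚ.- 1ℚ)) (0≤* 0≤K (0≤- (1≤logarithmic p q)))
            (solve 2 (λ K B → K :* B := K :+ K :* (B :- con 1ℚ)) refl K (logarithmic p q)))))
    large : ∀ p q → s₀ ℕ.≤ p ℕ.+ q →
      (∀ i j → i ℕ.+ j ℕ.< p ℕ.+ q → f i j ≤ bound i j) → f p q ≤ bound p q
    large p q s₀≤s ih = *-cancelˡ-≤ 0<D {f p q} {bound p q}
      (≤-trans {D * f p q} {cost p q + ∑pivotsℝ f p q} {D * bound p q} (step p q s₀≤s)
      (≤-trans {cost p q + ∑pivotsℝ f p q} {cost p q + ∑pivotsℝ bound p q} {D * bound p q}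
        (+-mono-≤ {cost p q} {cost p q} {∑pivotsℝ f p q} {∑pivotsℝ bound p q}
          (≤-refl {cost p q}) (∑pivotsℝ-mono p q ih))
      (≤-trans {cost p q + ∑pivotsℝ bound p q} {D * toll + excess p q} {D * bound p q}
        (bound-recurrence 0≤K p q)
      (≤-trans {D * toll + excess p q} {D * fromℚ K + excess p q} {D * bound p q}
        (+-mono-≤ {D * toll} {D * fromℚ K} {excess p q} {excess p q}
          (*-monoˡ-≤ 0<D {toll} {fromℚ K} toll≤K) (≤-refl {excess p q}))
        (≤-pointwise {D * fromℚ K + excess p q} {D * bound p q} (λ n → ℚₚ.≤-reflexive
          (solve 2 (λ x y → x :+ (y :- x) := y) refl
            (pairs p q ℚ.* K) (seq (D * bound p q) n))))))))
      where
      D = fromℚ (pairs p q)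
      0<D = 0<pairs p q (ℕₚ.≤-trans 1≤s₀ s₀≤s)
    go : ∀ p q → Acc ℕ._<_ (p ℕ.+ q) → f p q ≤ bound p q
    go p q (acc rec) = [ base p q , (λ s₀≤s → large p q s₀≤s (λ i j i+j< → go i j (rec i+j<))) ]′
      (ℕₚ.<-≤-connex (p ℕ.+ q) s₀)

-- Continuous functions

norm : ∀ {k} → (Fin k → ℚ) → ℚ
norm {zero}  x = 0ℚ
norm {suc k} x = ℚ.∣ x zero ∣ ℚ.+ norm (λ i → x (suc i))

0≤norm : ∀ {k} (x : Fin k → ℚ) → 0ℚ ℚ.≤ norm x
0≤norm {zero}  x = ℚₚ.≤-refl
0≤norm {suc k} x = 0≤+ (ℚₚ.0≤∣p∣ (x zero)) (0≤norm (λ i → x (suc i)))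

∣xᵢ∣≤norm : ∀ {k} (x : Fin k → ℚ) i → ℚ.∣ x i ∣ ℚ.≤ norm x
∣xᵢ∣≤norm x zero    = ≤-by (norm (λ i → x (suc i))) (0≤norm (λ i → x (suc i))) refl
∣xᵢ∣≤norm x (suc i) = ℚₚ.≤-trans (∣xᵢ∣≤norm (λ i → x (suc i)) i)
  (≤-by ℚ.∣ x zero ∣ (ℚₚ.0≤∣p∣ (x zero)) (ℚₚ.+-comm ℚ.∣ x zero ∣ _))

seq-norm : ∀ {k} (x : Fin k → ℝ) n → seq (∑ (λ i → ∣ x i ∣)) n ≡ norm (λ i → seq (x i) n)
seq-norm {zero}  x n = refl
seq-norm {suc k} x n = cong (ℚ.∣ seq (x zero) n ∣ ℚ.+_) (seq-norm (λ i → x (suc i)) n)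

-- Functions that act on each term of the approximating sequences separately;
-- the locally Lipschitz bound gives both continuity and linear growth.
record Tame {k} (φ : (Fin k → ℝ) → ℝ) : Set where
  field
    at        : (Fin k → ℚ) → ℚ
    seq-at    : ∀ x n → seq (φ x) n ≡ at (λ i → seq (x i) n)
    L         : ℚ
    0≤L       : 0ℚ ℚ.≤ L
    lipschitz : ∀ x y → ℚ.∣ at y ℚ.- at x ∣ ℚ.≤ L ℚ.* (1ℚ ℚ.+ norm x) ℚ.* norm (λ i → y i ℚ.- x i)

module _ {k} {φ : (Fin k → ℝ) → ℝ} (T : Tame φ) where
  open Tame T

  private
    norm-zero : ∀ k → norm {k} (λ _ → 0ℚ) ≡ 0ℚ
    norm-zero zero    = refl
    norm-zero (suc k) = trans (ℚₚ.+-identityˡ _) (norm-zero k)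

    norm-cong : ∀ {k} {x y : Fin k → ℚ} → (∀ i → x i ≡ y i) → norm x ≡ norm y
    norm-cong {zero}  h = refl
    norm-cong {suc k} h = cong₂ (λ a b → ℚ.∣ a ∣ ℚ.+ b) (h zero) (norm-cong (λ i → h (suc i)))

    ∑-≤ : ∀ {k} (x : Fin k → ℝ) {d} → (∀ i → x i ≤ fromℚ d) → ∑ x ≤ fromℚ (ι k ℚ.* d)
    ∑-≤ {zero}  x {d} h = ≤-pointwise {0ℝ} {fromℚ (ι 0 ℚ.* d)} (λ _ → ℚₚ.≤-reflexive (sym (ℚₚ.*-zeroˡ d)))
    ∑-≤ {suc k} x {d} h = ≤-trans {∑ x} {fromℚ d + fromℚ (ι k ℚ.* d)} {fromℚ (ι (suc k) ℚ.* d)}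
      (+-mono-≤ {x zero} {fromℚ d} {∑ (λ i → x (suc i))} {fromℚ (ι k ℚ.* d)}
        (h zero) (∑-≤ (λ i → x (suc i)) (λ i → h (suc i))))
      (≤-pointwise {fromℚ d + fromℚ (ι k ℚ.* d)} {fromℚ (ι (suc k) ℚ.* d)} (λ _ → ℚₚ.≤-reflexive (trans
        (solve 2 (λ k d → d :+ k :* d := (con 1ℚ :+ k) :* d) refl (ι k) d)
        (cong (ℚ._* d) (sym (ι-suc k))))))

  tame-bound : ∀ x → ℚ.∣ at x ∣ ℚ.≤ (ℚ.∣ at (λ _ → 0ℚ) ∣ ℚ.+ L) ℚ.* (1ℚ ℚ.+ norm x)
  tame-bound x = ℚₚ.≤-trans
    (subst (λ t → ℚ.∣ t ∣ ℚ.≤ L ℚ.* (1ℚ ℚ.+ 0ℚ) ℚ.* norm x ℚ.+ ℚ.∣ a₀ ∣)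
      (solve 2 (λ a b → a :- b :+ b := a) refl (at x) a₀)
      (∣+∣≤ {at x ℚ.- a₀} {a₀} (subst₂ (λ s t → ℚ.∣ at x ℚ.- a₀ ∣ ℚ.≤ L ℚ.* (1ℚ ℚ.+ s) ℚ.* t)
          (norm-zero k) (norm-cong (λ i → ℚₚ.+-identityʳ (x i)))
          (lipschitz (λ _ → 0ℚ) x))
        ℚₚ.≤-refl))
    (≤-by (ℚ.∣ a₀ ∣ ℚ.* norm x ℚ.+ L)
      (0≤+ (0≤* (ℚₚ.0≤∣p∣ a₀) (0≤norm x)) 0≤L)
      (solve 3 (λ a l x → (a :+ l) :* (con 1ℚ :+ x)
        := l :* (con 1ℚ :+ con 0ℚ) :* x :+ a :+ (a :* x :+ l)) refl ℚ.∣ a₀ ∣ L (norm x)))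
    where
    a₀ = at (λ _ → 0ℚ)

  tame-growth : LinearGrowth φ
  tame-growth = fromℚ C , λ x →
    ≤-pointwise {∣ φ x ∣} {fromℚ C * (1ℝ + ∑ (λ i → ∣ x i ∣))} (λ n →
      subst₂ (λ s t → ℚ.∣ s ∣ ℚ.≤ C ℚ.* (1ℚ ℚ.+ t)) (sym (seq-at x n)) (sym (seq-norm x n))
        (tame-bound (λ i → seq (x i) n)))
    where
    C = ℚ.∣ at (λ _ → 0ℚ) ∣ ℚ.+ L

  tame-continuous : Continuous φ
  tame-continuous x ε 0<ε =
    let (q , 0<q , q<ε) = rational-below {ε} 0<ε
        (M , 0≤M , x≤M) = upper-bound (∑ (λ i → ∣ x i ∣))
        -- The terms of the norm of `x` are eventually below M + 1, since M bounds it only up to an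
        -- eventual error. The last 1 keeps `B` invertible when `L` is 0.
        B = L ℚ.* (1ℚ ℚ.+ (M ℚ.+ 1ℚ)) ℚ.+ 1ℚ
        0≤LM = 0≤* 0≤L (0≤+ (ℚₚ.nonNegative⁻¹ 1ℚ) (0≤+ 0≤M (ℚₚ.nonNegative⁻¹ 1ℚ)))
        0<B : 0ℚ ℚ.< B
        0<B = ℚₚ.<-≤-trans (ℚₚ.positive⁻¹ 1ℚ) (≤-by (L ℚ.* (1ℚ ℚ.+ (M ℚ.+ 1ℚ))) 0≤LM
          (ℚₚ.+-comm (L ℚ.* (1ℚ ℚ.+ (M ℚ.+ 1ℚ))) 1ℚ))
        -- `k` coordinates, each within `δ`, add up to at most q / B; dividing by k + 1 also covers
        -- k = 0.
        δ = 1/[ 0<B ]⁺ ℚ.* q ℚ.* 1/[1+ k ]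
        0<δ = 0<* (0<* (0<1/⁺ 0<B) 0<q) (0<1/ k)
    in fromℚ δ , fromℚ-< 0<δ , λ y close →
      let dist = ∑ (λ i → ∣ y i - x i ∣)
          Bd≤q : fromℚ B * dist ≤ fromℚ q
          Bd≤q = ≤-trans {fromℚ B * dist} {fromℚ B * fromℚ (ι k ℚ.* δ)} {fromℚ q}
            (*-monoˡ-≤ 0<B {dist} {fromℚ (ι k ℚ.* δ)}
              (∑-≤ (λ i → ∣ y i - x i ∣) (λ i → <⇒≤ {∣ y i - x i ∣} {fromℚ δ} (close i))))
            (≤-pointwise {fromℚ B * fromℚ (ι k ℚ.* δ)} {fromℚ q} (λ _ → ≤-by (q ℚ.* 1/[1+ k ])
              (0≤* (ℚₚ.<⇒≤ 0<q) (0≤1/ k))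
              (rearrange B 1/[ 0<B ]⁺ q (*-1/⁺ 0<B))))
          (N , x≤M+1) = x≤M 1ℚ (ℚₚ.positive⁻¹ 1ℚ)
          φ≤ : ∣ φ y - φ x ∣ ≤ fromℚ B * dist
          φ≤ ε 0<ε = N , λ n n≥ → ℚₚ.≤-trans
            (subst₂ (λ s t → ℚ.∣ s ℚ.- t ∣ ℚ.≤ B ℚ.* seq dist n)
              (sym (seq-at y n)) (sym (seq-at x n))
              (subst (λ t → ℚ.∣ at (λ i → seq (y i) n) ℚ.- at (λ i → seq (x i) n) ∣ ℚ.≤ B ℚ.* t)
                (sym (seq-norm (λ i → y i - x i) n))
                (ℚₚ.≤-trans (lipschitz (λ i → seq (x i) n) (λ i → seq (y i) n))
                  (bound (0≤norm (λ i → seq (x i) n)) (0≤norm (λ i → seq (y i) n ℚ.- seq (x i) n))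
                    (subst (ℚ._≤ M ℚ.+ 1ℚ) (seq-norm x n)
                      (ℚₚ.≤-trans (p≤∣p∣ _) (x≤M+1 n n≥)))))))
            (≤-by ε (ℚₚ.<⇒≤ 0<ε) refl)
      in ≤-<-trans {∣ φ y - φ x ∣} {fromℚ q} {ε}
           (≤-trans {∣ φ y - φ x ∣} {fromℚ B * dist} {fromℚ q} φ≤ Bd≤q) q<ε
    where
    rearrange : ∀ B e q → B ℚ.* e ≡ 1ℚ →
      q ≡ B ℚ.* (ι k ℚ.* (e ℚ.* q ℚ.* 1/[1+ k ])) ℚ.+ q ℚ.* 1/[1+ k ]
    rearrange B e q Be≡1 = trans (sym (trans (cong₂ (λ s t → s ℚ.* (q ℚ.* t)) Be≡1 (ι*1/ k))
        (trans (ℚₚ.*-identityˡ _) (ℚₚ.*-identityʳ q))))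
      (trans (cong (λ t → B ℚ.* e ℚ.* (q ℚ.* (t ℚ.* 1/[1+ k ]))) (ι-suc k))
        (trans (solve 5 (λ B e q k r → B :* e :* (q :* ((con 1ℚ :+ k) :* r))
            := B :* (k :* (e :* q :* r)) :+ B :* e :* (q :* r)) refl B e q (ι k) 1/[1+ k ])
          (cong (B ℚ.* (ι k ℚ.* (e ℚ.* q ℚ.* 1/[1+ k ])) ℚ.+_)
            (trans (cong (ℚ._* (q ℚ.* 1/[1+ k ])) Be≡1) (ℚₚ.*-identityˡ _)))))
    bound : ∀ {a d M} → 0ℚ ℚ.≤ a → 0ℚ ℚ.≤ d → a ℚ.≤ M →
      L ℚ.* (1ℚ ℚ.+ a) ℚ.* d ℚ.≤ (L ℚ.* (1ℚ ℚ.+ M) ℚ.+ 1ℚ) ℚ.* d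
    bound {a} {d} {M} 0≤a 0≤d a≤M = ≤-by (L ℚ.* (M ℚ.- a) ℚ.* d ℚ.+ d)
      (0≤+ (0≤* (0≤* 0≤L (0≤- a≤M)) 0≤d) 0≤d)
      (solve 4 (λ l a d m → (l :* (con 1ℚ :+ m) :+ con 1ℚ) :* d
        := l :* (con 1ℚ :+ a) :* d :+ (l :* (m :- a) :* d :+ d)) refl L a d M)

-- A syntax for piecewise linear functions. The truncations and the bumps below can be written in
-- it, and a Lipschitz constant is found by recursion, which settles continuity, growth and thereby
-- integrability once and for all. Products are left out because they are not globally Lipschitz.
data Expr (k : ℕ) : Set where
  var   : Fin k → Expr k
  const : ℚ → Expr k
  _⊕_   : Expr k → Expr k → Expr k
  _⊛_   : ℚ → Expr k → Expr k
  abs   : Expr k → Expr k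

infixl 6 _⊕_
infixl 7 _⊛_

⟦_⟧ : ∀ {k} → Expr k → (Fin k → ℝ) → ℝ
⟦ var i ⟧   x = x i
⟦ const q ⟧ x = fromℚ q
⟦ e ⊕ f ⟧   x = ⟦ e ⟧ x + ⟦ f ⟧ x
⟦ q ⊛ e ⟧   x = fromℚ q * ⟦ e ⟧ x
⟦ abs e ⟧   x = ∣ ⟦ e ⟧ x ∣

eval : ∀ {k} → Expr k → (Fin k → ℚ) → ℚ
eval (var i)   x = x i
eval (const q) x = q
eval (e ⊕ f)   x = eval e x ℚ.+ eval f x
eval (q ⊛ e)   x = q ℚ.* eval e x
eval (abs e)   x = ℚ.∣ eval e x ∣

seq-eval : ∀ {k} (e : Expr k) x n → seq (⟦ e ⟧ x) n ≡ eval e (λ i → seq (x i) n)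
seq-eval (var i)   x n = refl
seq-eval (const q) x n = refl
seq-eval (e ⊕ f)   x n = cong₂ ℚ._+_ (seq-eval e x n) (seq-eval f x n)
seq-eval (q ⊛ e)   x n = cong (q ℚ.*_) (seq-eval e x n)
seq-eval (abs e)   x n = cong ℚ.∣_∣ (seq-eval e x n)

lip : ∀ {k} → Expr k → ℚ
lip (var i)   = 1ℚ
lip (const q) = 0ℚ
lip (e ⊕ f)   = lip e ℚ.+ lip f
lip (q ⊛ e)   = ℚ.∣ q ∣ ℚ.* lip e
lip (abs e)   = lip e

0≤lip : ∀ {k} (e : Expr k) → 0ℚ ℚ.≤ lip e
0≤lip (var i)   = ℚₚ.nonNegative⁻¹ 1ℚ
0≤lip (const q) = ℚₚ.≤-refl
0≤lip (e ⊕ f)   = 0≤+ (0≤lip e) (0≤lip f)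
0≤lip (q ⊛ e)   = 0≤* (ℚₚ.0≤∣p∣ q) (0≤lip e)
0≤lip (abs e)   = 0≤lip e

reverse-triangle : ∀ p q → ℚ.∣ ℚ.∣ p ∣ ℚ.- ℚ.∣ q ∣ ∣ ℚ.≤ ℚ.∣ p ℚ.- q ∣
reverse-triangle p q = ∣∣≤ (one p q) (subst₂ ℚ._≤_
  (solve 2 (λ a b → b :- a := :- (a :- b)) refl ℚ.∣ p ∣ ℚ.∣ q ∣) (∣-∣-comm q p) (one q p))
  where
  one : ∀ p q → ℚ.∣ p ∣ ℚ.- ℚ.∣ q ∣ ℚ.≤ ℚ.∣ p ℚ.- q ∣
  one p q = ≤-by (ℚ.∣ p ℚ.- q ∣ ℚ.+ ℚ.∣ q ∣ ℚ.- ℚ.∣ p ∣)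
    (0≤- (subst (λ t → ℚ.∣ t ∣ ℚ.≤ ℚ.∣ p ℚ.- q ∣ ℚ.+ ℚ.∣ q ∣)
      (solve 2 (λ p q → p :- q :+ q := p) refl p q) (ℚₚ.∣p+q∣≤∣p∣+∣q∣ (p ℚ.- q) q)))
    (solve 3 (λ d p q → d := p :- q :+ (d :+ q :- p)) refl ℚ.∣ p ℚ.- q ∣ ℚ.∣ p ∣ ℚ.∣ q ∣)

eval-lipschitz : ∀ {k} (e : Expr k) x y →
  ℚ.∣ eval e y ℚ.- eval e x ∣ ℚ.≤ lip e ℚ.* norm (λ i → y i ℚ.- x i)
eval-lipschitz (var i)   x y = ℚₚ.≤-trans (∣xᵢ∣≤norm (λ i → y i ℚ.- x i) i)
  (ℚₚ.≤-reflexive (sym (ℚₚ.*-identityˡ _)))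
eval-lipschitz (const q) x y = ℚₚ.≤-reflexive (trans (cong ℚ.∣_∣ (ℚₚ.+-inverseʳ q))
  (sym (ℚₚ.*-zeroˡ (norm (λ i → y i ℚ.- x i)))))
eval-lipschitz (e ⊕ f)   x y = subst₂ (λ s t → ℚ.∣ s ∣ ℚ.≤ t)
  (solve 4 (λ a b c d → a :- b :+ (c :- d) := a :+ c :- (b :+ d)) refl
    (eval e y) (eval e x) (eval f y) (eval f x))
  (sym (ℚₚ.*-distribʳ-+ (norm (λ i → y i ℚ.- x i)) (lip e) (lip f)))
  (∣+∣≤ {eval e y ℚ.- eval e x} {eval f y ℚ.- eval f x} (eval-lipschitz e x y) (eval-lipschitz f x y))
eval-lipschitz (q ⊛ e)   x y = subst₂ ℚ._≤_
  (trans (sym (ℚₚ.∣p*q∣≡∣p∣*∣q∣ q (eval e y ℚ.- eval e x))) (cong ℚ.∣_∣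
    (solve 3 (λ q a b → q :* (a :- b) := q :* a :- q :* b) refl q (eval e y) (eval e x))))
  (sym (ℚₚ.*-assoc ℚ.∣ q ∣ (lip e) _))
  (*-monoˡ (ℚₚ.0≤∣p∣ q) (eval-lipschitz e x y))
eval-lipschitz (abs e)   x y = ℚₚ.≤-trans (reverse-triangle (eval e y) (eval e x)) (eval-lipschitz e x y)

tame : ∀ {k} (e : Expr k) → Tame ⟦ e ⟧
tame e = record
  { at = eval e ; seq-at = seq-eval e ; L = lip e ; 0≤L = 0≤lip e
  ; lipschitz = λ x y → ℚₚ.≤-trans (eval-lipschitz e x y)
      (≤-by (lip e ℚ.* norm x ℚ.* norm (λ i → y i ℚ.- x i))
        (0≤* (0≤* (0≤lip e) (0≤norm x)) (0≤norm (λ i → y i ℚ.- x i)))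
        (solve 3 (λ l x d → l :* (con 1ℚ :+ x) :* d := l :* d :+ l :* x :* d) refl
          (lip e) (norm x) (norm (λ i → y i ℚ.- x i)))) }

-- A change of the bounded factor is multiplied by the other one, which may grow linearly. For this
-- reason the Lipschitz constant in `Tame` is allowed to grow with the norm of `x`.
tame-* : ∀ {k} (e f : Expr k) → (∀ x → ℚ.∣ eval e x ∣ ℚ.≤ 1ℚ) → Tame (λ x → ⟦ e ⟧ x * ⟦ f ⟧ x)
tame-* {k} e f e≤1 = record
  { at = λ x → eval e x ℚ.* eval f x
  ; seq-at = λ x n → cong₂ ℚ._*_ (seq-eval e x n) (seq-eval f x n)
  ; L = lip f ℚ.+ lip e ℚ.* F
  ; 0≤L = 0≤+ (0≤lip f) (0≤* (0≤lip e) 0≤F)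
  ; lipschitz = lipschitz }
  where
  F = ℚ.∣ eval f (λ _ → 0ℚ) ∣ ℚ.+ lip f
  0≤F = 0≤+ (ℚₚ.0≤∣p∣ (eval f (λ _ → 0ℚ))) (0≤lip f)
  lipschitz : ∀ x y → ℚ.∣ eval e y ℚ.* eval f y ℚ.- eval e x ℚ.* eval f x ∣
    ℚ.≤ (lip f ℚ.+ lip e ℚ.* F) ℚ.* (1ℚ ℚ.+ norm x) ℚ.* norm (λ i → y i ℚ.- x i)
  lipschitz x y = ℚₚ.≤-trans
    (subst (λ t → ℚ.∣ t ∣ ℚ.≤ 1ℚ ℚ.* (lip f ℚ.* d) ℚ.+ lip e ℚ.* d ℚ.* (F ℚ.* (1ℚ ℚ.+ norm x)))
      (solve 4 (λ a b a′ b′ → a :* (b :- b′) :+ (a :- a′) :* b′ := a :* b :- a′ :* b′) refl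
        (eval e y) (eval f y) (eval e x) (eval f x))
      (∣+∣≤ {eval e y ℚ.* (eval f y ℚ.- eval f x)} {(eval e y ℚ.- eval e x) ℚ.* eval f x}
        (product (eval e y) (eval f y ℚ.- eval f x) (e≤1 y) (eval-lipschitz f x y))
        (product (eval e y ℚ.- eval e x) (eval f x) (eval-lipschitz e x y) (tame-bound (tame f) x))))
    (≤-by (lip f ℚ.* norm x ℚ.* d) (0≤* (0≤* (0≤lip f) (0≤norm x)) (0≤norm (λ i → y i ℚ.- x i)))
      (solve 5 (λ l m F n d → (l :+ m :* F) :* (con 1ℚ :+ n) :* d
        := con 1ℚ :* (l :* d) :+ m :* d :* (F :* (con 1ℚ :+ n)) :+ l :* n :* d) refl
        (lip f) (lip e) F (norm x) d))
    where
    d = norm (λ i → y i ℚ.- x i)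
    product : ∀ p q {r s} → ℚ.∣ p ∣ ℚ.≤ r → ℚ.∣ q ∣ ℚ.≤ s → ℚ.∣ p ℚ.* q ∣ ℚ.≤ r ℚ.* s
    product p q p≤ q≤ = ℚₚ.≤-trans (ℚₚ.≤-reflexive (ℚₚ.∣p*q∣≡∣p∣*∣q∣ p q))
      (*-mono (ℚₚ.0≤∣p∣ p) p≤ (ℚₚ.0≤∣p∣ q) q≤)

-- Expectations

-- clamp K x = max (-K) (min K x) and excess K x = |x - clamp K x|
clamp excess : ∀ {k} → ℚ → Expr k → Expr k
clamp  K e = ½ ⊛ (abs (e ⊕ const K) ⊕ ℚ.- 1ℚ ⊛ abs (e ⊕ const (ℚ.- K)))
excess K e = ½ ⊛ (abs (e ⊕ const K) ⊕ abs (e ⊕ const (ℚ.- K))) ⊕ const (ℚ.- K)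

clampℚ excessℚ : ℚ → ℚ → ℚ
clampℚ  K x = eval {1} (clamp K (var zero)) (λ _ → x)
excessℚ K x = eval {1} (excess K (var zero)) (λ _ → x)

module _ (K x : ℚ) where
  private
    a = ℚ.∣ x ℚ.+ K ∣
    b = ℚ.∣ x ℚ.+ ℚ.- K ∣

  x-clamp≤excess : x ℚ.- clampℚ K x ℚ.≤ excessℚ K x
  x-clamp≤excess = ≤-by (a ℚ.- (x ℚ.+ K)) (0≤- (p≤∣p∣ (x ℚ.+ K)))
    (solve 4 (λ a b x K → con ½ :* (a :+ b) :+ :- K
      := x :- con ½ :* (a :+ :- con 1ℚ :* b) :+ (a :- (x :+ K))) refl a b x K)

  clamp-x≤excess : clampℚ K x ℚ.- x ℚ.≤ excessℚ K x
  clamp-x≤excess = ≤-by (b ℚ.- ℚ.- (x ℚ.+ ℚ.- K)) (0≤- (-p≤∣p∣ (x ℚ.+ ℚ.- K)))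
    (solve 4 (λ a b x K → con ½ :* (a :+ b) :+ :- K
      := con ½ :* (a :+ :- con 1ℚ :* b) :- x :+ (b :- :- (x :+ :- K))) refl a b x K)

  0≤excess : 0ℚ ℚ.≤ excessℚ K x
  0≤excess = ≤-by (½ ℚ.* (a ℚ.- (x ℚ.+ K)) ℚ.+ ½ ℚ.* (b ℚ.- ℚ.- (x ℚ.+ ℚ.- K)))
    (0≤+ (0≤* (ℚₚ.nonNegative⁻¹ ½) (0≤- (p≤∣p∣ (x ℚ.+ K))))
      (0≤* (ℚₚ.nonNegative⁻¹ ½) (0≤- (-p≤∣p∣ (x ℚ.+ ℚ.- K)))))
    (solve 4 (λ a b x K → con ½ :* (a :+ b) :+ :- K
      := con 0ℚ :+ (con ½ :* (a :- (x :+ K)) :+ con ½ :* (b :- :- (x :+ :- K)))) refl a b x K)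

  ∣clamp∣≤ : 0ℚ ℚ.≤ K → ℚ.∣ clampℚ K x ∣ ℚ.≤ K
  ∣clamp∣≤ 0≤K = ∣∣≤
    (≤-by (½ ℚ.* (b ℚ.+ (K ℚ.+ K) ℚ.- a)) (0≤* (ℚₚ.nonNegative⁻¹ ½) (0≤- (
        ℚₚ.≤-trans (ℚₚ.≤-reflexive (cong ℚ.∣_∣
          (solve 2 (λ x K → x :+ K := (x :+ :- K) :+ (K :+ K)) refl x K)))
          (∣+∣≤ {x ℚ.+ ℚ.- K} {K ℚ.+ K} ℚₚ.≤-refl (ℚₚ.≤-reflexive (ℚₚ.0≤p⇒∣p∣≡p (0≤+ 0≤K 0≤K)))))))
      (solve 3 (λ a b K → K := con ½ :* (a :+ :- con 1ℚ :* b) :+ con ½ :* (b :+ (K :+ K) :- a)) refl a b K))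
    (≤-by (½ ℚ.* (a ℚ.+ (K ℚ.+ K) ℚ.- b)) (0≤* (ℚₚ.nonNegative⁻¹ ½) (0≤- (
        ℚₚ.≤-trans (ℚₚ.≤-reflexive (cong ℚ.∣_∣
          (solve 2 (λ x K → x :+ :- K := (x :+ K) :+ :- (K :+ K)) refl x K)))
          (∣+∣≤ {x ℚ.+ K} {ℚ.- (K ℚ.+ K)} ℚₚ.≤-refl (ℚₚ.≤-reflexive
            (trans (ℚₚ.∣-p∣≡∣p∣ (K ℚ.+ K)) (ℚₚ.0≤p⇒∣p∣≡p (0≤+ 0≤K 0≤K))))))))
      (solve 3 (λ a b K → K := :- (con ½ :* (a :+ :- con 1ℚ :* b)) :+ con ½ :* (a :+ (K :+ K) :- b)) refl a b K))

  excess-anti : ∀ {d} → 0ℚ ℚ.≤ d → excessℚ (K ℚ.+ d) x ℚ.≤ excessℚ K x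
  excess-anti {d} 0≤d = ≤-by
    (½ ℚ.* (a ℚ.+ d ℚ.- a′) ℚ.+ ½ ℚ.* (b ℚ.+ d ℚ.- b′))
    (0≤+ (0≤* (ℚₚ.nonNegative⁻¹ ½) (0≤- (ℚₚ.≤-trans
        (ℚₚ.≤-reflexive (cong ℚ.∣_∣ (sym (ℚₚ.+-assoc x K d))))
        (∣+∣≤ {x ℚ.+ K} {d} ℚₚ.≤-refl (ℚₚ.≤-reflexive (ℚₚ.0≤p⇒∣p∣≡p 0≤d))))))
      (0≤* (ℚₚ.nonNegative⁻¹ ½) (0≤- (ℚₚ.≤-trans
        (ℚₚ.≤-reflexive (cong ℚ.∣_∣ (solve 3 (λ x K d → x :+ :- (K :+ d) := (x :+ :- K) :+ :- d) refl x K d)))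
        (∣+∣≤ {x ℚ.+ ℚ.- K} {ℚ.- d} ℚₚ.≤-refl
          (ℚₚ.≤-reflexive (trans (ℚₚ.∣-p∣≡∣p∣ d) (ℚₚ.0≤p⇒∣p∣≡p 0≤d))))))))
    (solve 6 (λ a b a′ b′ K d → con ½ :* (a :+ b) :+ :- K := con ½ :* (a′ :+ b′) :+ :- (K :+ d)
      :+ (con ½ :* (a :+ d :- a′) :+ con ½ :* (b :+ d :- b′))) refl a b a′ b′ K d)
    where
    a′ = ℚ.∣ x ℚ.+ (K ℚ.+ d) ∣
    b′ = ℚ.∣ x ℚ.+ ℚ.- (K ℚ.+ d) ∣

  excess-vanishes : ℚ.∣ x ∣ ℚ.≤ K → excessℚ K x ≡ 0ℚ
  excess-vanishes ∣x∣≤K = trans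
    (cong₂ (λ s t → ½ ℚ.* (s ℚ.+ t) ℚ.+ ℚ.- K)
      (ℚₚ.0≤p⇒∣p∣≡p (≤-by (K ℚ.- ℚ.- x) (0≤- (ℚₚ.≤-trans (-p≤∣p∣ x) ∣x∣≤K))
        (solve 2 (λ x K → x :+ K := con 0ℚ :+ (K :- :- x)) refl x K)))
      (trans (sym (ℚₚ.∣-p∣≡∣p∣ (x ℚ.+ ℚ.- K)))
        (ℚₚ.0≤p⇒∣p∣≡p (≤-by (K ℚ.- x) (0≤- (ℚₚ.≤-trans (p≤∣p∣ x) ∣x∣≤K))
          (solve 2 (λ x K → :- (x :+ :- K) := con 0ℚ :+ (K :- x)) refl x K)))))
    (solve 2 (λ x K → con ½ :* ((x :+ K) :+ (:- (x :+ :- K))) :+ :- K := con 0ℚ) refl x K)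

clamp-close₁ : ∀ K x {i} → i ≡ 1ℚ → ℚ.∣ i ℚ.* x ℚ.- i ℚ.* clampℚ K x ∣ ℚ.≤ excessℚ K x
clamp-close₁ K x refl = ∣∣≤
  (subst (ℚ._≤ excessℚ K x) (solve 2 (λ x c → x :- c := con 1ℚ :* x :- con 1ℚ :* c) refl x c)
    (x-clamp≤excess K x))
  (subst (ℚ._≤ excessℚ K x) (solve 2 (λ x c → c :- x := :- (con 1ℚ :* x :- con 1ℚ :* c)) refl x c)
    (clamp-x≤excess K x))
  where c = clampℚ K x

clamp-close₀ : ∀ K x {i} → i ≡ 0ℚ → ℚ.∣ i ℚ.* x ℚ.- i ℚ.* clampℚ K x ∣ ℚ.≤ excessℚ K x
clamp-close₀ K x refl = subst (ℚ._≤ excessℚ K x)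
  (cong ℚ.∣_∣ (solve 2 (λ x c → con 0ℚ := con 0ℚ :* x :- con 0ℚ :* c) refl x (clampℚ K x)))
  (0≤excess K x)

clampᵇ : ℕ → BoundedContinuous 1
clampᵇ K = record
  { fun = ⟦ clamp (ι K) (var zero) ⟧
  ; bounded = fromℚ (ι K) , λ x → ≤-pointwise {∣ ⟦ clamp (ι K) (var zero) ⟧ x ∣} {fromℚ (ι K)}
      (λ n → ∣clamp∣≤ (ι K) (seq (x zero) n) (0≤ι K))
  ; continuous = tame-continuous (tame (clamp (ι K) (var zero))) }

≈-approx : ∀ {x y} → (∀ ε → 0ℚ ℚ.< ε → ∣ x - y ∣ ≤ fromℚ ε) → x ≈ y
≈-approx {x} {y} h ε 0<ε = let (N , p) = h (½ ℚ.* ε) (½-pos 0<ε) (½ ℚ.* ε) (½-pos 0<ε) in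
  N , λ n n≥ → ℚₚ.≤-trans (p n n≥)
    (ℚₚ.≤-reflexive (solve 1 (λ ε → con ½ :* ε :+ con ½ :* ε := ε) refl ε))

dist-triangle : ∀ x y z ε → ∣ x - z ∣ ≤ fromℚ (½ ℚ.* ε) → ∣ y - z ∣ ≤ fromℚ (½ ℚ.* ε) →
  ∣ x - y ∣ ≤ fromℚ ε
dist-triangle x y z ε x-z y-z =
  ≤-trans {∣ x - y ∣} {∣ x - z ∣ + ∣ y - z ∣} {fromℚ ε}
    (≤-pointwise {∣ x - y ∣} {∣ x - z ∣ + ∣ y - z ∣} (λ n → subst (ℚ._≤ seq (∣ x - z ∣ + ∣ y - z ∣) n)
      (cong ℚ.∣_∣ (solve 3 (λ x y z → (x :- z) :+ (:- (y :- z)) := x :- y) refl (seq x n) (seq y n) (seq z n)))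
      (∣+∣≤ {seq x n ℚ.- seq z n} {ℚ.- (seq y n ℚ.- seq z n)} ℚₚ.≤-refl
        (ℚₚ.≤-reflexive (ℚₚ.∣-p∣≡∣p∣ (seq y n ℚ.- seq z n))))))
    (≤-trans {∣ x - z ∣ + ∣ y - z ∣} {fromℚ (½ ℚ.* ε) + fromℚ (½ ℚ.* ε)} {fromℚ ε}
      (+-mono-≤ {∣ x - z ∣} {fromℚ (½ ℚ.* ε)} {∣ y - z ∣} {fromℚ (½ ℚ.* ε)} x-z y-z)
      (≤-pointwise {fromℚ (½ ℚ.* ε) + fromℚ (½ ℚ.* ε)} {fromℚ ε} (λ _ → ℚₚ.≤-reflexive
        (solve 1 (λ ε → con ½ :* ε :+ con ½ :* ε := ε) refl ε))))

module Expectation (S : ProbabilitySpace) where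
  open ProbabilitySpace S

  integrable-tame : ∀ {k} {φ : (Fin k → ℝ) → ℝ} → Tame φ → (X : Fin k → Ω → ℝ) →
    (∀ i → Integrable (X i)) → Integrable (λ ω → φ (λ i → X i ω))
  integrable-tame {φ = φ} T = integrable-∘ φ (tame-continuous T) (tame-growth T)

  -- HasMean as a record, whose parameters unification can recover.
  record Mean (X : Ω → ℝ) (e : ℝ) : Set where
    constructor mk
    field
      integrable  : Integrable X
      expectation : 𝔼 X integrable ≈ e

    hasMean : HasMean X e
    hasMean = integrable , expectation

  fromHasMean : ∀ {X e} → HasMean X e → Mean X e
  fromHasMean (i , X≈e) = mk i X≈e

  mean-mono : ∀ {X Y : Ω → ℝ} {e f} → Mean X e → Mean Y f → (∀ ω → X ω ≤ Y ω) → e ≤ f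
  mean-mono {e = e} {f} (mk iX X≈e) (mk iY Y≈f) X≤Y = ≤-trans {e} {𝔼 _ iX} {f} (≈⇒≥ {𝔼 _ iX} {e} X≈e)
    (≤-trans {𝔼 _ iX} {𝔼 _ iY} {f} (𝔼-mono iX iY X≤Y) (≈⇒≤ {𝔼 _ iY} {f} Y≈f))

  mean : ∀ {X : Ω → ℝ} (int : Integrable X) → Mean X (𝔼 X int)
  mean int = mk int (≈-refl {𝔼 _ int})

  mean-cong : ∀ {X Y : Ω → ℝ} {e f} → (∀ ω → X ω ≈ Y ω) → e ≈ f → Mean X e → Mean Y f
  mean-cong {X} {Y} {e} {f} X≈Y e≈f (mk iX X≈e) = mk iY
    (≈-trans {𝔼 Y iY} {e} {f} (≤-antisym {𝔼 Y iY} {e}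
      (mean-mono {e = 𝔼 Y iY} {e} (mean iY) (mk iX X≈e) (λ ω → ≈⇒≥ {X ω} {Y ω} (X≈Y ω)))
      (mean-mono {e = e} {𝔼 Y iY} (mk iX X≈e) (mean iY) (λ ω → ≈⇒≤ {X ω} {Y ω} (X≈Y ω)))) e≈f)
    where iY = integrable-resp X≈Y iX

  mean-+ : ∀ {X Y : Ω → ℝ} {e f} → Mean X e → Mean Y f → Mean (λ ω → X ω + Y ω) (e + f)
  mean-+ {X} {Y} {e} {f} (mk iX X≈e) (mk iY Y≈f) = mk i
    (≈-trans {𝔼 _ i} {𝔼 X iX + 𝔼 Y iY} {e + f} (𝔼-+ iX iY i)
      (+-cong {𝔼 X iX} {e} {𝔼 Y iY} {f} X≈e Y≈f))
    where
    i = integrable-tame (tame (var zero ⊕ var (suc zero))) (X ∷ Y ∷ [])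
          λ { zero → iX ; (suc zero) → iY }

  mean-⊛ : ∀ {X : Ω → ℝ} {e} q → Mean X e → Mean (λ ω → fromℚ q * X ω) (fromℚ q * e)
  mean-⊛ {X} {e} q (mk iX X≈e) = mk i
    (≈-trans {𝔼 _ i} {fromℚ q * 𝔼 X iX} {fromℚ q * e} (𝔼-* (fromℚ q) iX i)
      (*-congˡ (fromℚ q) {𝔼 X iX} {e} X≈e))
    where i = integrable-tame (tame {1} (q ⊛ var zero)) (λ _ → X) (λ _ → iX)

  mean-1 : Mean (λ _ → 1ℝ) 1ℝ
  mean-1 = mk i (𝔼-1 i)
    where i = integrable-tame (tame {0} (const 1ℚ)) (λ ()) (λ ())

  mean-0 : Mean (λ _ → 0ℝ) 0ℝ
  mean-0 = mean-cong (λ _ → ≈-pointwise {0ℝ * 1ℝ} {0ℝ} (λ _ → refl)) (≈-pointwise {0ℝ * 1ℝ} {0ℝ} (λ _ → refl))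
    (mean-⊛ 0ℚ mean-1)

  mean-diff : ∀ {X Y : Ω → ℝ} {e f} → Mean X e → Mean Y f → Mean (λ ω → X ω - Y ω) (e - f)
  mean-diff {X} {Y} {e} {f} p q = mean-cong
    (λ ω → ≈-pointwise {X ω + fromℚ (ℚ.- 1ℚ) * Y ω} {X ω - Y ω} (λ n → eq (seq (X ω) n) (seq (Y ω) n)))
    (≈-pointwise {e + fromℚ (ℚ.- 1ℚ) * f} {e - f} (λ n → eq (seq e n) (seq f n)))
    (mean-+ p (mean-⊛ (ℚ.- 1ℚ) q))
    where
    eq : ∀ x y → x ℚ.+ (ℚ.- 1ℚ) ℚ.* y ≡ x ℚ.- y
    eq = solve 2 (λ x y → x :+ (:- con 1ℚ) :* y := x :- y) refl

  mean-sum : ∀ n {X : ℕ → Ω → ℝ} {e : ℕ → ℝ} → (∀ i → i ℕ.< n → Mean (X i) (e i)) →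
    Mean (λ ω → sum n (λ i → X i ω)) (sum n e)
  mean-sum zero    p = mean-0
  mean-sum (suc n) p = mean-+ (mean-sum n (λ i i<n → p i (ℕₚ.m<n⇒m<1+n i<n))) (p n ℕₚ.≤-refl)

  ∣mean∣≤ : ∀ {X Y : Ω → ℝ} {e f} → Mean X e → Mean Y f →
    (∀ ω n → ℚ.∣ seq (X ω) n ∣ ℚ.≤ seq (Y ω) n) → ∣ e ∣ ≤ f
  ∣mean∣≤ {X} {Y} {e} {f} p q h = ∣∣-≤ {e} {f}
    (mean-mono p q (λ ω → ≤-pointwise {X ω} {Y ω} (λ n → ℚₚ.≤-trans (p≤∣p∣ (seq (X ω) n)) (h ω n))))
    (≤-trans { - e} {0ℝ - e} {f}
      (≤-pointwise { - e} {0ℝ - e} (λ n → ℚₚ.≤-reflexive (sym (ℚₚ.+-identityˡ (ℚ.- seq e n)))))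
      (mean-mono (mean-diff mean-0 p) q (λ ω → ≤-pointwise {0ℝ - X ω} {Y ω} (λ n →
        ℚₚ.≤-trans (ℚₚ.≤-reflexive (ℚₚ.+-identityˡ (ℚ.- seq (X ω) n)))
          (ℚₚ.≤-trans (-p≤∣p∣ (seq (X ω) n)) (h ω n))))))

  module _ {X : Ω → ℝ} (iX : Integrable X) where
    private
      Excess : ℕ → Ω → ℝ
      Excess K ω = ⟦ excess (ι K) (var zero) ⟧ (λ (_ : Fin 1) → X ω)

    integrable-clamp : ∀ K → Integrable (λ ω → fun (clampᵇ K) (λ _ → X ω))
    integrable-clamp K = integrable-tame (tame {1} (clamp (ι K) (var zero))) (λ _ → X) (λ _ → iX)

    -- Daniell's axiom, applied to the decreasing truncation errors.
    truncation : ∀ ε → 0ℚ ℚ.< ε → ∃[ N ] ∀ K → N ℕ.≤ K → ∃[ η ] η ≤ fromℚ ε ×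
      Mean (λ ω → ⟦ excess (ι K) (var zero) ⟧ (λ (_ : Fin 1) → X ω)) η
    truncation ε 0<ε =
      let (N , h) = 𝔼-↓0 Excess int decreasing vanishing (fromℚ ε) (fromℚ-< 0<ε)
      in N , λ K N≤K → let η = 𝔼 (Excess K) (int K) in
        η , ≤-trans {η} {∣ η ∣} {fromℚ ε} (x≤∣x∣ {η}) (<⇒≤ {∣ η ∣} {fromℚ ε} (h K N≤K)) , mean (int K)
      where
      int : ∀ K → Integrable (Excess K)
      int K = integrable-tame (tame {1} (excess (ι K) (var zero))) (λ _ → X) (λ _ → iX)
      decreasing : ∀ K ω → Excess (suc K) ω ≤ Excess K ω
      decreasing K ω = ≤-pointwise {Excess (suc K) ω} {Excess K ω} (λ n →
        subst (λ t → excessℚ t (seq (X ω) n) ℚ.≤ excessℚ (ι K) (seq (X ω) n))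
          (trans (ℚₚ.+-comm (ι K) 1ℚ) (sym (ι-suc K)))
          (excess-anti (ι K) (seq (X ω) n) (ℚₚ.nonNegative⁻¹ 1ℚ)))
      vanishing : ∀ ω ε → 0ℝ < ε → ∃[ N ] ∀ K → N ℕ.≤ K → ∣ Excess K ω ∣ < ε
      vanishing ω ε 0<ε =
        let (B , _ , X≤B) = upper-bound (X ω)
            -- One more than `B`, because the terms of `X ω` respect the bound only up to an
            -- eventual error, here taken to be 1. From there on the excess is eventually zero term
            -- by term.
            (N , B+1≤N) = ≤-ι (B ℚ.+ 1ℚ)
            (M , h) = X≤B 1ℚ (ℚₚ.positive⁻¹ 1ℚ)
        in N , λ K N≤K → ≤-<-trans {∣ Excess K ω ∣} {0ℝ} {ε}
          (λ δ 0<δ → M , λ n n≥ → ℚₚ.≤-trans (ℚₚ.≤-reflexive (cong ℚ.∣_∣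
              (excess-vanishes (ι K) (seq (X ω) n)
                (ℚₚ.≤-trans (h n n≥) (ℚₚ.≤-trans B+1≤N (ι-mono N≤K))))))
            (≤-by δ (ℚₚ.<⇒≤ 0<δ) refl)) 0<ε

  ∣mean-clamp∣≤ : ∀ {X : Ω → ℝ} {e c η} K → Mean X e →
    Mean (λ ω → fun (clampᵇ K) (λ _ → X ω)) c →
    Mean (λ ω → ⟦ excess (ι K) (var zero) ⟧ (λ (_ : Fin 1) → X ω)) η → ∣ e - c ∣ ≤ η
  ∣mean-clamp∣≤ {X} K p q r = ∣mean∣≤ (mean-diff p q) r (λ ω n → ∣∣≤
    (x-clamp≤excess (ι K) (seq (X ω) n))
    (subst (ℚ._≤ excessℚ (ι K) (seq (X ω) n))
      (solve 2 (λ x c → c :- x := :- (x :- c)) refl (seq (X ω) n) (clampℚ (ι K) (seq (X ω) n)))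
      (clamp-x≤excess (ι K) (seq (X ω) n))))

  module _ {I X : Ω → ℝ} (I∈01 : ∀ ω → (∀ n → seq (I ω) n ≡ 1ℚ) ⊎ (∀ n → seq (I ω) n ≡ 0ℚ))
           (iI : Integrable I) (iX : Integrable X) where
    private
      clamped : Expr 2
      clamped = clamp 1ℚ (var zero)

      IX : Ω → ℝ
      IX ω = I ω * X ω

      integrable-IX : Integrable IX
      -- As a function of two variables the product is not of linear growth. Clamping `I` to
      -- [-1 , 1] changes nothing on the values 0 and 1 and supplies the bounded factor that
      -- `tame-*` requires.
      integrable-IX = integrable-resp
        (λ ω → ≈-pointwise {⟦ clamped ⟧ (λ i → (I ∷ X ∷ []) i ω) * X ω} {IX ω} (λ n →
          cong (ℚ._* seq (X ω) n) (clamp-I ω n)))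
        (integrable-tame (tame-* clamped (var (suc zero))
            (λ x → ∣clamp∣≤ 1ℚ (x zero) (ℚₚ.nonNegative⁻¹ 1ℚ))) (I ∷ X ∷ [])
          (λ { zero → iI ; (suc zero) → iX }))
        where
        clamp-I : ∀ ω n → clampℚ 1ℚ (seq (I ω) n) ≡ seq (I ω) n
        clamp-I ω n with I∈01 ω
        ... | inj₁ I≡1 rewrite I≡1 n = refl
        ... | inj₂ I≡0 rewrite I≡0 n = refl

    -- Independence yields the product rule only for the clamped variable. Since `I` is 0 or 1 and
    -- `w` lies between 0 and 1, clamping moves either side by at most the expected excess, which
    -- can be made arbitrarily small.
    mean-product : ∀ {e w} → 0ℚ ℚ.≤ w → w ℚ.≤ 1ℚ → Mean X e →
      (∀ K c → Mean (λ ω → fun (clampᵇ K) (λ _ → X ω)) c →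
        Mean (λ ω → I ω * fun (clampᵇ K) (λ _ → X ω)) (fromℚ w * c)) →
      Mean (λ ω → I ω * X ω) (fromℚ w * e)
    mean-product {e} {w} 0≤w w≤1 X-mean factor =
      mk integrable-IX (≈-approx {μ} {fromℚ w * e} (λ ε 0<ε →
        let (N , h) = truncation iX (½ ℚ.* ε) (½-pos 0<ε)
            (η , η≤ , excess-mean) = h N ℕₚ.≤-refl
            c = 𝔼 _ (integrable-clamp iX N)
            c-mean = mean (integrable-clamp iX N)
            e-c = ∣mean-clamp∣≤ N X-mean c-mean excess-mean
            μ-wc : ∣ μ - fromℚ w * c ∣ ≤ η
            μ-wc = ∣mean∣≤ (mean-diff (mean integrable-IX) (factor N c c-mean)) excess-mean (close N)
            we-wc : ∣ fromℚ w * e - fromℚ w * c ∣ ≤ η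
            we-wc = ≤-trans {∣ fromℚ w * e - fromℚ w * c ∣} {∣ e - c ∣} {η}
              (≤-pointwise {∣ fromℚ w * e - fromℚ w * c ∣} {∣ e - c ∣} (λ n → contract (seq e n) (seq c n))) e-c
        in dist-triangle μ (fromℚ w * e) (fromℚ w * c) ε
               (≤-trans {∣ μ - fromℚ w * c ∣} {η} {fromℚ (½ ℚ.* ε)} μ-wc η≤)
               (≤-trans {∣ fromℚ w * e - fromℚ w * c ∣} {η} {fromℚ (½ ℚ.* ε)} we-wc η≤)))
      where
      μ = 𝔼 IX integrable-IX
      contract : ∀ x y → ℚ.∣ w ℚ.* x ℚ.- w ℚ.* y ∣ ℚ.≤ ℚ.∣ x ℚ.- y ∣
      contract x y = subst₂ ℚ._≤_
        (trans (cong (ℚ._* ℚ.∣ x ℚ.- y ∣) (sym (ℚₚ.0≤p⇒∣p∣≡p 0≤w)))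
          (trans (sym (ℚₚ.∣p*q∣≡∣p∣*∣q∣ w (x ℚ.- y)))
            (cong ℚ.∣_∣ (solve 3 (λ w x y → w :* (x :- y) := w :* x :- w :* y) refl w x y))))
        (ℚₚ.*-identityˡ ℚ.∣ x ℚ.- y ∣)
        (ℚₚ.*-monoʳ-≤-nonNeg ℚ.∣ x ℚ.- y ∣ {{ℚ.nonNegative (ℚₚ.0≤∣p∣ (x ℚ.- y))}} w≤1)
      close : ∀ K ω n → ℚ.∣ seq (I ω) n ℚ.* seq (X ω) n ℚ.- seq (I ω) n ℚ.* clampℚ (ι K) (seq (X ω) n) ∣
        ℚ.≤ excessℚ (ι K) (seq (X ω) n)
      close K ω n = [ (λ I≡1 → clamp-close₁ (ι K) (seq (X ω) n) (I≡1 n))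
                    , (λ I≡0 → clamp-close₀ (ι K) (seq (X ω) n) (I≡0 n)) ]′ (I∈01 ω)

module _ (S T : ProbabilitySpace) where
  open ProbabilitySpace using (Ω; 𝔼)
  private
    module S = Expectation S
    module T = Expectation T

  -- A clamp level that serves both spaces gives one number `c`, the common mean of the clamped
  -- variables, close to both `e` and `f`.
  same-law⇒same-mean : ∀ {X : Ω S → ℝ} {Y : Ω T → ℝ} {e f} →
    (∀ K c → S.Mean (λ ω → fun (clampᵇ K) (λ _ → X ω)) c → T.Mean (λ ω → fun (clampᵇ K) (λ _ → Y ω)) c) →
    S.Mean X e → T.Mean Y f → e ≈ f
  same-law⇒same-mean {X} {Y} {e} {f} transfer p q = ≈-approx {e} {f} (λ ε 0<ε →
    let (M , h) = S.truncation (S.Mean.integrable p) (½ ℚ.* ε) (½-pos 0<ε)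
        (N , h′) = T.truncation (T.Mean.integrable q) (½ ℚ.* ε) (½-pos 0<ε)
        K = M ℕ.⊔ N
        (η , η≤ , r) = h K (ℕₚ.m≤m⊔n M N)
        (η′ , η′≤ , r′) = h′ K (ℕₚ.m≤n⊔m M N)
        iS = S.integrable-clamp (S.Mean.integrable p) K
        c = 𝔼 S _ iS
        c-mean = S.mean iS
    in dist-triangle e f c ε
           (≤-trans {∣ e - c ∣} {η} {fromℚ (½ ℚ.* ε)} (S.∣mean-clamp∣≤ K p c-mean r) η≤)
           (≤-trans {∣ f - c ∣} {η′} {fromℚ (½ ℚ.* ε)} (T.∣mean-clamp∣≤ K q (transfer K c c-mean) r′) η′≤))

-- The recurrence for the expected costs

∑<-zero : ∀ n {f : ℕ → ℚ} → (∀ i → i ℕ.< n → f i ≡ 0ℚ) → ∑< n f ≡ 0ℚ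
∑<-zero zero    f≡0 = refl
∑<-zero (suc n) f≡0 = cong₂ ℚ._+_ (∑<-zero n (λ i i<n → f≡0 i (ℕₚ.m<n⇒m<1+n i<n))) (f≡0 n ℕₚ.≤-refl)

∑<-single : ∀ n i₀ {f : ℕ → ℚ} → i₀ ℕ.< n → (∀ i → i ℕ.< n → i ≢ i₀ → f i ≡ 0ℚ) → ∑< n f ≡ f i₀
∑<-single (suc n) i₀ {f} i₀<n f≡0 with i₀ ℕₚ.≟ n
... | yes refl = trans (cong (ℚ._+ f n)
        (∑<-zero n (λ i i<n → f≡0 i (ℕₚ.m<n⇒m<1+n i<n) (ℕₚ.<⇒≢ i<n)))) (ℚₚ.+-identityˡ (f n))
... | no i₀≢n = trans (cong₂ ℚ._+_
        (∑<-single n i₀ (ℕₚ.≤∧≢⇒< (ℕₚ.≤-pred i₀<n) i₀≢n) (λ i i<n → f≡0 i (ℕₚ.m<n⇒m<1+n i<n)))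
        (f≡0 n ℕₚ.≤-refl (λ n≡i₀ → i₀≢n (sym n≡i₀)))) (ℚₚ.+-identityʳ (f i₀))

-- The segments of a round as sums over pairs of pivots

module _ (n : ℕ) (m : ℕ → ℕ) {P : ℕ → ℕ → Set} (P? : ∀ k j → Dec (P k j)) (x : ℕ → ℕ → ℝ) where

  private
    term : ℕ → ℕ → ℕ → ℚ
    term N k j = seq (𝟙 (P? k j) * x k j) N

    𝟙-no : ∀ {P : Set} (d : Dec P) → ¬ P → ∀ N y → seq (𝟙 d * y) N ≡ 0ℚ
    𝟙-no (yes p) ¬p N y = ⊥-elim (¬p p)
    𝟙-no (no _)  ¬p N y = ℚₚ.*-zeroˡ (seq y N)

    𝟙-yes : ∀ {P : Set} (d : Dec P) → P → ∀ N y → seq (𝟙 d * y) N ≡ seq y N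
    𝟙-yes (yes _) p N y = ℚₚ.*-identityˡ (seq y N)
    𝟙-yes (no ¬p) p N y = ⊥-elim (¬p p)

  -- If `E` holds, exactly one pair of indices is hit and carries the value `y`; otherwise none is.
  -- A cost at random size and rank thus becomes a sum in which all sizes and ranks are fixed, the
  -- form to which independence applies.
  indicator-cases : ∀ {E : Set} (E? : Dec E) (y : ℝ) →
    (E → ∃[ k ] ∃[ j ] k ℕ.< n × j ℕ.< m k × P k j × (y ≡ x k j) ×
      (∀ k′ j′ → k′ ℕ.< n → j′ ℕ.< m k′ → P k′ j′ → k′ ≡ k × j′ ≡ j)) →
    (∀ k j → k ℕ.< n → j ℕ.< m k → P k j → E) →
    ∀ N → seq (𝟙 E? * y) N ≡ seq (sum n (λ k → sum (m k) (λ j → 𝟙 (P? k j) * x k j))) N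
  indicator-cases {E} E? y case complete N = trans (go E?)
    (sym (seq-sum-sum n m (λ k j → 𝟙 (P? k j) * x k j) N))
    where
    go : (d : Dec E) → seq (𝟙 d * y) N ≡ ∑< n (λ k → ∑< (m k) (term N k))
    go (no ¬e) = trans (ℚₚ.*-zeroˡ (seq y N)) (sym (∑<-zero n (λ k k<n → ∑<-zero (m k) (λ j j<m →
      𝟙-no (P? k j) (λ p → ¬e (complete k j k<n j<m p)) N (x k j)))))
    go (yes e) with case e
    ... | k , j , k<n , j<m , p , refl , unique = trans (ℚₚ.*-identityˡ (seq (x k j) N)) (sym (trans
      (∑<-single n k k<n (λ k′ k′<n k′≢k → ∑<-zero (m k′) (λ j′ j′<m →
        𝟙-no (P? k′ j′) (λ p′ → k′≢k (proj₁ (unique k′ j′ k′<n j′<m p′))) N (x k′ j′))))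
      (trans (∑<-single (m k) j j<m (λ j′ j′<m j′≢j →
          𝟙-no (P? k j′) (λ p′ → j′≢j (proj₂ (unique k j′ k<n j′<m p′))) N (x k j′)))
        (𝟙-yes (P? k j) p N (x k j)))))

-- For sought rank p + 1 among p + q + 1 elements and pivot ranks r₁ < r₂.
module _ (p q r₁ r₂ : ℕ) (1≤r₁ : 1 ℕ.≤ r₁) (r₁<r₂ : r₁ ℕ.< r₂) (r₂≤n : r₂ ℕ.≤ suc (p ℕ.+ q))
         (g : ℕ → ℕ → ℝ) where

  private
    R = ranks (suc (p ℕ.+ q)) r₁ r₂

    pivots? : ∀ s₁ s₂ → Dec (r₁ ≡ s₁ × r₂ ≡ s₂)
    pivots? s₁ s₂ = (r₁ ℕₚ.≟ s₁) ×-dec (r₂ ℕₚ.≟ s₂)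

    shift : ∀ r a b → suc (suc (r ℕ.+ a ℕ.+ b)) ℕ.∸ r ℕ.∸ 1 ≡ suc (a ℕ.+ b)
    shift r a b = trans (cong (λ t → t ℕ.∸ r ℕ.∸ 1)
        (trans (cong (λ t → suc (suc t)) (ℕₚ.+-assoc r a b))
          (trans (cong suc (sym (ℕₚ.+-suc r (a ℕ.+ b)))) (sym (ℕₚ.+-suc r (suc (a ℕ.+ b)))))))
      (cong (ℕ._∸ 1) (ℕₚ.m+n∸m≡n r (suc (suc (a ℕ.+ b)))))

    shift₁ : ∀ r a → suc (r ℕ.+ a) ℕ.∸ r ≡ suc a
    shift₁ r a = trans (cong (ℕ._∸ r) (sym (ℕₚ.+-suc r a))) (ℕₚ.m+n∸m≡n r (suc a))

    above-cancel : ∀ {j k} → suc (suc (p ℕ.+ j)) ≡ suc (suc (p ℕ.+ k)) → j ≡ k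
    above-cancel {j} {k} eq = ℕₚ.+-cancelˡ-≡ p j k (ℕₚ.suc-injective (ℕₚ.suc-injective eq))

    above-< : ∀ {r} k → r ≡ suc (suc (p ℕ.+ k)) → suc p ℕ.< r
    above-< k refl = s≤s (s≤s (ℕₚ.m≤m+n p k))

    above-bound : ∀ k → suc (suc (p ℕ.+ k)) ℕ.≤ suc (p ℕ.+ q) → k ℕ.< q
    above-bound k h = ℕₚ.+-cancelˡ-≤ p (suc k) q (subst (ℕ._≤ p ℕ.+ q) (sym (ℕₚ.+-suc p k)) (ℕₚ.≤-pred h))

    below : ∀ {r} → r ℕ.≤ p → ∃[ k ] r ℕ.+ k ≡ p × r ≡ p ℕ.∸ k
    below {r} r≤p with ℕₚ.m≤n⇒∃[o]m+o≡n r≤p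
    ... | k , r+k≡p = k , r+k≡p , trans (sym (ℕₚ.m+n∸n≡m r k)) (cong (ℕ._∸ k) r+k≡p)

    below-< : ∀ {r k} → 1 ℕ.≤ r → r ℕ.+ k ≡ p → k ℕ.< p
    below-< {r} {k} 1≤r r+k≡p = subst (k ℕ.<_) r+k≡p (ℕₚ.+-monoˡ-≤ k 1≤r)

  -- In this and the next two lemmas an index counts the elements strictly between the sought one
  -- and a pivot: a pivot above has rank p + 2 + j, a pivot below has rank p - j. The recursive call
  -- keeps the elements counted towards the nearest pivot on either side, or all of them where there
  -- is no pivot.
  segment-above : ∀ N → seq (segmentCost R (suc p) zero g) N
    ≡ seq (sum q (λ k → sum k (λ j →
        𝟙 (pivots? (suc (suc (p ℕ.+ j))) (suc (suc (p ℕ.+ k)))) * g (suc (p ℕ.+ j)) (suc p)))) N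
  segment-above = indicator-cases q (λ k → k)
    (λ k j → pivots? (suc (suc (p ℕ.+ j))) (suc (suc (p ℕ.+ k)))) (λ k j → g (suc (p ℕ.+ j)) (suc p))
    ((0 ℕₚ.<? suc p) ×-dec (suc p ℕₚ.<? r₁)) (g (r₁ ℕ.∸ 1) (suc p)) found
    (λ { k j _ _ (r₁≡ , _) → s≤s z≤n , above-< j r₁≡ })
    where
    found : 0 ℕ.< suc p × suc p ℕ.< r₁ → _
    found (_ , m<r₁) with ℕₚ.m≤n⇒∃[o]m+o≡n m<r₁ | ℕₚ.m≤n⇒∃[o]m+o≡n (ℕₚ.<-trans m<r₁ r₁<r₂)
    ... | j , refl | k , refl =
      k , j , above-bound k r₂≤n ,
      ℕₚ.+-cancelˡ-< p j k (ℕₚ.≤-pred (ℕₚ.≤-pred r₁<r₂)) , (refl , refl) , refl ,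
      λ { k′ j′ _ _ (r₁≡ , r₂≡) → sym (above-cancel r₂≡) , sym (above-cancel r₁≡) }

  segment-middle : ∀ N → seq (segmentCost R (suc p) (suc zero) g) N
    ≡ seq (sum p (λ i → sum q (λ k →
        𝟙 (pivots? (p ℕ.∸ i) (suc (suc (p ℕ.+ k)))) * g (suc (i ℕ.+ k)) (suc i)))) N
  segment-middle = indicator-cases p (λ _ → q)
    (λ i k → pivots? (p ℕ.∸ i) (suc (suc (p ℕ.+ k)))) (λ i k → g (suc (i ℕ.+ k)) (suc i))
    ((r₁ ℕₚ.<? suc p) ×-dec (suc p ℕₚ.<? r₂)) (g (r₂ ℕ.∸ r₁ ℕ.∸ 1) (suc p ℕ.∸ r₁)) found
    (λ { i k _ _ (r₁≡ , r₂≡) → s≤s (subst (ℕ._≤ p) (sym r₁≡) (ℕₚ.m∸n≤m p i)) , above-< k r₂≡ })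
    where
    found : r₁ ℕ.< suc p × suc p ℕ.< r₂ → _
    found (r₁<m , m<r₂) with below (ℕₚ.≤-pred r₁<m) | ℕₚ.m≤n⇒∃[o]m+o≡n m<r₂
    ... | i , r₁+i≡p , r₁≡ | k , refl =
      i , k , i<p , above-bound k r₂≤n , (r₁≡ , refl) ,
      cong₂ g (trans (cong (λ t → suc (suc (t ℕ.+ k)) ℕ.∸ r₁ ℕ.∸ 1) (sym r₁+i≡p)) (shift r₁ i k))
        (trans (cong (λ t → suc t ℕ.∸ r₁) (sym r₁+i≡p)) (shift₁ r₁ i)) ,
      λ { i′ k′ i′<p _ (r₁≡′ , r₂≡′) →
        ℕₚ.∸-cancelˡ-≡ (ℕₚ.<⇒≤ i′<p) (ℕₚ.<⇒≤ i<p) (trans (sym r₁≡′) r₁≡) , sym (above-cancel r₂≡′) }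
      where i<p = below-< 1≤r₁ r₁+i≡p

  segment-below : ∀ N → seq (segmentCost R (suc p) (suc (suc zero)) g) N
    ≡ seq (sum p (λ k → sum k (λ j →
        𝟙 (pivots? (p ℕ.∸ k) (p ℕ.∸ j)) * g (suc (j ℕ.+ q)) (suc j)))) N
  segment-below = indicator-cases p (λ k → k)
    (λ k j → pivots? (p ℕ.∸ k) (p ℕ.∸ j)) (λ k j → g (suc (j ℕ.+ q)) (suc j))
    ((r₂ ℕₚ.<? suc p) ×-dec (suc p ℕₚ.<? suc (suc (p ℕ.+ q))))
    (g (suc (suc (p ℕ.+ q)) ℕ.∸ r₂ ℕ.∸ 1) (suc p ℕ.∸ r₂)) found
    (λ { k j _ _ (_ , r₂≡) → s≤s (subst (ℕ._≤ p) (sym r₂≡) (ℕₚ.m∸n≤m p j)) , s≤s (s≤s (ℕₚ.m≤m+n p q)) })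
    where
    found : r₂ ℕ.< suc p × suc p ℕ.< suc (suc (p ℕ.+ q)) → _
    found (r₂<m , _) with below (ℕₚ.≤-pred r₂<m) | below (ℕₚ.<⇒≤ (ℕₚ.<-≤-trans r₁<r₂ (ℕₚ.≤-pred r₂<m)))
    ... | j , r₂+j≡p , r₂≡ | k , r₁+k≡p , r₁≡ =
      k , j , k<p , j<k , (r₁≡ , r₂≡) ,
      cong₂ g (trans (cong (λ t → suc (suc (t ℕ.+ q)) ℕ.∸ r₂ ℕ.∸ 1) (sym r₂+j≡p)) (shift r₂ j q))
        (trans (cong (λ t → suc t ℕ.∸ r₂) (sym r₂+j≡p)) (shift₁ r₂ j)) ,
      λ { k′ j′ k′<p j′<k′ (r₁≡′ , r₂≡′) →
        ℕₚ.∸-cancelˡ-≡ (ℕₚ.<⇒≤ k′<p) (ℕₚ.<⇒≤ k<p) (trans (sym r₁≡′) r₁≡) ,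
        ℕₚ.∸-cancelˡ-≡ (ℕₚ.<⇒≤ (ℕₚ.<-trans j′<k′ k′<p)) (ℕₚ.<⇒≤ (ℕₚ.<-trans j<k k<p)) (trans (sym r₂≡′) r₂≡) }
      where
      k<p = below-< 1≤r₁ r₁+k≡p
      j<k : j ℕ.< k
      j<k = ℕₚ.+-cancelˡ-< r₁ j k (ℕₚ.<-≤-trans (ℕₚ.+-monoˡ-< j r₁<r₂)
        (ℕₚ.≤-reflexive (trans r₂+j≡p (sym r₁+k≡p))))

ι-C2 : ∀ n → ι (suc n choose 2) ≡ ½ ℚ.* ((1ℚ ℚ.+ ι n) ℚ.* ι n)
ι-C2 zero    = refl
ι-C2 (suc n) = trans (cong ι (sym (nCk+nC[k+1]≡[n+1]C[k+1] (suc n) 1)))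
  (trans (ι-+ (suc n choose 1) (suc n choose 2))
    (trans (cong₂ ℚ._+_ (trans (cong ι (nC1≡n (suc n))) (ι-suc n)) (ι-C2 n))
      (trans (solve 1 (λ t → con 1ℚ :+ t :+ con ½ :* ((con 1ℚ :+ t) :* t)
          := con ½ :* ((con 1ℚ :+ (con 1ℚ :+ t)) :* (con 1ℚ :+ t))) refl (ι n))
        (cong (λ t → ½ ℚ.* ((1ℚ ℚ.+ t) ℚ.* t)) (sym (ι-suc n))))))

-- The continuous function max 0 (1 - |x - r₁| - |y - r₂|) of (x , y , z); on integers,
-- the indicator of (x , y) = (r₁ , r₂).
distance bump : ℕ → ℕ → Expr 3
distance r₁ r₂ = abs (var zero ⊕ const (ℚ.- ι r₁)) ⊕ abs (var (suc zero) ⊕ const (ℚ.- ι r₂))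
bump r₁ r₂ = ½ ⊛ (abs (z ⊕ const (ℚ.- 1ℚ)) ⊕ abs (z ⊕ const 1ℚ)) ⊕ ℚ.- 1ℚ ⊛ abs z
  where z = distance r₁ r₂

module _ (z : ℚ) where
  private
    b = ½ ℚ.* (ℚ.∣ z ℚ.+ ℚ.- 1ℚ ∣ ℚ.+ ℚ.∣ z ℚ.+ 1ℚ ∣) ℚ.+ (ℚ.- 1ℚ) ℚ.* ℚ.∣ z ∣

  bump-bounded : ℚ.∣ b ∣ ℚ.≤ 1ℚ
  bump-bounded = ∣∣≤
    (≤-by (½ ℚ.* ((v ℚ.+ 1ℚ ℚ.- s) ℚ.+ (v ℚ.+ 1ℚ ℚ.- t)))
      (0≤* (ℚₚ.nonNegative⁻¹ ½) (0≤+ (0≤- (∣+∣≤ {z} {ℚ.- 1ℚ} ℚₚ.≤-refl ℚₚ.≤-refl))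
        (0≤- (∣+∣≤ {z} {1ℚ} ℚₚ.≤-refl ℚₚ.≤-refl))))
      (solve 3 (λ s t v → con 1ℚ := con ½ :* (s :+ t) :+ :- con 1ℚ :* v
        :+ con ½ :* ((v :+ con 1ℚ :- s) :+ (v :+ con 1ℚ :- t))) refl s t v))
    (≤-by (½ ℚ.* ((s ℚ.+ t) ℚ.- (v ℚ.+ v)) ℚ.+ 1ℚ)
      (0≤+ (0≤* (ℚₚ.nonNegative⁻¹ ½) (0≤- v+v≤s+t)) (ℚₚ.nonNegative⁻¹ 1ℚ))
      (solve 3 (λ s t v → con 1ℚ := :- (con ½ :* (s :+ t) :+ :- con 1ℚ :* v)
        :+ (con ½ :* ((s :+ t) :- (v :+ v)) :+ con 1ℚ)) refl s t v))
    where
    s = ℚ.∣ z ℚ.+ ℚ.- 1ℚ ∣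
    t = ℚ.∣ z ℚ.+ 1ℚ ∣
    v = ℚ.∣ z ∣
    2∣z∣ : ℚ.∣ z ℚ.+ z ∣ ≡ v ℚ.+ v
    2∣z∣ = trans (cong ℚ.∣_∣ (solve 1 (λ z → z :+ z := (con 1ℚ :+ con 1ℚ) :* z) refl z))
      (trans (ℚₚ.∣p*q∣≡∣p∣*∣q∣ (1ℚ ℚ.+ 1ℚ) z)
        (solve 1 (λ v → (con 1ℚ :+ con 1ℚ) :* v := v :+ v) refl v))
    v+v≤s+t : v ℚ.+ v ℚ.≤ s ℚ.+ t
    v+v≤s+t = subst (ℚ._≤ s ℚ.+ t)
      (trans (cong ℚ.∣_∣ (solve 1 (λ z → (z :+ :- con 1ℚ) :+ (z :+ con 1ℚ) := z :+ z) refl z)) 2∣z∣)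
      (∣+∣≤ {z ℚ.+ ℚ.- 1ℚ} {z ℚ.+ 1ℚ} ℚₚ.≤-refl ℚₚ.≤-refl)

  bump-0 : z ≡ 0ℚ → b ≡ 1ℚ
  bump-0 refl = refl

  bump-≥1 : 1ℚ ℚ.≤ z → b ≡ 0ℚ
  bump-≥1 1≤z = trans (cong₂ (λ s t → ½ ℚ.* s ℚ.+ (ℚ.- 1ℚ) ℚ.* t)
      (cong₂ ℚ._+_ (ℚₚ.0≤p⇒∣p∣≡p (0≤- 1≤z)) (ℚₚ.0≤p⇒∣p∣≡p (0≤+ 0≤z (ℚₚ.nonNegative⁻¹ 1ℚ))))
      (ℚₚ.0≤p⇒∣p∣≡p 0≤z))
    (solve 1 (λ z → con ½ :* ((z :+ :- con 1ℚ) :+ (z :+ con 1ℚ)) :+ :- con 1ℚ :* z := con 0ℚ) refl z)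
    where 0≤z = ℚₚ.≤-trans (ℚₚ.nonNegative⁻¹ 1ℚ) 1≤z

private
  1≤ι-ι : ∀ {m n} → m ℕ.< n → 1ℚ ℚ.≤ ι n ℚ.- ι m
  1≤ι-ι {m} {n} m<n = ≤-by (ι n ℚ.- ι (suc m)) (0≤- (ι-mono m<n))
    (trans (solve 2 (λ n m → n :- m := con 1ℚ :+ (n :- (con 1ℚ :+ m))) refl (ι n) (ι m))
      (cong (λ t → 1ℚ ℚ.+ (ι n ℚ.- t)) (sym (ι-suc m))))

ι-apart : ∀ {m n} → m ≢ n → 1ℚ ℚ.≤ ℚ.∣ ι m ℚ.+ ℚ.- ι n ∣
ι-apart {m} {n} m≢n = [
  (λ m≤n → ℚₚ.≤-trans (1≤ι-ι (ℕₚ.≤∧≢⇒< m≤n m≢n))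
    (ℚₚ.≤-trans (p≤∣p∣ (ι n ℚ.- ι m)) (ℚₚ.≤-reflexive (∣-∣-comm (ι n) (ι m))))) ,
  (λ n≤m → ℚₚ.≤-trans (1≤ι-ι (ℕₚ.≤∧≢⇒< n≤m (λ n≡m → m≢n (sym n≡m)))) (p≤∣p∣ (ι m ℚ.- ι n))) ]′
  (ℕₚ.≤-total m n)

-- Distinct integers are at least 1 apart, so on integers the bump is either at its peak or zero.
-- The discontinuous event of a pair of pivots thereby becomes accessible to the tests that define
-- independence.
bump-indicator : ∀ r₁ r₂ s₁ s₂ (x : Fin 3 → ℝ) n → seq (x zero) n ≡ ι s₁ → seq (x (suc zero)) n ≡ ι s₂ →
  seq (⟦ bump r₁ r₂ ⟧ x) n ≡ seq (𝟙 ((s₁ ℕₚ.≟ r₁) ×-dec (s₂ ℕₚ.≟ r₂))) n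
bump-indicator r₁ r₂ s₁ s₂ x n x₀≡ x₁≡ = go ((s₁ ℕₚ.≟ r₁) ×-dec (s₂ ℕₚ.≟ r₂))
  where
  z = ℚ.∣ seq (x zero) n ℚ.+ ℚ.- ι r₁ ∣ ℚ.+ ℚ.∣ seq (x (suc zero)) n ℚ.+ ℚ.- ι r₂ ∣
  z≡ : z ≡ ℚ.∣ ι s₁ ℚ.+ ℚ.- ι r₁ ∣ ℚ.+ ℚ.∣ ι s₂ ℚ.+ ℚ.- ι r₂ ∣
  z≡ = cong₂ (λ a b → ℚ.∣ a ℚ.+ ℚ.- ι r₁ ∣ ℚ.+ ℚ.∣ b ℚ.+ ℚ.- ι r₂ ∣) x₀≡ x₁≡
  at-zero : ∀ a b → ℚ.∣ a ℚ.+ ℚ.- a ∣ ℚ.+ ℚ.∣ b ℚ.+ ℚ.- b ∣ ≡ 0ℚ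
  at-zero a b rewrite ℚₚ.+-inverseʳ a | ℚₚ.+-inverseʳ b = refl
  go : (d : Dec (s₁ ≡ r₁ × s₂ ≡ r₂)) → seq (⟦ bump r₁ r₂ ⟧ x) n ≡ seq (𝟙 d) n
  go (yes (refl , refl)) = bump-0 z (trans z≡ (at-zero (ι s₁) (ι s₂)))
  go (no ¬eq) = bump-≥1 z (subst (1ℚ ℚ.≤_) (sym z≡) (apart (s₁ ℕₚ.≟ r₁)))
    where
    apart : Dec (s₁ ≡ r₁) → 1ℚ ℚ.≤ ℚ.∣ ι s₁ ℚ.+ ℚ.- ι r₁ ∣ ℚ.+ ℚ.∣ ι s₂ ℚ.+ ℚ.- ι r₂ ∣
    apart (no s₁≢r₁)  = ℚₚ.≤-trans (ι-apart s₁≢r₁) (≤-by _ (ℚₚ.0≤∣p∣ (ι s₂ ℚ.+ ℚ.- ι r₂)) refl)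
    apart (yes s₁≡r₁) = ℚₚ.≤-trans (ι-apart (λ s₂≡r₂ → ¬eq (s₁≡r₁ , s₂≡r₂)))
      (≤-by _ (ℚₚ.0≤∣p∣ (ι s₁ ℚ.+ ℚ.- ι r₁)) (ℚₚ.+-comm ℚ.∣ ι s₁ ℚ.+ ℚ.- ι r₁ ∣ _))

𝟙-01 : ∀ {P : Set} (d : Dec P) → (∀ n → seq (𝟙 d) n ≡ 1ℚ) ⊎ (∀ n → seq (𝟙 d) n ≡ 0ℚ)
𝟙-01 (yes _) = inj₁ (λ _ → refl)
𝟙-01 (no _)  = inj₂ (λ _ → refl)

bumpᵇ : ℕ → ℕ → BoundedContinuous 3
bumpᵇ r₁ r₂ = record
  { fun = ⟦ bump r₁ r₂ ⟧
  ; bounded = 1ℝ , λ x → ≤-pointwise {∣ ⟦ bump r₁ r₂ ⟧ x ∣} {1ℝ}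
      (λ n → bump-bounded (seq (⟦ distance r₁ r₂ ⟧ x) n))
  ; continuous = tame-continuous (tame (bump r₁ r₂)) }

oneᵇ : BoundedContinuous 1
oneᵇ = record
  { fun = λ _ → 1ℝ
  ; bounded = 1ℝ , λ x → ≤-refl {1ℝ}
  ; continuous = tame-continuous (tame (const 1ℚ)) }

parameters : ℕ → ℕ → Parameters
parameters p q = suc (p ℕ.+ q) , suc p , s≤s z≤n , s≤s (ℕₚ.m≤m+n p q)

-- Averaging over one round

module Round {S : ProbabilitySpace} {F : ℕ → ℕ → ProbabilitySpace.Ω S → ℝ}
  (F-integrable : ∀ par → ProbabilitySpace.Integrable S (restrict F par))
  (p q : ℕ) (1≤s : 1 ℕ.≤ p ℕ.+ q) (round : PartitioningRound S F (suc (p ℕ.+ q))) where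

  open PartitioningRound round
  open ProbabilitySpace space using (Ω; 𝔼; Integrable; HasMean)
  open Expectation space
  private module S = Expectation S

  f : ℕ → ℕ → ℝ
  f i j = ProbabilitySpace.𝔼 S _ (F-integrable (parameters i j))

  private
    n : ℕ
    n = suc (p ℕ.+ q)

    0<D = 0<pairs p q 1≤s
    w = 1/[ 0<D ]⁺

    I : ℕ → ℕ → Ω → ℝ
    I r₁ r₂ ω = 𝟙 ((R₁ ω ℕₚ.≟ r₁) ×-dec (R₂ ω ℕₚ.≟ r₂))

    X : Fin 3 → ℕ → ℕ → Ω → ℝ
    X ℓ i j = restrict (copy ℓ) (parameters i j)

    copy-mean : ∀ ℓ i j → Mean (X ℓ i j) (f i j)
    copy-mean ℓ i j = mean-cong (λ ω → ≈-refl {X ℓ i j ω})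
      (≈-sym {f i j} {𝔼 _ (copy-integrable ℓ (parameters i j))}
        (same-law⇒same-mean S space {e = f i j} {𝔼 _ (copy-integrable ℓ (parameters i j))}
          (λ K c m → fromHasMean (Equivalence.to
            (copy-law ℓ {1} (λ _ → parameters i j) (clampᵇ K) c) (S.Mean.hasMean m)))
          (S.mean (F-integrable (parameters i j))) (mean (copy-integrable ℓ (parameters i j)))))
      (mean (copy-integrable ℓ (parameters i j)))

    1≤D : 1ℚ ℚ.≤ pairs p q
    1≤D = subst (λ t → 1ℚ ℚ.≤ ½ ℚ.* ((1ℚ ℚ.+ t) ℚ.* t)) (ι-+ p q) (≤-by
      (½ ℚ.* ((s ℚ.- 1ℚ) ℚ.* (s ℚ.+ (1ℚ ℚ.+ 1ℚ))))
      (0≤* (ℚₚ.nonNegative⁻¹ ½) (0≤* (0≤- (ι-mono 1≤s)) (0≤+ (0≤ι (p ℕ.+ q)) (ℚₚ.nonNegative⁻¹ (1ℚ ℚ.+ 1ℚ)))))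
      (solve 1 (λ s → con ½ :* ((con 1ℚ :+ s) :* s)
        := con 1ℚ :+ con ½ :* ((s :- con 1ℚ) :* (s :+ (con 1ℚ :+ con 1ℚ)))) refl s))
      where s = ι (p ℕ.+ q)

    w≤1 : w ℚ.≤ 1ℚ
    w≤1 = ≤-by ((pairs p q ℚ.- 1ℚ) ℚ.* w) (0≤* (0≤- 1≤D) (ℚₚ.<⇒≤ (0<1/⁺ 0<D)))
      (trans (sym (*-1/⁺ 0<D)) (solve 2 (λ D w → D :* w := w :+ (D :- con 1ℚ) :* w) refl (pairs p q) w))

    module _ {r₁ r₂ : ℕ} (1≤r₁ : 1 ℕ.≤ r₁) (r₁<r₂ : r₁ ℕ.< r₂) (r₂≤n : r₂ ℕ.≤ n) where
      indicator-mean : Mean (I r₁ r₂) (fromℚ w)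
      indicator-mean =
        let (int , nC2*𝔼≈1) = pivots-uniform r₁ r₂ 1≤r₁ r₁<r₂ r₂≤n
            E = 𝔼 (I r₁ r₂) int
        in mk int (≈-trans {E} {fromℚ w * (fromℕ (n choose 2) * E)} {fromℚ w}
          (≈-pointwise {E} {fromℚ w * (fromℕ (n choose 2) * E)} (λ k → sym (trans
            (cong (λ t → w ℚ.* (t ℚ.* seq E k))
              (trans (ι-C2 (p ℕ.+ q)) (cong (λ t → ½ ℚ.* ((1ℚ ℚ.+ t) ℚ.* t)) (ι-+ p q))))
            (trans (solve 3 (λ w D x → w :* (D :* x) := D :* w :* x) refl w (pairs p q) (seq E k))
              (trans (cong (ℚ._* seq E k) (*-1/⁺ 0<D)) (ℚₚ.*-identityˡ (seq E k)))))))
          (≈-trans {fromℚ w * (fromℕ (n choose 2) * E)} {fromℚ w * 1ℝ} {fromℚ w}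
            (*-congˡ (fromℚ w) {fromℕ (n choose 2) * E} {1ℝ} nC2*𝔼≈1)
            (≈-pointwise {fromℚ w * 1ℝ} {fromℚ w} (λ _ → ℚₚ.*-identityʳ w))))

      private
        Y : Ω → Fin 3 → ℝ
        Y ω i = families R₁ R₂ A copy zero i ω

        bump≡I : ∀ ω k → seq (⟦ bump r₁ r₂ ⟧ (Y ω)) k ≡ seq (I r₁ r₂ ω) k
        bump≡I ω k = bump-indicator r₁ r₂ (R₁ ω) (R₂ ω) (Y ω) k refl refl

        size : Fin 4 → ℕ
        size zero    = 3
        size (suc _) = 1

        index : ℕ → ℕ → ∀ j → Fin (size j) → FamilyIndex j
        index i k zero    = λ j → j
        index i k (suc _) = λ _ → parameters i k

        select : ∀ {A : Set} → Fin 3 → A → A → Fin 3 → A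
        select zero             x y zero             = x
        select zero             x y (suc _)          = y
        select (suc zero)       x y zero             = y
        select (suc zero)       x y (suc zero)       = x
        select (suc zero)       x y (suc (suc zero)) = y
        select (suc (suc zero)) x y zero             = y
        select (suc (suc zero)) x y (suc zero)       = y
        select (suc (suc zero)) x y (suc (suc zero)) = x

      module _ (ℓ : Fin 3) (i k K : ℕ) (c : ℝ)
               (c-mean : Mean (λ ω → fun (clampᵇ K) (λ _ → X ℓ i k ω)) c) where
        private
          φ : ∀ j → BoundedContinuous (size j)
          φ zero    = bumpᵇ r₁ r₂
          φ (suc j) = select ℓ (clampᵇ K) oneᵇ j

          e : Fin 4 → ℝ
          e zero    = fromℚ w
          e (suc j) = select ℓ c 1ℝ j

          -- The variable `ℓ′` allows a case distinction, which lets `select` compute, while `ℓ`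
          -- stays fixed in `c-mean`.
          means : ∀ ℓ′ → ℓ′ ≡ ℓ → ∀ j →
            HasMean (λ ω → fun (select ℓ′ (clampᵇ K) oneᵇ j) (λ _ → X j i k ω)) (select ℓ′ c 1ℝ j)
          means zero             refl zero             = Mean.hasMean c-mean
          means zero             refl (suc j)          = Mean.hasMean mean-1
          means (suc zero)       refl zero             = Mean.hasMean mean-1
          means (suc zero)       refl (suc zero)       = Mean.hasMean c-mean
          means (suc zero)       refl (suc (suc zero)) = Mean.hasMean mean-1
          means (suc (suc zero)) refl zero             = Mean.hasMean mean-1
          means (suc (suc zero)) refl (suc zero)       = Mean.hasMean mean-1
          means (suc (suc zero)) refl (suc (suc zero)) = Mean.hasMean c-mean

          bump-mean : HasMean (λ ω → ⟦ bump r₁ r₂ ⟧ (Y ω)) (fromℚ w)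
          bump-mean = Mean.hasMean (mean-cong {e = fromℚ w} {fromℚ w}
            (λ ω → ≈-pointwise {I r₁ r₂ ω} {⟦ bump r₁ r₂ ⟧ (Y ω)} (λ m → sym (bump≡I ω m)))
            (≈-refl {fromℚ w}) indicator-mean)

          all-means : ∀ j → HasMean (λ ω → fun (φ j) (λ l → families R₁ R₂ A copy j (index i k j l) ω)) (e j)
          all-means zero    = bump-mean
          all-means (suc j) = means ℓ refl j

          C : Ω → ℝ
          C ω = fun (clampᵇ K) (λ _ → X ℓ i k ω)

          factors : ∀ ℓ′ → ℓ′ ≡ ℓ → ∀ ω m →
            seq (∏ (λ j → fun (select ℓ′ (clampᵇ K) oneᵇ j) (λ _ → X j i k ω))) m ≡ seq (C ω) m
          factors zero             refl ω m = ℚₚ.*-identityʳ (seq (C ω) m)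
          factors (suc zero)       refl ω m = trans (ℚₚ.*-identityˡ _) (ℚₚ.*-identityʳ (seq (C ω) m))
          factors (suc (suc zero)) refl ω m = trans (ℚₚ.*-identityˡ _)
            (trans (ℚₚ.*-identityˡ _) (ℚₚ.*-identityʳ (seq (C ω) m)))

          values : ∀ ℓ′ → ℓ′ ≡ ℓ → ∀ m → seq (∏ (select ℓ′ c 1ℝ)) m ≡ seq c m
          values zero             refl m = ℚₚ.*-identityʳ (seq c m)
          values (suc zero)       refl m = trans (ℚₚ.*-identityˡ _) (ℚₚ.*-identityʳ (seq c m))
          values (suc (suc zero)) refl m = trans (ℚₚ.*-identityˡ _)
            (trans (ℚₚ.*-identityˡ _) (ℚₚ.*-identityʳ (seq c m)))

        -- Independence takes a test function for each of the four families at once: the bump for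
        -- the pivots, the clamp for the copy `ℓ`, and the constant 1 for the other two copies,
        -- which then drop out of the product.
        factorisation : Mean (λ ω → I r₁ r₂ ω * fun (clampᵇ K) (λ _ → X ℓ i k ω)) (fromℚ w * c)
        factorisation = mean-cong {e = ∏ e} {fromℚ w * c}
          (λ ω → ≈-pointwise {∏ (λ j → fun (φ j) (λ l → families R₁ R₂ A copy j (index i k j l) ω))}
            {I r₁ r₂ ω * C ω} (λ m → cong₂ ℚ._*_ (bump≡I ω m) (factors ℓ refl ω m)))
          (≈-pointwise {∏ e} {fromℚ w * c} (λ m → cong (w ℚ.*_) (values ℓ refl m)))
          (fromHasMean (independent (index i k) φ e all-means))

      term-mean : ∀ ℓ i k → Mean (λ ω → I r₁ r₂ ω * X ℓ i k ω) (fromℚ w * f i k)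
      term-mean ℓ i k = mean-product (λ ω → 𝟙-01 ((R₁ ω ℕₚ.≟ r₁) ×-dec (R₂ ω ℕₚ.≟ r₂)))
        (Mean.integrable indicator-mean) (copy-integrable ℓ (parameters i k))
        (ℚₚ.<⇒≤ (0<1/⁺ 0<D)) w≤1 (copy-mean ℓ i k)
        (λ K c c-mean → factorisation ℓ i k K c c-mean)

    -- The right-hand side of the recurrence with every summand split up as the event of one pair of
    -- pivots times one fixed member of a copy, so that its mean can be taken term by term.
    total : Ω → ℝ
    total ω = A ω +
      ( sum q (λ k → sum k (λ j → I (suc (suc (p ℕ.+ j))) (suc (suc (p ℕ.+ k))) ω * X zero p j ω))
      + sum p (λ i → sum q (λ k → I (p ℕ.∸ i) (suc (suc (p ℕ.+ k))) ω * X (suc zero) i k ω))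
      + sum p (λ k → sum k (λ j → I (p ℕ.∸ k) (p ℕ.∸ j) ω * X (suc (suc zero)) j q ω)))

    total-mean : Mean total (𝔼 A A-integrable + ∑pivotsℝ (λ i j → fromℚ w * f i j) p q)
    total-mean = mean-+ (mean A-integrable) (mean-+ (mean-+
      (mean-sum q (λ k k<q → mean-sum k (λ j j<k → term-mean (s≤s z≤n)
        (s≤s (s≤s (ℕₚ.+-monoʳ-< p j<k))) (above k<q) zero p j)))
      (mean-sum p (λ i i<p → mean-sum q (λ k k<q → term-mean (ℕₚ.m<n⇒0<n∸m i<p)
        (s≤s (ℕₚ.m≤n⇒m≤1+n (ℕₚ.≤-trans (ℕₚ.m∸n≤m p i) (ℕₚ.m≤m+n p k)))) (above k<q) (suc zero) i k))))
      (mean-sum p (λ k k<p → mean-sum k (λ j j<k → term-mean (ℕₚ.m<n⇒0<n∸m k<p)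
        (ℕₚ.∸-monoʳ-< j<k (ℕₚ.<⇒≤ k<p))
        (ℕₚ.≤-trans (ℕₚ.m∸n≤m p j) (ℕₚ.m≤n⇒m≤1+n (ℕₚ.m≤m+n p q))) (suc (suc zero)) j q))))
      where
      above : ∀ {k} → k ℕ.< q → suc (suc (p ℕ.+ k)) ℕ.≤ n
      above {k} k<q = s≤s (subst (ℕ._≤ p ℕ.+ q) (ℕₚ.+-suc p k) (ℕₚ.+-monoʳ-≤ p k<q))

    recurrent : Ω → ℝ
    recurrent ω = A ω + ∑ (λ ℓ → segmentCost (R ω) (suc p) ℓ (λ j k → copy ℓ j k ω))

    total≡recurrent : ∀ ω N → seq (total ω) N ≡ seq (recurrent ω) N
    total≡recurrent ω N =
      let (1≤R₁ , R₁<R₂ , R₂≤n) = pivots-distinct ω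
          g = λ ℓ j k → copy ℓ j k ω
      in cong (seq (A ω) N ℚ.+_) (sym (regroup
        (segment-above p q (R₁ ω) (R₂ ω) 1≤R₁ R₁<R₂ R₂≤n (g zero) N)
        (segment-middle p q (R₁ ω) (R₂ ω) 1≤R₁ R₁<R₂ R₂≤n (g (suc zero)) N)
        (segment-below p q (R₁ ω) (R₂ ω) 1≤R₁ R₁<R₂ R₂≤n (g (suc (suc zero))) N)))
      where
      regroup : ∀ {a b c a′ b′ c′ : ℚ} → a ≡ a′ → b ≡ b′ → c ≡ c′ →
        a ℚ.+ (b ℚ.+ (c ℚ.+ 0ℚ)) ≡ a′ ℚ.+ b′ ℚ.+ c′
      regroup {a} {b} {c} refl refl refl =
        solve 3 (λ a b c → a :+ (b :+ (c :+ con 0ℚ)) := a :+ b :+ c) refl a b c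

  -- Each pair of pivots has probability `w`, the reciprocal of `pairs p q`; multiplying by the
  -- number of pairs gives all recursive calls the coefficient 1.
  mean-recurrence : fromℚ (pairs p q) * f p q ≈ fromℚ (pairs p q) * 𝔼 A A-integrable + ∑pivotsℝ f p q
  mean-recurrence = ≈-trans {fromℚ D * f p q} {fromℚ D * e} {fromℚ D * 𝔼 A A-integrable + ∑pivotsℝ f p q}
    (*-congˡ (fromℚ D) {f p q} {e} (same-law⇒same-mean S space {e = f p q} {e}
      (λ K c m → fromHasMean (Equivalence.to
        (recurrence (suc p) (s≤s z≤n) (s≤s (ℕₚ.m≤m+n p q)) {1} (λ _ → tt) (clampᵇ K) c) (S.Mean.hasMean m)))
      (S.mean (F-integrable (parameters p q)))
      (mean-cong {e = e} {e} (λ ω → ≈-pointwise {total ω} {recurrent ω} (total≡recurrent ω))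
        (≈-refl {e}) total-mean)))
    (≈-pointwise {fromℚ D * e} {fromℚ D * 𝔼 A A-integrable + ∑pivotsℝ f p q} (λ n → trans
      (cong (λ t → D ℚ.* (seq (𝔼 A A-integrable) n ℚ.+ t)) (trans
        (seq-∑pivots (λ i j → fromℚ w * f i j) p q n) (∑pivots-scale w (λ i j → seq (f i j) n) p q)))
      (trans (solve 4 (λ D a w s → D :* (a :+ w :* s) := D :* a :+ D :* w :* s) refl
          D (seq (𝔼 A A-integrable) n) w (s n))
        (cong (D ℚ.* seq (𝔼 A A-integrable) n ℚ.+_) (trans (cong (ℚ._* s n) (*-1/⁺ 0<D))
          (trans (ℚₚ.*-identityˡ (s n)) (sym (seq-∑pivots f p q n))))))))
    where
    D = pairs p q
    e = 𝔼 A A-integrable + ∑pivotsℝ (λ i j → fromℚ w * f i j) p q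
    s : ℕ → ℚ
    s n = ∑pivots (λ i j → seq (f i j) n) p q

-- The limit

open DualPivotQuickselect

bounded< : (x : ℕ → ℝ) (s : ℕ) → ∃[ K ] 0ℚ ℚ.≤ K × (∀ i → i ℕ.< s → ∣ x i ∣ ≤ fromℚ K)
bounded< x zero    = 0ℚ , ℚₚ.≤-refl , λ i ()
bounded< x (suc s) =
  let (K , 0≤K , below) = bounded< x s
      (L , 0≤L , last)  = upper-bound (x s)
  in K ℚ.+ L , 0≤+ 0≤K 0≤L , λ i i<s → [
      (λ i<s′ → ≤-trans {∣ x i ∣} {fromℚ K} {fromℚ (K ℚ.+ L)} (below i i<s′)
        (≤-pointwise {fromℚ K} {fromℚ (K ℚ.+ L)} (λ _ → ≤-by L 0≤L refl))) ,
      (λ i≡s → ≤-trans {∣ x i ∣} {fromℚ L} {fromℚ (K ℚ.+ L)}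
        (subst (λ j → ∣ x j ∣ ≤ fromℚ L) (sym i≡s) last)
        (≤-pointwise {fromℚ L} {fromℚ (K ℚ.+ L)} (λ _ → ≤-by K 0≤K (ℚₚ.+-comm K L)))) ]′
      (ℕₚ.m≤n⇒m<n∨m≡n (ℕₚ.≤-pred i<s))

bounded<< : (x : ℕ → ℕ → ℝ) (s t : ℕ) →
  ∃[ K ] 0ℚ ℚ.≤ K × (∀ i j → i ℕ.< s → j ℕ.< t → ∣ x i j ∣ ≤ fromℚ K)
bounded<< x s t =
  let row  = λ i → bounded< (x i) t
      (K , 0≤K , below) = bounded< (λ i → fromℚ (proj₁ (row i))) s
  in K , 0≤K , λ i j i<s j<t → ≤-trans {∣ x i j ∣} {fromℚ (proj₁ (row i))} {fromℚ K}
       (proj₂ (proj₂ (row i)) j j<t)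
       (≤-trans {fromℚ (proj₁ (row i))} {∣ fromℚ (proj₁ (row i)) ∣} {fromℚ K}
         (x≤∣x∣ {fromℚ (proj₁ (row i))}) (below i i<s))

lesser : ∀ {a b} → 0ℚ ℚ.< a → 0ℚ ℚ.< b → ∃[ c ] 0ℚ ℚ.< c × c ℚ.≤ a × c ℚ.≤ b
lesser {a} {b} 0<a 0<b = [ (λ a≤b → a , 0<a , ℚₚ.≤-refl , a≤b) , (λ b≤a → b , 0<b , b≤a , ℚₚ.≤-refl) ]′
  (ℚₚ.≤-total a b)

-- Comparison of the expected costs with a G

module _ (Q : DualPivotQuickselect) (a C : ℝ)
  (toll : ∀ n (n₀≤n : n₀ Q ℕ.≤ n) → ∣ 𝔼A Q n n₀≤n - a * fromℕ n ∣ ≤ C) where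

  expected : ℕ → ℕ → ℝ
  expected p q = 𝔼F Q (suc (p ℕ.+ q)) (suc p) (s≤s z≤n) (s≤s (ℕₚ.m≤m+n p q))

  private
    s₀ : ℕ
    -- At least 1, so that two elements exist and the number of pairs of pivots is positive.
    s₀ = n₀ Q ℕ.⊔ 1

    error : ℕ → ℕ → ℝ
    error p q = expected p q - a * fromℚ (leading p q)

    K₁ = proj₁ (bounded<< error s₀ s₀)
    0≤K₁ = proj₁ (proj₂ (bounded<< error s₀ s₀))
    Kₐ = proj₁ (upper-bound a)
    0≤Kₐ = proj₁ (proj₂ (upper-bound a))
    K₂ = proj₁ (upper-bound C)
    0≤K₂ = proj₁ (proj₂ (upper-bound C))

    K : ℚ
    -- `K₁` covers the finitely many inputs with `p + q` below `s₀`; the rest dominates 4 |a| + C,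
    -- the bounded part of the toll.
    K = K₁ ℚ.+ (4ℚ ℚ.* Kₐ ℚ.+ K₂)

    0≤K′ : 0ℚ ℚ.≤ 4ℚ ℚ.* Kₐ ℚ.+ K₂
    0≤K′ = 0≤+ (0≤* (ℚₚ.nonNegative⁻¹ 4ℚ) 0≤Kₐ) 0≤K₂

    0≤K : 0ℚ ℚ.≤ K
    0≤K = 0≤+ 0≤K₁ 0≤K′

    ∣error∣≤ : ∀ p q → p ℕ.+ q ℕ.< s₀ → ∣ error p q ∣ ≤ fromℚ K
    ∣error∣≤ p q s<s₀ = ≤-trans {∣ error p q ∣} {fromℚ K₁} {fromℚ K}
      (proj₂ (proj₂ (bounded<< error s₀ s₀)) p q (ℕₚ.≤-<-trans (ℕₚ.m≤m+n p q) s<s₀)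
        (ℕₚ.≤-<-trans (ℕₚ.m≤n+m q p) s<s₀))
      (≤-pointwise {fromℚ K₁} {fromℚ K} (λ _ → ≤-by (4ℚ ℚ.* Kₐ ℚ.+ K₂) 0≤K′ refl))

    recurrence : ∀ p q → s₀ ℕ.≤ p ℕ.+ q → ∃[ t ]
      ∣ t - a * fromℚ (1ℚ ℚ.+ (ι p ℚ.+ ι q)) ∣ ≤ C ×
      fromℚ (pairs p q) * expected p q ≈ fromℚ (pairs p q) * t + ∑pivotsℝ expected p q
    recurrence p q s₀≤s = 𝔼A Q n n₀≤n ,
      subst (λ x → ∣ 𝔼A Q n n₀≤n - a * fromℚ x ∣ ≤ C)
        (trans (ι-suc (p ℕ.+ q)) (cong (ℚ._+_ 1ℚ) (ι-+ p q))) (toll n n₀≤n) ,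
      Round.mean-recurrence (F-integrable Q) p q (ℕₚ.m⊔n≤o⇒n≤o (n₀ Q) 1 s₀≤s) (round Q n n₀≤n)
      where
      n = suc (p ℕ.+ q)
      n₀≤n = ℕₚ.m≤n⇒m≤1+n (ℕₚ.m⊔n≤o⇒m≤o (n₀ Q) 1 s₀≤s)

    -- σ = 1 and σ = -1 give the upper and the lower bound.
    module _ (σ : ℚ) (∣σ∣≡1 : ℚ.∣ σ ∣ ≡ 1ℚ) where
      sign-∣∣ : ∀ x → ℚ.∣ σ ℚ.* x ∣ ≡ ℚ.∣ x ∣
      sign-∣∣ x = trans (ℚₚ.∣p*q∣≡∣p∣*∣q∣ σ x)
        (trans (cong (ℚ._* ℚ.∣ x ∣) ∣σ∣≡1) (ℚₚ.*-identityˡ ℚ.∣ x ∣))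

      sign-≤ : ∀ x y → σ ℚ.* x ℚ.≤ σ ℚ.* y ℚ.+ ℚ.∣ x ℚ.- y ∣
      sign-≤ x y = ≤-by (ℚ.∣ x ℚ.- y ∣ ℚ.- σ ℚ.* (x ℚ.- y))
        (0≤- (ℚₚ.≤-trans (p≤∣p∣ (σ ℚ.* (x ℚ.- y))) (ℚₚ.≤-reflexive (sign-∣∣ (x ℚ.- y)))))
        (solve 4 (λ s x y v → s :* y :+ v := s :* x :+ (v :- s :* (x :- y))) refl σ x y ℚ.∣ x ℚ.- y ∣)

      sign-bound : ∀ x b g d → ∣ x - b * g ∣ ≤ d → fromℚ σ * x ≤ fromℚ σ * b * g + d
      sign-bound x b g d h = ≤-trans {fromℚ σ * x} {fromℚ σ * b * g + ∣ x - b * g ∣} {fromℚ σ * b * g + d}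
        (≤-pointwise {fromℚ σ * x} {fromℚ σ * b * g + ∣ x - b * g ∣} (λ n →
          subst (λ t → σ ℚ.* seq x n ℚ.≤ t ℚ.+ ℚ.∣ seq x n ℚ.- seq b n ℚ.* seq g n ∣)
            (sym (ℚₚ.*-assoc σ (seq b n) (seq g n))) (sign-≤ (seq x n) (seq b n ℚ.* seq g n))))
        (+-mono-≤ {fromℚ σ * b * g} {fromℚ σ * b * g} {∣ x - b * g ∣} {d} (≤-refl {fromℚ σ * b * g}) h)

      one-sided : ∀ p q → fromℚ σ * expected p q
        ≤ fromℚ σ * a * fromℚ (leading p q) + fromℚ (K ℚ.* logarithmic p q)
      one-sided = comparison (λ i j → fromℚ σ * expected i j) (fromℚ σ * a) C K s₀ 0≤K
        (ℕₚ.m≤n⊔m (n₀ Q) 1)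
        (λ p q s<s₀ → sign-bound (expected p q) a (fromℚ (leading p q)) (fromℚ K) (∣error∣≤ p q s<s₀))
        (≤-trans {∣ fromℚ σ * a ∣ * fromℚ 4ℚ + C} {fromℚ 4ℚ * ∣ a ∣ + ∣ C ∣} {fromℚ K}
          (≤-pointwise {∣ fromℚ σ * a ∣ * fromℚ 4ℚ + C} {fromℚ 4ℚ * ∣ a ∣ + ∣ C ∣} (λ n →
            ℚₚ.+-mono-≤ (ℚₚ.≤-reflexive (trans (ℚₚ.*-comm ℚ.∣ σ ℚ.* seq a n ∣ 4ℚ)
              (cong (ℚ._*_ 4ℚ) (sign-∣∣ (seq a n)))))
              (p≤∣p∣ (seq C n))))
          (≤-trans {fromℚ 4ℚ * ∣ a ∣ + ∣ C ∣} {fromℚ 4ℚ * fromℚ Kₐ + fromℚ K₂} {fromℚ K}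
            (+-mono-≤ {fromℚ 4ℚ * ∣ a ∣} {fromℚ 4ℚ * fromℚ Kₐ} {∣ C ∣} {fromℚ K₂}
              (*-monoˡ-≤ (ℚₚ.positive⁻¹ 4ℚ) {∣ a ∣} {fromℚ Kₐ} (proj₂ (proj₂ (upper-bound a))))
              (proj₂ (proj₂ (upper-bound C))))
            (≤-pointwise {fromℚ 4ℚ * fromℚ Kₐ + fromℚ K₂} {fromℚ K} (λ _ → ≤-by K₁ 0≤K₁ (ℚₚ.+-comm K₁ _)))))
        step
        where
        step : ∀ p q → s₀ ℕ.≤ p ℕ.+ q → fromℚ (pairs p q) * (fromℚ σ * expected p q)
          ≤ fromℚ (pairs p q) * (fromℚ σ * a * fromℚ (1ℚ ℚ.+ (ι p ℚ.+ ι q)) + C)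
            + ∑pivotsℝ (λ i j → fromℚ σ * expected i j) p q
        step p q s₀≤s =
          let (t , t≤ , eq) = recurrence p q s₀≤s
              D = fromℚ (pairs p q)
              0<D = 0<pairs p q (ℕₚ.m⊔n≤o⇒n≤o (n₀ Q) 1 s₀≤s)
              f = expected p q
              n̂ = fromℚ (1ℚ ℚ.+ (ι p ℚ.+ ι q))
              s = ∑pivotsℝ expected p q
              s′ = ∑pivotsℝ (λ i j → fromℚ σ * expected i j) p q
          in ≤-trans {D * (fromℚ σ * f)} {fromℚ σ * (D * f)} {D * (fromℚ σ * a * n̂ + C) + s′}
              (≤-pointwise {D * (fromℚ σ * f)} {fromℚ σ * (D * f)} (λ n → ℚₚ.≤-reflexive
                (solve 3 (λ D s f → D :* (s :* f) := s :* (D :* f)) refl (pairs p q) σ (seq f n))))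
            (≤-trans {fromℚ σ * (D * f)} {fromℚ σ * (D * t + s)} {D * (fromℚ σ * a * n̂ + C) + s′}
              (≈⇒≤ {fromℚ σ * (D * f)} {fromℚ σ * (D * t + s)} (*-congˡ (fromℚ σ) {D * f} {D * t + s} eq))
            (≤-trans {fromℚ σ * (D * t + s)} {D * (fromℚ σ * t) + s′} {D * (fromℚ σ * a * n̂ + C) + s′}
              (≤-pointwise {fromℚ σ * (D * t + s)} {D * (fromℚ σ * t) + s′} (λ n → ℚₚ.≤-reflexive (trans
                (solve 4 (λ σ D t s → σ :* (D :* t :+ s) := D :* (σ :* t) :+ σ :* s) refl
                  σ (pairs p q) (seq t n) (seq s n))
                (cong (pairs p q ℚ.* (σ ℚ.* seq t n) ℚ.+_) (trans
                  (cong (σ ℚ.*_) (seq-∑pivots expected p q n))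
                  (trans (sym (∑pivots-scale σ (λ i j → seq (expected i j) n) p q))
                    (sym (seq-∑pivots (λ i j → fromℚ σ * expected i j) p q n))))))))
              (+-mono-≤ {D * (fromℚ σ * t)} {D * (fromℚ σ * a * n̂ + C)} {s′} {s′}
                (*-monoˡ-≤ 0<D {fromℚ σ * t} {fromℚ σ * a * n̂ + C} (sign-bound t a n̂ C t≤))
                (≤-refl {s′}))))

  expected-leading : ∃[ K ] 0ℚ ℚ.≤ K × (∀ p q →
    ∣ expected p q - a * fromℚ (leading p q) ∣ ≤ fromℚ (K ℚ.* logarithmic p q))
  expected-leading = K , 0≤K , λ p q →
    let f = expected p q
        G = fromℚ (leading p q)
        B = fromℚ (K ℚ.* logarithmic p q)
        bound = λ σ ∣σ∣≡1 → +-mono-≤ {fromℚ σ * f} {fromℚ σ * a * G + B}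
          { - (fromℚ σ * a * G)} { - (fromℚ σ * a * G)}
          (one-sided σ ∣σ∣≡1 p q) (≤-refl { - (fromℚ σ * a * G)})
        side = λ σ → fromℚ σ * f - fromℚ σ * a * G
        side≤B = λ σ ∣σ∣≡1 → ≤-trans {side σ} {fromℚ σ * a * G + B - fromℚ σ * a * G} {B} (bound σ ∣σ∣≡1)
          (≤-pointwise {fromℚ σ * a * G + B - fromℚ σ * a * G} {B} (λ n → ℚₚ.≤-reflexive
            (solve 2 (λ g b → g :+ b :- g := b) refl (seq (fromℚ σ * a * G) n) (seq B n))))
    in ∣∣-≤ {f - a * G} {B}
      (≤-trans {f - a * G} {side 1ℚ} {B} (≤-pointwise {f - a * G} {side 1ℚ} (λ n → ℚₚ.≤-reflexive
        (solve 3 (λ f a g → f :- a :* g := con 1ℚ :* f :- con 1ℚ :* a :* g) refl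
          (seq f n) (seq a n) (leading p q))))
        (side≤B 1ℚ refl))
      (≤-trans { - (f - a * G)} {side (ℚ.- 1ℚ)} {B}
        (≤-pointwise { - (f - a * G)} {side (ℚ.- 1ℚ)} (λ n → ℚₚ.≤-reflexive
        (solve 3 (λ f a g → :- (f :- a :* g) := (:- con 1ℚ) :* f :- (:- con 1ℚ) :* a :* g) refl
          (seq f n) (seq a n) (leading p q))))
        (side≤B (ℚ.- 1ℚ) refl))

-- Division by n and passage to the limit

entropy≡h : ∀ α 0<α α<1 N → seq (h α 0<α α<1) N ≡ entropy N (seq α N)
entropy≡h α 0<α α<1 N = solve 4 (λ y m z m′ → :- (y :* :- m) :+ :- (z :* :- m′) := y :* m :+ z :* m′) refl
  (seq α N) (mercator N (1ℚ ℚ.- seq α N)) (1ℚ ℚ.- seq α N) (mercator N (1ℚ ℚ.- (1ℚ ℚ.- seq α N)))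

logarithmic≤ : ∀ p q → logarithmic p q ℚ.≤ harmonic (suc (p ℕ.+ q)) ℚ.+ harmonic (suc (p ℕ.+ q))
logarithmic≤ p q = ℚₚ.+-mono-≤ (harmonic-mono (s≤s (ℕₚ.m≤m+n p q))) (harmonic-mono (s≤s (ℕₚ.m≤n+m q p)))

combine-errors : ∀ {r f a G v b A η} → 0ℚ ℚ.≤ r → ℚ.∣ f ℚ.- a ℚ.* G ∣ ℚ.≤ b → ℚ.∣ a ∣ ℚ.≤ A →
  ℚ.∣ r ℚ.* G ℚ.- v ∣ ℚ.≤ η → ℚ.∣ r ℚ.* f ℚ.- a ℚ.* v ∣ ℚ.≤ r ℚ.* b ℚ.+ A ℚ.* η
combine-errors {r} {f} {a} {G} {v} {b} {A} {η} 0≤r f-aG a≤A rG-v =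
  subst (λ t → ℚ.∣ t ∣ ℚ.≤ r ℚ.* b ℚ.+ A ℚ.* η)
    (solve 5 (λ r f a G v → r :* (f :- a :* G) :+ a :* (r :* G :- v) := r :* f :- a :* v) refl r f a G v)
    (∣+∣≤ {r ℚ.* (f ℚ.- a ℚ.* G)} {a ℚ.* (r ℚ.* G ℚ.- v)}
      (ℚₚ.≤-trans (ℚₚ.≤-reflexive (trans (ℚₚ.∣p*q∣≡∣p∣*∣q∣ r (f ℚ.- a ℚ.* G))
          (cong (ℚ._* ℚ.∣ f ℚ.- a ℚ.* G ∣) (ℚₚ.0≤p⇒∣p∣≡p 0≤r))))
        (*-monoˡ 0≤r f-aG))
      (ℚₚ.≤-trans (ℚₚ.≤-reflexive (ℚₚ.∣p*q∣≡∣p∣*∣q∣ a (r ℚ.* G ℚ.- v)))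
        (*-mono (ℚₚ.0≤∣p∣ a) a≤A (ℚₚ.0≤∣p∣ (r ℚ.* G ℚ.- v)) rG-v)))

-- A quarter of `q` is divided by M + 1 instead of M, which may be zero.
allowance : ∀ {q} → 0ℚ ℚ.< q → ∀ {M} → 0ℚ ℚ.≤ M →
  ∃[ η ] 0ℚ ℚ.< η × M ℚ.* η ℚ.≤ (+ 1 / 4) ℚ.* q
allowance {q} 0<q {M} 0≤M = e ℚ.* q/4 , 0<* (0<1/⁺ 0<M+1) 0<q/4 ,
  ≤-by (e ℚ.* q/4) (ℚₚ.<⇒≤ (0<* (0<1/⁺ 0<M+1) 0<q/4))
    (trans (sym (ℚₚ.*-identityˡ q/4)) (trans (cong (ℚ._* q/4) (sym (*-1/⁺ 0<M+1)))
      (solve 3 (λ M e x → (M :+ con 1ℚ) :* e :* x := M :* (e :* x) :+ e :* x) refl M e q/4)))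
  where
  q/4 = (+ 1 / 4) ℚ.* q
  0<q/4 : 0ℚ ℚ.< q/4
  0<q/4 = 0<* {+ 1 / 4} {q} (ℚₚ.positive⁻¹ (+ 1 / 4)) 0<q
  0<M+1 : 0ℚ ℚ.< M ℚ.+ 1ℚ
  0<M+1 = ℚₚ.<-≤-trans (ℚₚ.positive⁻¹ 1ℚ) (≤-by M 0≤M (ℚₚ.+-comm M 1ℚ))
  e = 1/[ 0<M+1 ]⁺

limit : (f : ℕ → ℕ → ℝ) (a : ℝ) (K : ℚ) → 0ℚ ℚ.≤ K →
  (∀ p q → ∣ f p q - a * fromℚ (leading p q) ∣ ≤ fromℚ (K ℚ.* logarithmic p q)) →
  ∀ α (0<α : 0ℝ < α) (α<1 : α < 1ℝ) ε → 0ℝ < ε →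
  ∃[ δ ] 0ℝ < δ × (∃[ N ] ∀ p q → N ℕ.≤ suc (p ℕ.+ q) →
    ∣ fromℚ (ι (suc p) ℚ.* 1/[1+ p ℕ.+ q ]) - α ∣ < δ →
    ∣ fromℚ 1/[1+ p ℕ.+ q ] * f p q - a * (fromℚ 3/2 + h α 0<α α<1) ∣ < ε)
limit f a K 0≤K f-aG α 0<α@(c₁ , 0<c₁ , M₁ , c₁≤α) α<1@(c₂ , 0<c₂ , M₂ , α≤1-c₂) ε 0<ε =
  fromℚ δ , fromℚ-< 0<δ , suc (n₁ ℕ.⊔ n₂) , λ p q n≥ x-α →
    let k = p ℕ.+ q
        r = 1/[1+ k ]
        x = ι (suc p) ℚ.* r
        H = harmonic (suc k)
        B = K ℚ.* logarithmic p q
        k≥n₁ = ℕₚ.m⊔n≤o⇒m≤o n₁ n₂ (ℕₚ.≤-pred n≥)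
        k≥n₂ = ℕₚ.m⊔n≤o⇒n≤o n₁ n₂ (ℕₚ.≤-pred n≥)
        (e , 0<e , M₃ , close) = x-α
        close′ : ∀ n → M₃ ℕ.≤ n → ℚ.∣ x ℚ.- seq α n ∣ ℚ.≤ δ
        close′ n n≥ = ℚₚ.≤-trans (≤-by e (ℚₚ.<⇒≤ 0<e) refl) (close n n≥)
        -- Since `x` is rational, one index at which α satisfies all three bounds is enough to place
        -- `x` in [c , 1 - c].
        M₁₂₃ = M₁ ℕ.⊔ M₂ ℕ.⊔ M₃
        y₀ = seq α M₁₂₃
        x-y₀ = close′ M₁₂₃ (ℕₚ.m≤n⊔m (M₁ ℕ.⊔ M₂) M₃)
        c≤x : c ℚ.≤ x
        c≤x = ≤-by ((y₀ ℚ.- c₁) ℚ.+ ((c₁ ℚ.- c′) ℚ.+ ((c ℚ.- δ) ℚ.+ (δ ℚ.- ℚ.- (x ℚ.- y₀)))))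
          (0≤+ (0≤- (c₁≤ M₁₂₃ (ℕₚ.≤-trans (ℕₚ.m≤m⊔n M₁ M₂) (ℕₚ.m≤m⊔n (M₁ ℕ.⊔ M₂) M₃))))
            (0≤+ (0≤- c′≤c₁) (0≤+ (0≤- δ≤c) (0≤- (ℚₚ.≤-trans (-p≤∣p∣ (x ℚ.- y₀)) x-y₀)))))
          (solve 5 (λ x y c₁ c′ δ → x := con ½ :* c′
              :+ ((y :- c₁) :+ ((c₁ :- c′) :+ ((con ½ :* c′ :- δ) :+ (δ :- :- (x :- y))))))
            refl x y₀ c₁ c′ δ)
        x≤1-c : x ℚ.≤ 1ℚ ℚ.- c
        x≤1-c = ≤-by ((1ℚ ℚ.- (y₀ ℚ.+ c₂)) ℚ.+ ((c₂ ℚ.- c′) ℚ.+ ((c ℚ.- δ) ℚ.+ (δ ℚ.- (x ℚ.- y₀)))))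
          (0≤+ (0≤- (α≤1-c₂ M₁₂₃ (ℕₚ.≤-trans (ℕₚ.m≤n⊔m M₁ M₂) (ℕₚ.m≤m⊔n (M₁ ℕ.⊔ M₂) M₃))))
            (0≤+ (0≤- c′≤c₂) (0≤+ (0≤- δ≤c) (0≤- (ℚₚ.≤-trans (p≤∣p∣ (x ℚ.- y₀)) x-y₀)))))
          (solve 5 (λ x y c₂ c′ δ → con 1ℚ :- con ½ :* c′ := x
              :+ ((con 1ℚ :- (y :+ c₂)) :+ ((c₂ :- c′) :+ ((con ½ :* c′ :- δ) :+ (δ :- (x :- y))))))
            refl x y₀ c₂ c′ δ)
        (M₄ , near) = proj₂ (proj₂ (proj₂ lead)) p q k≥n₁ c≤x x≤1-c
        -- An inequality between reals holds for their terms only up to an eventual error; a quarter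
        -- of `q₀` is set aside for it.
        (M₅ , error) = f-aG p q q/4 0<q/4
        N = M₁₂₃ ℕ.⊔ (M₄ ℕ.⊔ (M₅ ℕ.⊔ M₆))
        bound : ∀ n → N ℕ.≤ n →
          seq ∣ fromℚ r * f p q - a * (fromℚ 3/2 + h α 0<α α<1) ∣ n ℚ.≤ q₀
        bound n n≥ =
          let n≥₁₂₃ = ℕₚ.m⊔n≤o⇒m≤o M₁₂₃ (M₄ ℕ.⊔ (M₅ ℕ.⊔ M₆)) n≥
              n≥₄₅₆ = ℕₚ.m⊔n≤o⇒n≤o M₁₂₃ (M₄ ℕ.⊔ (M₅ ℕ.⊔ M₆)) n≥
              n≥₅₆ = ℕₚ.m⊔n≤o⇒n≤o M₄ (M₅ ℕ.⊔ M₆) n≥₄₅₆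
              n≥₁₂ = ℕₚ.m⊔n≤o⇒m≤o (M₁ ℕ.⊔ M₂) M₃ n≥₁₂₃
              y = seq α n
              c≤y : c ℚ.≤ y
              c≤y = ≤-by ((y ℚ.- c₁) ℚ.+ ((c₁ ℚ.- c′) ℚ.+ c))
                (0≤+ (0≤- (c₁≤ n (ℕₚ.m⊔n≤o⇒m≤o M₁ M₂ n≥₁₂))) (0≤+ (0≤- c′≤c₁) (ℚₚ.<⇒≤ 0<c)))
                (solve 3 (λ y c₁ c′ → y := con ½ :* c′
                  :+ ((y :- c₁) :+ ((c₁ :- c′) :+ con ½ :* c′))) refl y c₁ c′)
              y≤1-c : y ℚ.≤ 1ℚ ℚ.- c
              y≤1-c = ≤-by ((1ℚ ℚ.- (y ℚ.+ c₂)) ℚ.+ ((c₂ ℚ.- c′) ℚ.+ c))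
                (0≤+ (0≤- (α≤1-c₂ n (ℕₚ.m⊔n≤o⇒n≤o M₁ M₂ n≥₁₂))) (0≤+ (0≤- c′≤c₂) (ℚₚ.<⇒≤ 0<c)))
                (solve 3 (λ y c₂ c′ → con 1ℚ :- con ½ :* c′ := y
                  :+ ((con 1ℚ :- (y :+ c₂)) :+ ((c₂ :- c′) :+ con ½ :* c′))) refl y c₂ c′)
              near′ : ℚ.∣ r ℚ.* leading p q ℚ.- (3/2 ℚ.+ seq (h α 0<α α<1) n) ∣ ℚ.≤ η
              near′ = subst (λ t → ℚ.∣ r ℚ.* leading p q ℚ.- (3/2 ℚ.+ t) ∣ ℚ.≤ η) (sym (entropy≡h α 0<α α<1 n))
                (near n (ℕₚ.m⊔n≤o⇒m≤o M₄ (M₅ ℕ.⊔ M₆) n≥₄₅₆) y c≤y y≤1-c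
                  (ℚₚ.≤-trans (close′ n (ℕₚ.m⊔n≤o⇒n≤o (M₁ ℕ.⊔ M₂) M₃ n≥₁₂₃)) δ≤δ₁))
          in ℚₚ.≤-trans
            (combine-errors {r} {seq (f p q) n} {seq a n} {leading p q} (0≤1/ k)
              (error n (ℕₚ.m⊔n≤o⇒m≤o M₅ M₆ n≥₅₆)) (a≤A n (ℕₚ.m⊔n≤o⇒n≤o M₅ M₆ n≥₅₆)) near′)
            -- One quarter pays for the supersolution, through H n / n, one for the distance of G /
            -- n from its limit and one for the eventual error; the last is spare.
            (≤-by ((q/4 ℚ.- K ℚ.* 2ℚ ℚ.* η₂) ℚ.+ (K ℚ.* 2ℚ ℚ.* (η₂ ℚ.- H ℚ.* r)
                ℚ.+ (K ℚ.* (H ℚ.+ H ℚ.- logarithmic p q) ℚ.* r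
                ℚ.+ ((q/4 ℚ.- A ℚ.* η) ℚ.+ ((1ℚ ℚ.- r) ℚ.* q/4 ℚ.+ q/4)))))
              (0≤+ (0≤- Kη₂≤) (0≤+ (0≤* (0≤* 0≤K (ℚₚ.nonNegative⁻¹ 2ℚ)) (0≤- (proj₂ sub k k≥n₂)))
                (0≤+ (0≤* (0≤* 0≤K (0≤- (logarithmic≤ p q))) (0≤1/ k))
                  (0≤+ (0≤- Aη≤) (0≤+ (0≤* (0≤- (1/≤1 k)) (ℚₚ.<⇒≤ 0<q/4)) (ℚₚ.<⇒≤ 0<q/4))))))
              (solve 8 (λ q K η₂ H r L A η → let q/4 = con (+ 1 / 4) :* q in
                q := r :* (K :* L :+ q/4) :+ A :* η
                  :+ ((q/4 :- K :* con 2ℚ :* η₂) :+ (K :* con 2ℚ :* (η₂ :- H :* r) :+ (K :* (H :+ H :- L) :* r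
                    :+ ((q/4 :- A :* η) :+ ((con 1ℚ :- r) :* q/4 :+ q/4))))))
                refl q₀ K η₂ H r (logarithmic p q) A η))
    in ≤-<-trans {∣ fromℚ r * f p q - a * (fromℚ 3/2 + h α 0<α α<1) ∣} {fromℚ q₀} {ε}
         (λ e 0<e → N , λ n n≥ → ℚₚ.≤-trans (bound n n≥) (≤-by e (ℚₚ.<⇒≤ 0<e) refl)) q₀<ε
  where
  2ℚ = + 2 / 1
  q₀ = proj₁ (rational-below {ε} 0<ε)
  0<q₀ = proj₁ (proj₂ (rational-below {ε} 0<ε))
  q₀<ε = proj₂ (proj₂ (rational-below {ε} 0<ε))
  q/4 = (+ 1 / 4) ℚ.* q₀
  0<q/4 : 0ℚ ℚ.< q/4
  0<q/4 = 0<* {+ 1 / 4} {q₀} (ℚₚ.positive⁻¹ (+ 1 / 4)) 0<q₀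
  c′ = proj₁ (lesser 0<c₁ 0<c₂)
  c′≤c₁ = proj₁ (proj₂ (proj₂ (lesser 0<c₁ 0<c₂)))
  c′≤c₂ = proj₂ (proj₂ (proj₂ (lesser 0<c₁ 0<c₂)))
  -- The terms of α eventually keep the distance `c′` from 0 and 1. Half of this margin is given to
  -- `x`, which is within `δ ≤ c` of them.
  c = ½ ℚ.* c′
  0<c = ½-pos (proj₁ (proj₂ (lesser 0<c₁ 0<c₂)))
  c₁≤ : ∀ n → M₁ ℕ.≤ n → c₁ ℚ.≤ seq α n
  c₁≤ n n≥ = subst (ℚ._≤ seq α n) (ℚₚ.+-identityˡ c₁) (c₁≤α n n≥)
  aᵇ = upper-bound a
  A = proj₁ aᵇ ℚ.+ 1ℚ
  M₆ = proj₁ (proj₂ (proj₂ aᵇ) 1ℚ (ℚₚ.positive⁻¹ 1ℚ))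
  a≤A : ∀ n → M₆ ℕ.≤ n → ℚ.∣ seq a n ∣ ℚ.≤ A
  a≤A = proj₂ (proj₂ (proj₂ aᵇ) 1ℚ (ℚₚ.positive⁻¹ 1ℚ))
  allowance-A = allowance 0<q₀ {A} (0≤+ (proj₁ (proj₂ aᵇ)) (ℚₚ.nonNegative⁻¹ 1ℚ))
  η = proj₁ allowance-A
  Aη≤ = proj₂ (proj₂ allowance-A)
  allowance-K = allowance 0<q₀ {K ℚ.* 2ℚ} (0≤* 0≤K (ℚₚ.nonNegative⁻¹ 2ℚ))
  η₂ = proj₁ allowance-K
  Kη₂≤ = proj₂ (proj₂ allowance-K)
  lead = leading-limit 0<c η (proj₁ (proj₂ allowance-A))
  δ₁ = proj₁ lead
  n₁ = proj₁ (proj₂ (proj₂ lead))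
  sub = harmonic-sublinear η₂ (proj₁ (proj₂ allowance-K))
  n₂ = proj₁ sub
  δᶜ = lesser 0<c (proj₁ (proj₂ lead))
  δ = proj₁ δᶜ
  0<δ = proj₁ (proj₂ δᶜ)
  δ≤c = proj₁ (proj₂ (proj₂ δᶜ))
  δ≤δ₁ = proj₂ (proj₂ (proj₂ δᶜ))

mainTheorem4 : (Q : DualPivotQuickselect) (a : ℝ) →
    (∃[ C ] ∀ n (n₀≤n : n₀ Q ℕ.≤ n) → ∣ 𝔼A Q n n₀≤n - a * fromℕ n ∣ ≤ C) →
    ∀ (α : ℝ) (0<α : 0ℝ < α) (α<1 : α < 1ℝ) →
    ∀ ε → 0ℝ < ε →
    ∃[ δ ] 0ℝ < δ × (∃[ N ]
    ∀ n m .{{_ : NonZero n}} (1≤m : 1 ℕ.≤ m) (m≤n : m ℕ.≤ n) →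
    N ℕ.≤ n → ∣ fromℚ (+ m / n) - α ∣ < δ →
    ∣ fromℚ (+ 1 / n) * 𝔼F Q n m 1≤m m≤n - a * (fromℚ (+ 3 / 2) + h α 0<α α<1) ∣ < ε)
mainTheorem4 Q a (C , toll) α 0<α α<1 ε 0<ε = δ , proj₁ (proj₂ lim) , N ,
  λ { n (suc p) (s≤s z≤n) p<n → let (q , eq) = ℕₚ.m≤n⇒∃[o]m+o≡n p<n in at p q p<n eq }
  where
  leading-error = expected-leading Q a C toll
  lim = limit (expected Q a C toll) a (proj₁ leading-error) (proj₁ (proj₂ leading-error))
          (proj₂ (proj₂ leading-error)) α 0<α α<1 ε 0<ε
  δ = proj₁ lim
  N = proj₁ (proj₂ (proj₂ lim))
  v = a * (fromℚ 3/2 + h α 0<α α<1)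
  at : ∀ p q {n} .{{_ : NonZero n}} (p<n : suc p ℕ.≤ n) → suc p ℕ.+ q ≡ n → N ℕ.≤ n →
    ∣ fromℚ (+ suc p / n) - α ∣ < δ → ∣ fromℚ (+ 1 / n) * 𝔼F Q n (suc p) (s≤s z≤n) p<n - v ∣ < ε
  -- `𝔼F` takes a proof of `m ≤ n`, and `expected` was defined with a particular one; all such
  -- proofs are equal.
  at p q p<n refl N≤n near = subst
    (λ m≤n → ∣ fromℚ 1/[1+ p ℕ.+ q ] * 𝔼F Q (suc (p ℕ.+ q)) (suc p) (s≤s z≤n) m≤n - v ∣ < ε)
    (ℕₚ.≤-irrelevant _ p<n)
    (proj₂ (proj₂ (proj₂ lim)) p q N≤n
      (subst (λ x → ∣ fromℚ x - α ∣ < δ) (/≡*1/ (suc p) (p ℕ.+ q)) near))
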